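{- Let $q=2^n$ with $n\ge 3$, let $h$ be a positive integer with $\gcd(n,h)=1$, let $q\equiv\xi\pmod 3$ with $\xi\in\{1,-1\}$, and let the point classes $\mathcal O_i$ and the plane classes $\mathcal O_d^{\mathfrak s}$ of $\mathrm{PG}(3,q)$ be as defined in the context. Through every point of $\mathcal O_0$ there pass exactly $r_{0,d}$ planes of $\mathcal O_d^{\mathfrak s}$, and through every point of $\mathcal O_3$ there pass exactly $r_{3,d}$ planes of $\mathcal O_d^{\mathfrak s}$, where $$r_{0,d}=\begin{cases}0&\text{if } d=q+1,\\ \frac{q^2+\xi q+1}3&\text{if } d=0,\\ \frac{q(q-\xi)}2&\text{if } d=1,\\ q+1&\text{if } d=2,\\ \frac{q^2+\xi q-2}6&\text{if } d=3,\end{cases}\qquad r_{3,d}=\begin{cases}3&\text{if } d=q+1,\\ \frac{q^2+\xi q-2}3&\text{if } d=0,\\ \frac{q(q-\xi)}2&\text{if } d=1,\\ q-2&\text{if } d=2,\\ \frac{q^2+\xi q+4}6&\text{if } d=3.\end{cases}$$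
   Context: Points of $\mathrm{PG}(3,q)$ have homogeneous coordinates $(X_1,X_2,X_3,X_4)$; $U_i$ is the point with $1$ in position $i$ and $0$ elsewhere. $\mathcal A=\{P_t=(1,t,t^{2^h},t^{2^h+1})\mid t\in\mathbb F_q\}\cup\{U_4\}$. $\mathfrak s$ is the symplectic polarity of $\mathrm{PG}(3,q)$ defined by the alternating form $x_1y_4+x_2y_3+x_3y_2+x_4y_1$. The osculating planes are the $q+1$ planes $P^{\mathfrak s}$, $P\in\mathcal A$. Put $\mathcal O_{q+1}=\mathcal A$; for $i\in\{0,1,2,3\}$, $\mathcal O_i$ is the set of points of $\mathrm{PG}(3,q)\setminus\mathcal A$ lying on exactly $i$ osculating planes. For $i\in\{0,1,2,3,q+1\}$, $\mathcal O_i^{\mathfrak s}=\{P^{\mathfrak s}\mid P\in\mathcal O_i\}$ (so $\mathcal O_{q+1}^{\mathfrak s}$ is the set of osculating planes). -}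

module Defs where

open import Level using (Level; _⊔_; suc)
open import Algebra.Bundles using (CommutativeRing)
import Algebra.Definitions as AlgDefs
import Algebra.Properties.Semiring.Exp as Exp
open import Data.Nat.Base as ℕ using (ℕ)
open import Data.Integer.Base using (ℤ; +_)
open import Data.Rational.Unnormalised.Base using (ℚᵘ; _/_; _≃_)
open import Data.Fin.Base using (Fin; opposite)
open import Data.Fin.Patterns using (0F; 1F; 2F; 3F)
open import Data.Fin.Properties using (opposite-involutive)
open import Data.Vec.Functional using (Vector; []; _∷_)
open import Data.Product.Base using (Σ; ∃; ∃-syntax; _×_; _,_; proj₁)
open import Data.Sum.Base using (_⊎_)
open import Function.Bundles using (Inverse)
open import Relation.Binary.Bundles using (Setoid)
import Relation.Binary.Construct.On as On
open import Relation.Binary.PropositionalEquality as ≡ using (_≡_)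
open import Relation.Nullary.Negation using (¬_)
open import Relation.Unary using (Pred)

private
  variable
    a p c ℓ : Level

-- The set of elements of S satisfying P; membership proofs are ignored
-- when comparing elements.
Subsetoid : (S : Setoid a ℓ) → Pred (Setoid.Carrier S) p → Setoid (a ⊔ p) ℓ
Subsetoid S P = On.setoid S (proj₁ {B = P})

HasCardinality : Setoid a ℓ → ℕ → Set (a ⊔ ℓ)
HasCardinality S k = Inverse S (≡.setoid (Fin k))

-- The cardinality of S is a natural number k that equals the rational r;
-- in particular r is asserted to be a natural number (no rounding).
HasCardinalityℚ : Setoid a ℓ → ℚᵘ → Set (a ⊔ ℓ)
HasCardinalityℚ S r = ∃[ k ] ((+ k) / 1 ≃ r) × HasCardinality S k

record Field c ℓ : Set (suc (c ⊔ ℓ)) where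
  field
    commutativeRing : CommutativeRing c ℓ

  open CommutativeRing commutativeRing public
  open AlgDefs _≈_ using (Invertible)

  field
    1≉0     : ¬ (1# ≈ 0#)
    inverse : ∀ x → ¬ (x ≈ 0#) → Invertible 1# _*_ x

-- Index set {0, 1, 2, 3, q+1} of the point and plane classes.
data Class : Set where
  c0 c1 c2 c3 cq+1 : Class

module PG3 (F : Field c ℓ) where

  private
    module F = Field F
    open F using (Carrier; _≈_; 0#; 1#)

  record Homogeneous : Set (c ⊔ ℓ) where
    constructor homogeneous
    field
      coord   : Vector Carrier 4
      nonzero : ∃[ i ] ¬ (coord i ≈ 0#)

  open Homogeneous public

  Proportional : Homogeneous → Homogeneous → Set (c ⊔ ℓ)
  Proportional x y =
    ∃[ s ] (¬ (s ≈ 0#)) × (∀ i → coord x i ≈ s F.* coord y i)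

  ℙ : Setoid (c ⊔ ℓ) (c ⊔ ℓ)
  ℙ = record
    { Carrier       = Homogeneous
    ; _≈_           = Proportional
    ; isEquivalence = record
      { refl  = 1# , F.1≉0 , λ i → F.sym (F.*-identityˡ _)
      ; sym   = λ {x} {y} (s , s≉0 , x≈sy) →
          let (t , ts≈1 , _) = F.inverse s s≉0 in
            t
          , (λ t≈0 → F.1≉0 (F.trans (F.sym ts≈1)
                       (F.trans (F.*-congʳ t≈0) (F.zeroˡ s))))
          , λ i → F.sym (F.trans (F.*-congˡ (x≈sy i))
                    (F.trans (F.sym (F.*-assoc t s _))
                      (F.trans (F.*-congʳ ts≈1) (F.*-identityˡ _))))
      ; trans = λ {x} {y} {z} (s , s≉0 , x≈sy) (t , t≉0 , y≈tz) →
            s F.* t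
          , (λ st≈0 →
              let (u , us≈1 , _) = F.inverse s s≉0 in
              t≉0 (F.trans (F.sym (F.*-identityˡ t))
                    (F.trans (F.*-congʳ (F.sym us≈1))
                      (F.trans (F.*-assoc u s t)
                        (F.trans (F.*-congˡ st≈0) (F.zeroʳ u))))))
          , λ i → F.trans (x≈sy i)
                    (F.trans (F.*-congˡ (y≈tz i)) (F.sym (F.*-assoc s t _)))
      }
    }

  Points : Setoid (c ⊔ ℓ) (c ⊔ ℓ)
  Points = ℙ

  -- The plane a₁X₁ + a₂X₂ + a₃X₃ + a₄X₄ = 0 is given by the homogeneous
  -- coordinates [a₁ : a₂ : a₃ : a₄] of its equation.
  Planes : Setoid (c ⊔ ℓ) (c ⊔ ℓ)
  Planes = ℙ

  Point Plane : Set (c ⊔ ℓ)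
  Point = Setoid.Carrier Points
  Plane = Setoid.Carrier Planes

  open Setoid Points public using () renaming (_≈_ to _≈ᴾ_)
  open Setoid Planes public using () renaming (_≈_ to _≈ᴴ_)

  infix 4 _liesOn_

  _liesOn_ : Point → Plane → Set ℓ
  X liesOn π =
    (x 0F F.* u 0F) F.+ (x 1F F.* u 1F) F.+ (x 2F F.* u 2F) F.+ (x 3F F.* u 3F)
      ≈ 0#
    where
    x = coord X
    u = coord π

  -- Alternating only in characteristic 2, the case in which it is used.
  form : Vector Carrier 4 → Vector Carrier 4 → Carrier
  form x y =
    (x 0F F.* y 3F) F.+ (x 1F F.* y 2F) F.+ (x 2F F.* y 1F) F.+ (x 3F F.* y 0F)

  -- The plane {X | form X P = 0}, with coordinates [y₄ : y₃ : y₂ : y₁] for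
  -- P = (y₁, y₂, y₃, y₄).
  infix 30 _^𝔰

  _^𝔰 : Point → Plane
  (P ^𝔰) .coord i = coord P (opposite i)
  (P ^𝔰) .nonzero with nonzero P
  ... | i , yᵢ≉0 = opposite i , λ eq →
    yᵢ≉0 (≡.subst (λ j → coord P j ≈ 0#) (opposite-involutive i) eq)

  liesOn-polar : ∀ X P → (X liesOn P ^𝔰) ≡ (form (coord X) (coord P) ≈ 0#)
  liesOn-polar X P = ≡.refl

  U₄ : Point
  U₄ = homogeneous (0# ∷ 0# ∷ 0# ∷ 1# ∷ []) (3F , F.1≉0)

  module Arc (h : ℕ) where

    open Exp F.semiring using (_^_)

    P⟨_⟩ : Carrier → Point
    P⟨ t ⟩ = homogeneous
      (1# ∷ t ∷ t ^ (2 ℕ.^ h) ∷ t ^ (2 ℕ.^ h ℕ.+ 1) ∷ []) (0F , F.1≉0)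

    𝒜 : Pred Point (c ⊔ ℓ)
    𝒜 P = (∃[ t ] P ≈ᴾ P⟨ t ⟩) ⊎ (P ≈ᴾ U₄)

    Osculating : Pred Plane (c ⊔ ℓ)
    Osculating π = ∃[ P ] 𝒜 P × (π ≈ᴴ P ^𝔰)

    OnExactlyOsculating : ℕ → Pred Point (c ⊔ ℓ)
    OnExactlyOsculating i Q =
      HasCardinality (Subsetoid Planes (λ π → Osculating π × Q liesOn π)) i

    𝒪 : Class → Pred Point (c ⊔ ℓ)
    𝒪 c0   P = ¬ 𝒜 P × OnExactlyOsculating 0 P
    𝒪 c1   P = ¬ 𝒜 P × OnExactlyOsculating 1 P
    𝒪 c2   P = ¬ 𝒜 P × OnExactlyOsculating 2 P
    𝒪 c3   P = ¬ 𝒜 P × OnExactlyOsculating 3 P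
    𝒪 cq+1 P = 𝒜 P

    𝒪^𝔰 : Class → Pred Plane (c ⊔ ℓ)
    𝒪^𝔰 d π = ∃[ P ] 𝒪 d P × (π ≈ᴴ P ^𝔰)

    PlanesThrough : Class → Point → Setoid (c ⊔ ℓ) (c ⊔ ℓ)
    PlanesThrough d Q = Subsetoid Planes (λ π → 𝒪^𝔰 d π × Q liesOn π)

open import Data.Integer.Base using (_+_; _-_; _*_)

r₀ r₃ : (q ξ : ℤ) → Class → ℚᵘ

r₀ q ξ cq+1 = + 0 / 1
r₀ q ξ c0   = (q * q + ξ * q + + 1) / 3
r₀ q ξ c1   = (q * (q - ξ)) / 2
r₀ q ξ c2   = (q + + 1) / 1
r₀ q ξ c3   = (q * q + ξ * q - + 2) / 6

r₃ q ξ cq+1 = + 3 / 1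
r₃ q ξ c0   = (q * q + ξ * q - + 2) / 3
r₃ q ξ c1   = (q * (q - ξ)) / 2
r₃ q ξ c2   = (q - + 2) / 1
r₃ q ξ c3   = (q * q + ξ * q + + 4) / 6

module Submission where

-- Let σ be the automorphism t ↦ t^(2^h) of 𝔽_q. A point x of PG(3,q) is a
-- nonzero form B x v w, σ-linear in v and linear in w, on 𝔽_q²; the arc 𝒜
-- consists of the tensors σ(t) ⊗ t, and x lies on the osculating plane at t
-- exactly when B x t t = 0. The number of such t is 1 on 𝒜, 2 on the rest of the
-- quadric det = 0 and 0, 1 or 3 off the quadric, because a root moved to infinity
-- leaves an equation a σ(t) + b t + c = 0 with a, b ≠ 0, which has 0 or 2 roots.
--
-- Let x be off the quadric, with polar plane H. The plane H meets the quadric in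
-- q + 1 points, and counting in H the points, the incidences with one osculating
-- plane and the incidences with two distinct ones expresses every class size
-- through m, the number of ordered pairs (s , t), s ≠ t, such that x lies on the
-- chord of 𝒜 through s and t; this means B x s t = B x t s = 0. At most one chord
-- of 𝒜 passes through x, since σ fixes only 0 and 1; hence m ≤ 2. Finally the
-- number of points of the class 𝒪₃ in H is an integer, which modulo 3 forces
-- m = ξ + 1.
open import Defs
open import Level using (Level; 0ℓ)
open import Algebra.Bundles using (CommutativeRing; RawRing)
open import Algebra.Core using (Op₁; Op₂)
open import Algebra.Morphism.Structures using (IsRingMonomorphism)
import Algebra.Morphism.RingMonomorphism as RingMonomorphism
import Algebra.Properties.CommutativeMonoid.Sum as MonoidSum
import Algebra.Properties.CommutativeSemiring.Exp as CommutativePower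
import Algebra.Properties.Ring as RingProperties
import Algebra.Properties.Semiring.Exp as Power
import Algebra.Properties.Semiring.Mult as Multiple
import Algebra.Solver.Ring
open import Algebra.Solver.Ring.AlmostCommutativeRing
  using (fromCommutativeRing; _-Raw-AlmostCommutative⟶_)
open import Algebra.Structures using (IsCommutativeRing)
open import Data.Bool.Base using (Bool; true; false; if_then_else_; _xor_; _∧_)
import Data.Bool.Properties as Boolₚ
open import Data.Fin.Base using (Fin; zero; suc; opposite; punchIn)
open import Data.Fin.Patterns using (0F; 1F; 2F; 3F)
open import Data.Fin.Permutation using (Permutation′; permutation; ↔⇒≡)
import Data.Fin.Properties as Finₚ
open import Data.List.Base as List
  using (List; []; _∷_; _++_; allFin; cartesianProductWith; filter; length; lookup; map)
open import Data.List.Membership.Propositional using (_∈_)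
open import Data.List.Membership.Propositional.Properties
  using (∈-allFin; ∈-cartesianProductWith⁺; ∈-filter⁺; ∈-filter⁻; ∈-lookup; ∈-map⁺; ∈-map⁻; ∈-++⁺ˡ; ∈-++⁺ʳ; ∈-++⁻)
open import Data.List.Properties using (length-tabulate)
import Data.List.Relation.Unary.All as All
open import Data.List.Relation.Unary.Any using (here; there; index)
open import Data.List.Relation.Unary.Any.Properties using (lookup-index)
open import Data.List.Relation.Unary.Unique.Propositional using (Unique; []; _∷_)
import Data.List.Relation.Unary.Unique.Propositional.Properties as Uniqueₚ
import Data.Maybe.Base as Maybe
open import Data.Nat as ℕ using (ℕ; zero; suc)
open import Data.Nat.GCD using (gcd; gcd-GCD; module Bézout)

import Data.Nat.Properties as ℕₚ
open import Data.Nat.Solver using (module +-*-Solver)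
open import Data.Product.Base using (∃; _×_; _,_; proj₁; proj₂)
open import Data.Sum.Base using (_⊎_; inj₁; inj₂; [_,_])
open import Data.Vec.Base as Vec using (Vec; []; _∷_; replicate)
import Data.Vec.Properties as Vecₚ
open import Function.Base using (_∘_; id)
open import Function.Bundles using (Inverse)
import Function.Construct.Composition as Composition
import Function.Construct.Symmetry as Symmetry
open import Function.Definitions using (Injective)
open import Relation.Binary.Bundles using (Setoid)
open import Relation.Binary.Definitions using (DecidableEquality)
open import Relation.Binary.PropositionalEquality hiding ([_])
open import Relation.Nullary using (Dec; yes; no; does; ¬_; contradiction; ¬?; _×-dec_)
open import Relation.Nullary.Decidable using (dec⇒maybe; from-no)
open import Relation.Unary using (Pred; Decidable)

-- A plane passes through Q exactly when its pole lies in the polar plane of Q, so the planes of one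
-- class through Q become the points of one class in a single plane. Vectors are counted before
-- points: a change of basis by `frame` permutes the vectors but not the chosen representatives of
-- points, and division by q - 1 comes at the end. Every count is a sum of 0/1 indicators over an
-- explicit list, which needs decidable equality; the given field is only a setoid, so the work is
-- done in an isomorphic copy with carrier `Fin q`.
--
-- The five class sizes satisfy five linear equations in which m is the only parameter not known
-- beforehand. Whether x lies on a chord is never decided by algebra in the field; integrality of a
-- class size replaces that step. It suffices because the number of osculating planes through x,
-- being 0 or 3, vanishes modulo 3, and because among 0, 1, 2 each residue modulo 3 occurs once.

-- Finite sums over lists and indicator functions

module Summation where

  open import Data.Nat.Base using (_+_; _*_; _≤_; z≤n; s≤s)
  open import Data.Nat.ListAction using (sum)
  open import Algebra.Properties.CommutativeSemigroup ℕₚ.+-commutativeSemigroup using (interchange)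

  private
    variable
      a b p : Level
      A B C : Set a
      P Q : Set p

  𝟙 : Dec P → ℕ
  𝟙 d = if does d then 1 else 0

  𝟙-yes : (d : Dec P) → P → 𝟙 d ≡ 1
  𝟙-yes (yes _) _ = refl
  𝟙-yes (no ¬p) p = contradiction p ¬p

  𝟙-no : (d : Dec P) → ¬ P → 𝟙 d ≡ 0
  𝟙-no (yes p) ¬p = contradiction p ¬p
  𝟙-no (no _) _ = refl

  𝟙-⇔ : (d : Dec P) (e : Dec Q) → (P → Q) → (Q → P) → 𝟙 d ≡ 𝟙 e
  𝟙-⇔ (yes p) e f g = sym (𝟙-yes e (f p))
  𝟙-⇔ (no ¬p) e f g = sym (𝟙-no e (¬p ∘ g))

  𝟙-× : (d : Dec P) (e : Dec Q) → 𝟙 (d ×-dec e) ≡ 𝟙 d * 𝟙 e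
  𝟙-× (yes _) (yes _) = refl
  𝟙-× (yes _) (no _) = refl
  𝟙-× (no _) _ = refl

  𝟙≢0 : (d : Dec P) → 𝟙 d ≢ 0 → P
  𝟙≢0 (yes p) _ = p
  𝟙≢0 (no _) ≢0 = contradiction refl ≢0

  𝟙+𝟙¬ : (d : Dec P) → 𝟙 d + 𝟙 (¬? d) ≡ 1
  𝟙+𝟙¬ (yes _) = refl
  𝟙+𝟙¬ (no _) = refl

  ∑ : List A → (A → ℕ) → ℕ
  ∑ xs f = sum (map f xs)

  syntax ∑ xs (λ x → e) = ∑[ x ∈ xs ] e

  ∑-cong-∈ : {f g : A → ℕ} (xs : List A) → (∀ x → x ∈ xs → f x ≡ g x) → ∑ xs f ≡ ∑ xs g
  ∑-cong-∈ [] eq = refl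
  ∑-cong-∈ (x ∷ xs) eq = cong₂ _+_ (eq x (here refl)) (∑-cong-∈ xs (λ y y∈ → eq y (there y∈)))

  ∑-cong : {f g : A → ℕ} (xs : List A) → (∀ x → f x ≡ g x) → ∑ xs f ≡ ∑ xs g
  ∑-cong xs eq = ∑-cong-∈ xs (λ x _ → eq x)

  ∑-+ : (xs : List A) (f g : A → ℕ) → ∑[ x ∈ xs ] (f x + g x) ≡ ∑ xs f + ∑ xs g
  ∑-+ [] f g = refl
  ∑-+ (x ∷ xs) f g = trans (cong (f x + g x +_) (∑-+ xs f g)) (interchange (f x) (g x) _ _)

  ∑-*ˡ : (xs : List A) (k : ℕ) (f : A → ℕ) → ∑[ x ∈ xs ] (k * f x) ≡ k * ∑ xs f
  ∑-*ˡ [] k f = sym (ℕₚ.*-zeroʳ k)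
  ∑-*ˡ (x ∷ xs) k f = trans (cong (k * f x +_) (∑-*ˡ xs k f)) (sym (ℕₚ.*-distribˡ-+ k (f x) _))

  ∑-*ʳ : (xs : List A) (k : ℕ) (f : A → ℕ) → ∑[ x ∈ xs ] (f x * k) ≡ ∑ xs f * k
  ∑-*ʳ xs k f = trans (∑-cong xs (λ x → ℕₚ.*-comm (f x) k))
    (trans (∑-*ˡ xs k f) (ℕₚ.*-comm k _))

  ∑-zero : (xs : List A) → ∑[ x ∈ xs ] 0 ≡ 0
  ∑-zero [] = refl
  ∑-zero (x ∷ xs) = ∑-zero xs

  ∑-const : (xs : List A) (k : ℕ) → ∑[ x ∈ xs ] k ≡ length xs * k
  ∑-const [] k = refl
  ∑-const (x ∷ xs) k = cong (k +_) (∑-const xs k)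

  ∑-swap : (xs : List A) (ys : List B) (f : A → B → ℕ) →
           ∑[ x ∈ xs ] ∑[ y ∈ ys ] f x y ≡ ∑[ y ∈ ys ] ∑[ x ∈ xs ] f x y
  ∑-swap [] ys f = sym (∑-zero ys)
  ∑-swap (x ∷ xs) ys f = trans (cong (∑ ys (f x) +_) (∑-swap xs ys f))
    (sym (∑-+ ys (f x) _))

  ∑-mono-∈ : {f g : A → ℕ} (xs : List A) → (∀ x → x ∈ xs → f x ≤ g x) → ∑ xs f ≤ ∑ xs g
  ∑-mono-∈ [] le = z≤n
  ∑-mono-∈ (x ∷ xs) le = ℕₚ.+-mono-≤ (le x (here refl)) (∑-mono-∈ xs (λ y y∈ → le y (there y∈)))

  ∑-++ : (xs ys : List A) (f : A → ℕ) → ∑ (xs ++ ys) f ≡ ∑ xs f + ∑ ys f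
  ∑-++ [] ys f = refl
  ∑-++ (x ∷ xs) ys f = trans (cong (f x +_) (∑-++ xs ys f)) (sym (ℕₚ.+-assoc (f x) _ _))

  ∑-map : (g : A → B) (xs : List A) (f : B → ℕ) → ∑ (map g xs) f ≡ ∑ xs (f ∘ g)
  ∑-map g [] f = refl
  ∑-map g (x ∷ xs) f = cong (f (g x) +_) (∑-map g xs f)

  ∑-cartesianProductWith : (g : A → B → C) (xs : List A) (ys : List B) (f : C → ℕ) →
    ∑ (cartesianProductWith g xs ys) f ≡ ∑[ x ∈ xs ] ∑[ y ∈ ys ] f (g x y)
  ∑-cartesianProductWith g [] ys f = refl
  ∑-cartesianProductWith g (x ∷ xs) ys f =
    trans (∑-++ (map (g x) ys) _ f)
      (cong₂ _+_ (∑-map (g x) ys f) (∑-cartesianProductWith g xs ys f))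

  ∑-0-or-∃ : (xs : List A) (f : A → ℕ) → ∑ xs f ≡ 0 ⊎ ∃ λ x → x ∈ xs × f x ≢ 0
  ∑-0-or-∃ [] f = inj₁ refl
  ∑-0-or-∃ (x ∷ xs) f with f x in eq | ∑-0-or-∃ xs f
  ... | zero  | inj₁ ≡0 = inj₁ ≡0
  ... | suc _ | _       = inj₂ (x , here refl , λ fx≡0 → ℕₚ.1+n≢0 (trans (sym eq) fx≡0))
  ... | zero  | inj₂ (y , y∈ , ≢0) = inj₂ (y , there y∈ , ≢0)

  length-filter : {P : Pred A p} (P? : Decidable P) (xs : List A) →
                  length (filter P? xs) ≡ ∑ xs (𝟙 ∘ P?)
  length-filter P? [] = refl
  length-filter P? (x ∷ xs) with does (P? x)
  ... | true  = cong suc (length-filter P? xs)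
  ... | false = length-filter P? xs

  -- A term below 1 could not be made up for by the others. This is the pigeonhole principle in the
  -- form used for fibres.
  ∑-saturated : (u : A → ℕ) (xs : List A) → (∀ x → u x ≤ 1) → ∑ xs u ≡ length xs →
                ∀ x → x ∈ xs → u x ≡ 1
  ∑-saturated u (x ∷ xs) u≤1 eq = go
    where
    ∑≤ : ∀ ys → ∑ ys u ≤ length ys
    ∑≤ ys = subst (∑ ys u ≤_) (trans (∑-const ys 1) (ℕₚ.*-identityʳ _)) (∑-mono-∈ ys (λ x _ → u≤1 x))
    1≤ux : 1 ≤ u x
    1≤ux = ℕₚ.+-cancelʳ-≤ (length xs) 1 (u x)
      (subst (_≤ u x + length xs) eq (ℕₚ.+-monoʳ-≤ (u x) (∑≤ xs)))
    ux≡1 : u x ≡ 1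
    ux≡1 = ℕₚ.≤-antisym (u≤1 x) 1≤ux
    go : ∀ y → y ∈ x ∷ xs → u y ≡ 1
    go y (here refl) = ux≡1
    go y (there y∈) = ∑-saturated u xs u≤1
      (ℕₚ.+-cancelˡ-≡ 1 _ _ (trans (cong (_+ ∑ xs u) (sym ux≡1)) eq)) y y∈

  module _ {A : Set a} (_≟_ : DecidableEquality A) where

    ∑-pick : {xs : List A} → Unique xs → ∀ {y} → y ∈ xs → (f : A → ℕ) →
             ∑[ x ∈ xs ] (𝟙 (x ≟ y) * f x) ≡ f y
    ∑-pick {x ∷ xs} (x∉xs ∷ _) (here refl) f = begin
      𝟙 (x ≟ x) * f x + ∑[ z ∈ xs ] (𝟙 (z ≟ x) * f z)
        ≡⟨ cong₂ _+_ (cong (_* f x) (𝟙-yes (x ≟ x) refl)) (∑-cong-∈ xs λ z z∈ →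
             cong (_* f z) (𝟙-no (z ≟ x) λ { refl → All.lookup x∉xs z∈ refl })) ⟩
      1 * f x + ∑[ z ∈ xs ] 0 ≡⟨ cong₂ _+_ (ℕₚ.*-identityˡ (f x)) (∑-zero xs) ⟩
      f x + 0                 ≡⟨ ℕₚ.+-identityʳ (f x) ⟩
      f x ∎
      where open ≡-Reasoning
    ∑-pick {x ∷ xs} (x∉xs ∷ xs!) {y} (there y∈) f =
      cong₂ _+_ (cong (_* f x) (𝟙-no (x ≟ y) λ { refl → All.lookup x∉xs y∈ refl }))
        (∑-pick xs! y∈ f)

    ∑-δ : {xs : List A} → Unique xs → ∀ {y} → y ∈ xs → ∑[ x ∈ xs ] 𝟙 (x ≟ y) ≡ 1
    ∑-δ {xs} xs! y∈ =
      trans (∑-cong xs λ _ → sym (ℕₚ.*-identityʳ _)) (∑-pick xs! y∈ (λ _ → 1))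

    module _ {xs : List A} (xs! : Unique xs) (∈xs : ∀ x → x ∈ xs)
             {f : A → A} (f-injective : Injective _≡_ _≡_ f) where

      private
        fibre : A → ℕ
        fibre y = ∑[ x ∈ xs ] 𝟙 (f x ≟ y)

        fibre≤1 : ∀ y → fibre y ≤ 1
        fibre≤1 y with ∑-0-or-∃ xs (λ x → 𝟙 (f x ≟ y))
        ... | inj₁ ≡0 = subst (_≤ 1) (sym ≡0) z≤n
        ... | inj₂ (x₀ , _ , ≢0) = ℕₚ.≤-reflexive (trans
          (∑-cong xs λ x → 𝟙-⇔ (f x ≟ y) (x ≟ x₀)
            (λ fx≡y → f-injective (trans fx≡y (sym fx₀≡y))) (λ { refl → fx₀≡y }))
          (∑-δ xs! (∈xs x₀)))
          where fx₀≡y = 𝟙≢0 (f x₀ ≟ y) ≢0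

        ∑fibre : ∑ xs fibre ≡ length xs
        ∑fibre = begin
          ∑[ y ∈ xs ] ∑[ x ∈ xs ] 𝟙 (f x ≟ y) ≡⟨ ∑-swap xs xs _ ⟩
          ∑[ x ∈ xs ] ∑[ y ∈ xs ] 𝟙 (f x ≟ y)
            ≡⟨ ∑-cong xs (λ x → trans (∑-cong xs λ y → 𝟙-⇔ (f x ≟ y) (y ≟ f x) sym sym)
                 (∑-δ xs! (∈xs (f x)))) ⟩
          ∑[ x ∈ xs ] 1 ≡⟨ trans (∑-const xs 1) (ℕₚ.*-identityʳ _) ⟩
          length xs ∎
          where open ≡-Reasoning

        fibre≡1 : ∀ y → fibre y ≡ 1
        fibre≡1 y = ∑-saturated fibre xs fibre≤1 ∑fibre y (∈xs y)

      -- Each fibre has at most one element and the fibre sizes add up to `length xs`, so by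
      -- `∑-saturated` every fibre has exactly one.
      injective⇒surjective : ∀ y → ∃ λ x → f x ≡ y
      injective⇒surjective y with ∑-0-or-∃ xs (λ x → 𝟙 (f x ≟ y))
      ... | inj₁ ≡0 = contradiction (trans (sym (fibre≡1 y)) ≡0) λ ()
      ... | inj₂ (x , _ , ≢0) = x , 𝟙≢0 (f x ≟ y) ≢0

      ∑-reindex : (g : A → ℕ) → ∑ xs (g ∘ f) ≡ ∑ xs g
      ∑-reindex g = begin
        ∑[ x ∈ xs ] g (f x) ≡⟨ ∑-cong xs (λ x → sym (∑-pick xs! (∈xs (f x)) g)) ⟩
        ∑[ x ∈ xs ] ∑[ y ∈ xs ] (𝟙 (y ≟ f x) * g y) ≡⟨ ∑-swap xs xs _ ⟩
        ∑[ y ∈ xs ] ∑[ x ∈ xs ] (𝟙 (y ≟ f x) * g y)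
          ≡⟨ ∑-cong xs (λ y → ∑-*ʳ xs (g y) λ x → 𝟙 (y ≟ f x)) ⟩
        ∑[ y ∈ xs ] (∑[ x ∈ xs ] 𝟙 (y ≟ f x) * g y)
          ≡⟨ ∑-cong xs (λ y → cong (_* g y) (trans
               (∑-cong xs λ x → 𝟙-⇔ (y ≟ f x) (f x ≟ y) sym sym) (fibre≡1 y))) ⟩
        ∑[ y ∈ xs ] (1 * g y) ≡⟨ ∑-cong xs (λ y → ℕₚ.*-identityˡ (g y)) ⟩
        ∑ xs g ∎
        where open ≡-Reasoning

open Summation

-- Cardinalities of setoids from sums of indicators

module Cardinality where

  private
    variable
      a b p : Level

  lookup-injective : {A : Set a} {xs : List A} → Unique xs → ∀ {i j} → lookup xs i ≡ lookup xs j → i ≡ j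
  lookup-injective (_ ∷ _) {zero} {zero} _ = refl
  lookup-injective {xs = x ∷ xs} (x∉xs ∷ _) {zero} {suc j} eq = contradiction eq (All.lookup x∉xs (∈-lookup j))
  lookup-injective {xs = x ∷ xs} (x∉xs ∷ _) {suc i} {zero} eq = contradiction (sym eq) (All.lookup x∉xs (∈-lookup i))
  lookup-injective (_ ∷ xs!) {suc i} {suc j} eq = cong suc (lookup-injective xs! eq)

  -- The bijection with `Fin` is the position of a code in the list filtered by `P?`. Codes absorb
  -- the equivalence of S, so the membership proofs carried by elements of a subsetoid never have to
  -- be compared.
  hasCardinality-∑ : (S : Setoid a b) {A : Set} {P : Pred A p} (P? : Decidable P)
    {xs : List A} → Unique xs →
    (encode : Setoid.Carrier S → A) → (∀ x → encode x ∈ xs) → (∀ x → P (encode x)) →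
    (∀ {x y} → Setoid._≈_ S x y → encode x ≡ encode y) → (∀ {x y} → encode x ≡ encode y → Setoid._≈_ S x y) →
    (∀ {c} → c ∈ xs → P c → ∃ λ x → encode x ≡ c) →
    HasCardinality S (∑ xs (𝟙 ∘ P?))
  hasCardinality-∑ S {P = P} P? {xs} xs! encode encode∈ encode-P encode-cong encode-injective decode =
    subst (HasCardinality S) (length-filter P? xs) (record
      { to        = to
      ; from      = proj₁ ∘ from
      ; to-cong   = λ {x} {y} x≈y → lookup-injective ys!
          (trans (lookup-to x) (trans (encode-cong x≈y) (sym (lookup-to y))))
      ; from-cong = λ { refl → Setoid.refl S }
      ; inverse   =
          (λ {i} {y} y≈ → lookup-injective ys!
            (trans (lookup-to y) (trans (encode-cong y≈) (proj₂ (from i)))))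
        , λ { {x} refl → encode-injective (trans (proj₂ (from (to x))) (lookup-to x)) }
      })
    where
    ys = filter P? xs
    ys! : Unique ys
    ys! = Uniqueₚ.filter⁺ P? xs!
    encode∈ys : ∀ x → encode x ∈ ys
    encode∈ys x = ∈-filter⁺ P? (encode∈ x) (encode-P x)
    to : Setoid.Carrier S → Fin (length ys)
    to x = index (encode∈ys x)
    lookup-to : ∀ x → lookup ys (to x) ≡ encode x
    lookup-to x = sym (lookup-index (encode∈ys x))
    from : ∀ i → ∃ λ x → encode x ≡ lookup ys i
    from i with ∈xs , Pc ← ∈-filter⁻ P? {xs = xs} (∈-lookup {xs = ys} i) = decode ∈xs Pc

  hasCardinality-unique : (S : Setoid a b) → ∀ {k l} → HasCardinality S k → HasCardinality S l → k ≡ l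
  hasCardinality-unique S card card′ = ↔⇒≡ (Composition.inverse (Symmetry.inverse card) card′)

open Cardinality

-- Finite fields

record FiniteField (q : ℕ) : Set where
  infixl 7 _*_
  infixl 6 _+_
  field
    _+_ _*_           : Op₂ (Fin q)
    -_                : Op₁ (Fin q)
    0# 1#             : Fin q
    isCommutativeRing : IsCommutativeRing _≡_ _+_ _*_ -_ 0# 1#
    1≢0               : 1# ≢ 0#
    inverse           : ∀ x → x ≢ 0# → ∃ λ y → y * x ≡ 1#

2≤q : ∀ {q} → FiniteField q → 2 ℕ.≤ q
2≤q {zero} K with () ← FiniteField.0# K
2≤q {suc zero} K = contradiction (all-equal (FiniteField.1# K) (FiniteField.0# K)) (FiniteField.1≢0 K)
  where
  all-equal : ∀ (x y : Fin 1) → x ≡ y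
  all-equal zero zero = refl
2≤q {suc (suc q)} K = ℕ.s≤s (ℕ.s≤s ℕ.z≤n)

module FieldProperties {q : ℕ} (K : FiniteField q) where

  open FiniteField K public

  commutativeRing : CommutativeRing 0ℓ 0ℓ
  commutativeRing = record { isCommutativeRing = isCommutativeRing }

  open CommutativeRing commutativeRing public
    using (+-assoc; +-comm; +-identityˡ; +-identityʳ; -‿inverseˡ; -‿inverseʳ; *-assoc; *-comm;
           *-identityˡ; *-identityʳ; zeroˡ; zeroʳ; distribˡ; distribʳ; semiring;
           commutativeSemiring; +-commutativeMonoid; *-commutativeMonoid; ring)
  open RingProperties ring public using (+-cancelˡ; +-cancelʳ)
  open Multiple semiring using (×1-homo-*) renaming (_×_ to _·_)
  open Power semiring public using (_^_; ^-homo-*; ^-assocʳ)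
  open CommutativePower commutativeSemiring public using (^-distrib-*)
  open ≡-Reasoning

  infix 4 _≟_
  _≟_ : DecidableEquality (Fin q)
  _≟_ = Finₚ._≟_

  elements : List (Fin q)
  elements = allFin q

  elements-unique : Unique elements
  elements-unique = Uniqueₚ.allFin⁺ q

  ∈-elements : ∀ x → x ∈ elements
  ∈-elements = ∈-allFin

  length-elements : length elements ≡ q
  length-elements = length-tabulate id

  *-cancelˡ : ∀ {a x y} → a ≢ 0# → a * x ≡ a * y → x ≡ y
  *-cancelˡ {a} {x} {y} a≢0 eq with b , ba≡1 ← inverse a a≢0 = begin
    x           ≡⟨ *-identityˡ x ⟨
    1# * x      ≡⟨ cong (_* x) ba≡1 ⟨
    b * a * x   ≡⟨ *-assoc b a x ⟩
    b * (a * x) ≡⟨ cong (b *_) eq ⟩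
    b * (a * y) ≡⟨ *-assoc b a y ⟨
    b * a * y   ≡⟨ cong (_* y) ba≡1 ⟩
    1# * y      ≡⟨ *-identityˡ y ⟩
    y ∎

  *-cancelʳ : ∀ {a x y} → a ≢ 0# → x * a ≡ y * a → x ≡ y
  *-cancelʳ {a} {x} {y} a≢0 eq = *-cancelˡ a≢0 (trans (*-comm a x) (trans eq (*-comm y a)))

  x*y≡0⇒y≡0 : ∀ {x y} → x ≢ 0# → x * y ≡ 0# → y ≡ 0#
  x*y≡0⇒y≡0 {x} x≢0 eq = *-cancelˡ x≢0 (trans eq (sym (zeroʳ x)))

  x*y≡0⇒x≡0 : ∀ {x y} → y ≢ 0# → x * y ≡ 0# → x ≡ 0#
  x*y≡0⇒x≡0 {x} {y} y≢0 eq = x*y≡0⇒y≡0 y≢0 (trans (*-comm y x) eq)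

  x*y≡0 : ∀ {x y} → x * y ≡ 0# → x ≡ 0# ⊎ y ≡ 0#
  x*y≡0 {x} eq with x ≟ 0#
  ... | yes x≡0 = inj₁ x≡0
  ... | no x≢0 = inj₂ (x*y≡0⇒y≡0 x≢0 eq)

  *-≢0 : ∀ {x y} → x ≢ 0# → y ≢ 0# → x * y ≢ 0#
  *-≢0 x≢0 y≢0 eq = y≢0 (x*y≡0⇒y≡0 x≢0 eq)

  -- The value 0 at 0 makes the inverse an injection of the whole field, so that sums over all
  -- elements can be reindexed by it.
  inv : Op₁ (Fin q)
  inv x with x ≟ 0#
  ... | yes _ = 0#
  ... | no x≢0 = proj₁ (inverse x x≢0)

  inv-0 : inv 0# ≡ 0#
  inv-0 with 0# ≟ 0#
  ... | yes _ = refl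
  ... | no 0≢0 = contradiction refl 0≢0

  inv-inverseˡ : ∀ {x} → x ≢ 0# → inv x * x ≡ 1#
  inv-inverseˡ {x} x≢0 with x ≟ 0#
  ... | yes x≡0 = contradiction x≡0 x≢0
  ... | no x≢0′ = proj₂ (inverse x x≢0′)

  inv-inverseʳ : ∀ {x} → x ≢ 0# → x * inv x ≡ 1#
  inv-inverseʳ x≢0 = trans (*-comm _ _) (inv-inverseˡ x≢0)

  inv-≢0 : ∀ {x} → x ≢ 0# → inv x ≢ 0#
  inv-≢0 {x} x≢0 eq = 1≢0 (trans (sym (inv-inverseˡ x≢0)) (trans (cong (_* x) eq) (zeroˡ x)))

  inv-injective : Injective _≡_ _≡_ inv
  inv-injective {x} {y} eq = by-cases (x ≟ 0#) (y ≟ 0#)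
    where
    by-cases : Dec (x ≡ 0#) → Dec (y ≡ 0#) → x ≡ y
    by-cases (yes x≡0) (yes y≡0) = trans x≡0 (sym y≡0)
    by-cases (yes refl) (no y≢0) = contradiction (trans (sym eq) inv-0) (inv-≢0 y≢0)
    by-cases (no x≢0) (yes refl) = contradiction (trans eq inv-0) (inv-≢0 x≢0)
    by-cases (no x≢0) (no y≢0) = *-cancelˡ (inv-≢0 x≢0)
      (trans (inv-inverseˡ x≢0) (trans (sym (inv-inverseˡ y≢0)) (cong (_* y) (sym eq))))

  +-injective : ∀ a → Injective _≡_ _≡_ (a +_)
  +-injective a = +-cancelˡ a _ _

  -- The sum of all elements is unchanged by x ↦ x + 1.
  q·1≡0 : q · 1# ≡ 0#
  q·1≡0 = +-cancelˡ (sum id) _ _ (begin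
    sum id + q · 1#        ≡⟨ cong (sum id +_) (sum-replicate q) ⟨
    sum id + sum {q} (λ _ → 1#) ≡⟨ ∑-distrib-+ {q} id (λ _ → 1#) ⟨
    sum (λ x → x + 1#)     ≡⟨ sum-permute id shift ⟨
    sum id                 ≡⟨ +-identityʳ _ ⟨
    sum id + 0#            ∎)
    where
    open MonoidSum +-commutativeMonoid
    cancel : ∀ {a b} → a + b ≡ 0# → ∀ x → x + a + b ≡ x
    cancel {a} {b} eq x = trans (+-assoc x a b) (trans (cong (x +_) eq) (+-identityʳ x))
    shift : Permutation′ q
    shift = permutation (_+ 1#) (_+ (- 1#)) (cancel (-‿inverseˡ 1#)) (cancel (-‿inverseʳ 1#))

  -- Multiplication by a permutes the elements; compare the products of all
  -- nonzero elements (with 0# replaced by 1#).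
  x^q≡x : ∀ x → x ^ q ≡ x
  x^q≡x a = by-cases (a ≟ 0#)
    where
    open MonoidSum *-commutativeMonoid
      renaming (sum to product; sum-permute to product-permute; ∑-distrib-+ to product-distrib;
                sum-replicate to product-replicate; sum-replicate-zero to product-ones;
                sum-remove to product-remove; sum-cong-≗ to product-cong)

    product-single : ∀ {n} (i : Fin n) (t : Fin n → Fin q) → (∀ j → j ≢ i → t j ≡ 1#) →
                     product t ≡ t i
    product-single {suc n} i t ones = begin
      product t ≡⟨ product-remove {i = i} t ⟩
      t i * product (t ∘ punchIn i)
        ≡⟨ cong (t i *_) (product-cong λ j → ones (punchIn i j) (Finₚ.punchInᵢ≢i i j)) ⟩
      t i * product {n} (λ _ → 1#) ≡⟨ cong (t i *_) (product-ones n) ⟩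
      t i * 1# ≡⟨ *-identityʳ (t i) ⟩
      t i ∎

    product-≢0 : ∀ {n} (t : Fin n → Fin q) → (∀ j → t j ≢ 0#) → product t ≢ 0#
    product-≢0 {zero} t t≢0 = 1≢0
    product-≢0 {suc n} t t≢0 = *-≢0 (t≢0 zero) (product-≢0 (t ∘ suc) (t≢0 ∘ suc))

    by-cases : Dec (a ≡ 0#) → a ^ q ≡ a
    by-cases (yes refl) = zero-power 0#
      where
      zero-power : ∀ {m} → Fin m → 0# ^ m ≡ 0#
      zero-power {suc m} _ = zeroˡ _
    by-cases (no a≢0) = *-cancelˡ (product-≢0 unit unit≢0) (begin
      product unit * a ^ q ≡⟨ cong (product unit *_) (product-replicate q) ⟨
      product unit * product {q} (λ _ → a) ≡⟨ product-distrib unit (λ _ → a) ⟨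
      product (λ x → unit x * a) ≡⟨ product-cong split ⟩
      product (λ x → unit (a * x) * at-zero x) ≡⟨ product-distrib (unit ∘ (a *_)) at-zero ⟩
      product (unit ∘ (a *_)) * product at-zero
        ≡⟨ cong₂ _*_ (sym (product-permute unit scale)) (trans (product-single 0# at-zero at-zero-≢) at-zero-0) ⟩
      product unit * a ∎)
      where
      unit at-zero : Fin q → Fin q
      unit x with x ≟ 0#
      ... | yes _ = 1#
      ... | no _ = x
      at-zero x with x ≟ 0#
      ... | yes _ = a
      ... | no _ = 1#
      unit≢0 : ∀ x → unit x ≢ 0#
      unit≢0 x with x ≟ 0#
      ... | yes _ = 1≢0
      ... | no x≢0 = x≢0
      at-zero-≢ : ∀ x → x ≢ 0# → at-zero x ≡ 1#
      at-zero-≢ x x≢0 with x ≟ 0#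
      ... | yes x≡0 = contradiction x≡0 x≢0
      ... | no _ = refl
      at-zero-0 : at-zero 0# ≡ a
      at-zero-0 with 0# ≟ 0#
      ... | yes _ = refl
      ... | no 0≢0 = contradiction refl 0≢0
      -- At x = 0 the left side is a while `unit (a * x)` is 1; `at-zero` supplies the missing
      -- factor there and is 1 elsewhere.
      split : ∀ x → unit x * a ≡ unit (a * x) * at-zero x
      split x with x ≟ 0# | a * x ≟ 0#
      ... | yes _ | yes _ = refl
      ... | yes refl | no a0≢0 = contradiction (zeroʳ a) a0≢0
      ... | no x≢0 | yes ax≡0 = contradiction ax≡0 (*-≢0 a≢0 x≢0)
      ... | no _ | no _ = trans (*-comm x a) (sym (*-identityʳ _))
      scale : Permutation′ q
      scale = permutation (a *_) (inv a *_) (cancel (inv-inverseʳ a≢0)) (cancel (inv-inverseˡ a≢0))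
        where
        cancel : ∀ {b c} → b * c ≡ 1# → ∀ x → b * (c * x) ≡ x
        cancel {b} {c} bc≡1 x =
          trans (sym (*-assoc b c x)) (trans (cong (_* x) bc≡1) (*-identityˡ x))

-- Characteristic 2

module Characteristic2 (n : ℕ) (K : FiniteField (2 ℕ.^ n)) where

  private
    q = 2 ℕ.^ n

  open FieldProperties K
  open Multiple semiring using (×1-homo-*) renaming (_×_ to _·_)
  open ≡-Reasoning

  -- The multiple q · 1 is a product of n copies of 2 · 1 and vanishes; without zero divisors one of
  -- the factors must vanish.
  1+1≡0 : 1# + 1# ≡ 0#
  1+1≡0 = trans (cong (1# +_) (sym (+-identityʳ 1#))) (go n q·1≡0)
    where
    go : ∀ m → (2 ℕ.^ m) · 1# ≡ 0# → 2 · 1# ≡ 0#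
    go zero eq = contradiction (trans (sym (+-identityʳ 1#)) eq) 1≢0
    go (suc m) eq with x*y≡0 (trans (sym (×1-homo-* 2 (2 ℕ.^ m))) eq)
    ... | inj₁ 2≡0 = 2≡0
    ... | inj₂ 2^m≡0 = go m 2^m≡0

  x+x≡0 : ∀ x → x + x ≡ 0#
  x+x≡0 x = begin
    x + x           ≡⟨ cong₂ _+_ (*-identityʳ x) (*-identityʳ x) ⟨
    x * 1# + x * 1# ≡⟨ distribˡ x 1# 1# ⟨
    x * (1# + 1#)   ≡⟨ cong (x *_) 1+1≡0 ⟩
    x * 0#          ≡⟨ zeroʳ x ⟩
    0# ∎

  x+y≡0⇒x≡y : ∀ {x y} → x + y ≡ 0# → x ≡ y
  x+y≡0⇒x≡y {x} {y} eq = begin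
    x           ≡⟨ +-identityʳ x ⟨
    x + 0#      ≡⟨ cong (x +_) (x+x≡0 y) ⟨
    x + (y + y) ≡⟨ +-assoc x y y ⟨
    x + y + y   ≡⟨ cong (_+ y) eq ⟩
    0# + y      ≡⟨ +-identityˡ y ⟩
    y ∎

  x≡y⇒x+y≡0 : ∀ {x y} → x ≡ y → x + y ≡ 0#
  x≡y⇒x+y≡0 refl = x+x≡0 _

  private
    ⟦_⟧ : Bool → Fin q
    ⟦ true ⟧  = 1#
    ⟦ false ⟧ = 0#

    𝔽₂⟶K : CommutativeRing.rawRing Boolₚ.xor-∧-commutativeRing
             -Raw-AlmostCommutative⟶ fromCommutativeRing commutativeRing
    𝔽₂⟶K = record
      { ⟦_⟧    = ⟦_⟧
      ; +-homo = +-homo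
      ; *-homo = *-homo
      ; -‿homo = -‿homo
      ; 0-homo = refl
      ; 1-homo = refl
      }
      where
      +-homo : ∀ x y → ⟦ x xor y ⟧ ≡ ⟦ x ⟧ + ⟦ y ⟧
      +-homo true  true  = sym 1+1≡0
      +-homo true  false = sym (+-identityʳ 1#)
      +-homo false y     = sym (+-identityˡ ⟦ y ⟧)
      *-homo : ∀ x y → ⟦ x ∧ y ⟧ ≡ ⟦ x ⟧ * ⟦ y ⟧
      *-homo true  y = sym (*-identityˡ ⟦ y ⟧)
      *-homo false y = sym (zeroˡ ⟦ y ⟧)
      -‿homo : ∀ x → ⟦ x ⟧ ≡ - ⟦ x ⟧
      -‿homo x = x+y≡0⇒x≡y (-‿inverseʳ ⟦ x ⟧)

  -- With coefficients in 𝔽₂ the solver also cancels x + x.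
  private
    module 𝔽₂-Solver = Algebra.Solver.Ring _ _ 𝔽₂⟶K
      (λ x y → Maybe.map (cong ⟦_⟧) (dec⇒maybe (x Boolₚ.≟ y)))

  open 𝔽₂-Solver public using (solve; con; _:+_; _:*_; _:=_)

-- The automorphism σ and semilinear equations

module Frobenius (n : ℕ) (K : FiniteField (2 ℕ.^ n)) (h : ℕ) (coprime : gcd n h ≡ 1) where

  private
    q = 2 ℕ.^ n

  open FieldProperties K
  open Characteristic2 n K
  open ≡-Reasoning

  -- Iterated squaring rather than a power with exponent 2^k: additivity and multiplicativity follow
  -- by induction from the case of a single squaring.
  frobenius : ℕ → Op₁ (Fin q)
  frobenius zero x = x
  frobenius (suc k) x = frobenius k (x * x)

  frobenius≡^ : ∀ k x → frobenius k x ≡ x ^ (2 ℕ.^ k)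
  frobenius≡^ zero x = sym (*-identityʳ x)
  frobenius≡^ (suc k) x = begin
    frobenius k (x * x)   ≡⟨ frobenius≡^ k (x * x) ⟩
    (x * x) ^ (2 ℕ.^ k)   ≡⟨ cong (λ y → (x * y) ^ (2 ℕ.^ k)) (*-identityʳ x) ⟨
    (x ^ 2) ^ (2 ℕ.^ k)   ≡⟨ ^-assocʳ x 2 (2 ℕ.^ k) ⟩
    x ^ (2 ℕ.* 2 ℕ.^ k) ∎

  frobenius-+ : ∀ k x y → frobenius k (x + y) ≡ frobenius k x + frobenius k y
  frobenius-+ zero x y = refl
  frobenius-+ (suc k) x y = trans
    (cong (frobenius k) (solve 2 (λ x y → (x :+ y) :* (x :+ y) := x :* x :+ y :* y) refl x y))
    (frobenius-+ k (x * x) (y * y))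

  frobenius-* : ∀ k x y → frobenius k (x * y) ≡ frobenius k x * frobenius k y
  frobenius-* zero x y = refl
  frobenius-* (suc k) x y = trans
    (cong (frobenius k) (solve 2 (λ x y → (x :* y) :* (x :* y) := (x :* x) :* (y :* y)) refl x y))
    (frobenius-* k (x * x) (y * y))

  frobenius-0 : ∀ k → frobenius k 0# ≡ 0#
  frobenius-0 zero = refl
  frobenius-0 (suc k) = trans (cong (frobenius k) (zeroˡ 0#)) (frobenius-0 k)

  frobenius-1 : ∀ k → frobenius k 1# ≡ 1#
  frobenius-1 zero = refl
  frobenius-1 (suc k) = trans (cong (frobenius k) (*-identityˡ 1#)) (frobenius-1 k)

  frobenius-∘ : ∀ k l x → frobenius (k ℕ.+ l) x ≡ frobenius l (frobenius k x)
  frobenius-∘ zero l x = refl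
  frobenius-∘ (suc k) l x = frobenius-∘ k l (x * x)

  frobenius-fixed-* : ∀ {k x} → frobenius k x ≡ x → ∀ m → frobenius (m ℕ.* k) x ≡ x
  frobenius-fixed-* fixed zero = refl
  frobenius-fixed-* {k} {x} fixed (suc m) = trans (frobenius-∘ k (m ℕ.* k) x)
    (trans (cong (frobenius (m ℕ.* k)) fixed) (frobenius-fixed-* fixed m))

  σ : Op₁ (Fin q)
  σ = frobenius h

  σ-+ : ∀ x y → σ (x + y) ≡ σ x + σ y
  σ-+ = frobenius-+ h

  σ-* : ∀ x y → σ (x * y) ≡ σ x * σ y
  σ-* = frobenius-* h

  σ-0 : σ 0# ≡ 0#
  σ-0 = frobenius-0 h

  σ-1 : σ 1# ≡ 1#
  σ-1 = frobenius-1 h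

  σ-≢0 : ∀ {x} → x ≢ 0# → σ x ≢ 0#
  σ-≢0 {x} x≢0 eq with y , yx≡1 ← inverse x x≢0 = 1≢0 (begin
    1#        ≡⟨ trans (cong σ yx≡1) σ-1 ⟨
    σ (y * x) ≡⟨ σ-* y x ⟩
    σ y * σ x ≡⟨ cong (σ y *_) eq ⟩
    σ y * 0#  ≡⟨ zeroʳ (σ y) ⟩
    0# ∎)

  σ≡0⇒≡0 : ∀ {x} → σ x ≡ 0# → x ≡ 0#
  σ≡0⇒≡0 {x} eq with x ≟ 0#
  ... | yes x≡0 = x≡0
  ... | no x≢0 = contradiction eq (σ-≢0 x≢0)

  σ-injective : Injective _≡_ _≡_ σ
  σ-injective {x} {y} eq = x+y≡0⇒x≡y (σ≡0⇒≡0 (trans (σ-+ x y) (x≡y⇒x+y≡0 eq)))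

  σ-surjective : ∀ y → ∃ λ x → σ x ≡ y
  σ-surjective = injective⇒surjective _≟_ elements-unique ∈-elements σ-injective

  -- The exponents k with x^(2^k) = x include n and h, hence gcd n h.
  σ-fixed⇒≡1 : ∀ {x} → x ≢ 0# → σ x ≡ x → x ≡ 1#
  σ-fixed⇒≡1 {x} x≢0 σx≡x =
    *-cancelˡ x≢0 (trans (square (subst (λ d → Bézout.Identity d n h) coprime
      (Bézout.identity (gcd-GCD n h)))) (sym (*-identityʳ x)))
    where
    fixed-n : frobenius n x ≡ x
    fixed-n = trans (frobenius≡^ n x) (x^q≡x x)

    -- Bézout's identity yields a multiple of n and a multiple of h that differ by 1. Both fix x,
    -- hence so does one squaring.
    difference : ∀ {k l} → 1 ℕ.+ l ≡ k → frobenius k x ≡ x → frobenius l x ≡ x → x * x ≡ x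
    difference {l = l} refl fixed-1+l fixed-l = begin
      x * x                       ≡⟨ cong (λ y → y * y) fixed-l ⟨
      frobenius 1 (frobenius l x) ≡⟨ frobenius-∘ l 1 x ⟨
      frobenius (l ℕ.+ 1) x       ≡⟨ cong (λ k → frobenius k x) (ℕₚ.+-comm l 1) ⟩
      frobenius (1 ℕ.+ l) x       ≡⟨ fixed-1+l ⟩
      x ∎

    square : Bézout.Identity 1 n h → x * x ≡ x
    square (Bézout.+- a b eq) = difference eq (frobenius-fixed-* fixed-n a) (frobenius-fixed-* σx≡x b)
    square (Bézout.-+ a b eq) = difference eq (frobenius-fixed-* σx≡x b) (frobenius-fixed-* fixed-n a)

  -- The hypothesis says that x / y is fixed by σ, and the only nonzero fixed element is 1.
  σx*y≡σy*x⇒x≡y : ∀ {x y} → x ≢ 0# → y ≢ 0# → σ x * y ≡ σ y * x → x ≡ y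
  σx*y≡σy*x⇒x≡y {x} {y} x≢0 y≢0 eq = begin
    x      ≡⟨ zy≡x ⟨
    z * y  ≡⟨ cong (_* y) (σ-fixed⇒≡1 (*-≢0 x≢0 (inv-≢0 y≢0)) σz≡z) ⟩
    1# * y ≡⟨ *-identityˡ y ⟩
    y ∎
    where
    z = x * inv y
    zy≡x : z * y ≡ x
    zy≡x = trans (*-assoc x (inv y) y) (trans (cong (x *_) (inv-inverseˡ y≢0)) (*-identityʳ x))
    σz≡z : σ z ≡ z
    σz≡z = *-cancelʳ (*-≢0 (σ-≢0 y≢0) y≢0) (begin
      σ z * (σ y * y)   ≡⟨ *-assoc (σ z) (σ y) y ⟨
      σ z * σ y * y     ≡⟨ cong (_* y) (σ-* z y) ⟨
      σ (z * y) * y     ≡⟨ cong (λ w → σ w * y) zy≡x ⟩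
      σ x * y           ≡⟨ eq ⟩
      σ y * x           ≡⟨ cong (σ y *_) zy≡x ⟨
      σ y * (z * y)     ≡⟨ solve 3 (λ s z y → s :* (z :* y) := z :* (s :* y)) refl (σ y) z y ⟩
      z * (σ y * y) ∎)

  private
    quotient : Op₁ (Fin q)
    quotient x = σ x * inv x

    quotient-≢0 : ∀ {x} → x ≢ 0# → quotient x ≢ 0#
    quotient-≢0 x≢0 = *-≢0 (σ-≢0 x≢0) (inv-≢0 x≢0)

    quotient-0 : quotient 0# ≡ 0#
    quotient-0 = trans (cong (_* inv 0#) σ-0) (zeroˡ _)

    quotient-* : ∀ {x} → x ≢ 0# → quotient x * x ≡ σ x
    quotient-* {x} x≢0 = trans (*-assoc (σ x) (inv x) x)
      (trans (cong (σ x *_) (inv-inverseˡ x≢0)) (*-identityʳ (σ x)))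

    quotient-injective : Injective _≡_ _≡_ quotient
    quotient-injective {x} {y} eq = by-cases (x ≟ 0#) (y ≟ 0#)
      where
      by-cases : Dec (x ≡ 0#) → Dec (y ≡ 0#) → x ≡ y
      by-cases (yes x≡0) (yes y≡0) = trans x≡0 (sym y≡0)
      by-cases (yes refl) (no y≢0) = contradiction (trans (sym eq) quotient-0) (quotient-≢0 y≢0)
      by-cases (no x≢0) (yes refl) = contradiction (trans eq quotient-0) (quotient-≢0 x≢0)
      by-cases (no x≢0) (no y≢0) = σx*y≡σy*x⇒x≡y x≢0 y≢0 (begin
        σ x * y            ≡⟨ cong (_* y) (quotient-* x≢0) ⟨
        quotient x * x * y ≡⟨ cong (λ k → k * x * y) eq ⟩
        quotient y * x * y ≡⟨ solve 3 (λ k x y → k :* x :* y := k :* y :* x) refl (quotient y) x y ⟩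
        quotient y * y * x ≡⟨ cong (_* x) (quotient-* y≢0) ⟩
        σ y * x ∎)

  -- The map x ↦ σ x / x, extended by 0 at 0, is injective and therefore takes the value b / a.
  semilinear-root : ∀ {a b} → a ≢ 0# → b ≢ 0# → ∃ λ r → r ≢ 0# × a * σ r ≡ b * r
  semilinear-root {a} {b} a≢0 b≢0
    with r , eq ← injective⇒surjective _≟_ elements-unique ∈-elements quotient-injective (inv a * b) =
      r , r≢0 , (begin
        a * σ r               ≡⟨ cong (a *_) (quotient-* r≢0) ⟨
        a * (quotient r * r)  ≡⟨ cong (λ k → a * (k * r)) eq ⟩
        a * (inv a * b * r)   ≡⟨ solve 4 (λ a i b r → a :* (i :* b :* r) := (i :* a) :* (b :* r)) refl a (inv a) b r ⟩
        inv a * a * (b * r)   ≡⟨ cong (_* (b * r)) (inv-inverseˡ a≢0) ⟩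
        1# * (b * r)          ≡⟨ *-identityˡ (b * r) ⟩
        b * r ∎)
    where
    r≢0 : r ≢ 0#
    r≢0 refl = *-≢0 (inv-≢0 a≢0) b≢0 (trans (sym eq) quotient-0)

  -- Besides 0 there is one root: all nonzero roots share the quotient σ t / t = b / a (signs do not
  -- matter), which determines t.
  semilinear-roots : ∀ {a b} → a ≢ 0# → b ≢ 0# →
    ∑[ t ∈ elements ] 𝟙 (a * σ t + b * t ≟ 0#) ≡ 2
  semilinear-roots {a} {b} a≢0 b≢0 = begin
    ∑[ t ∈ elements ] 𝟙 (a * σ t + b * t ≟ 0#) ≡⟨ ∑-cong elements (λ t → pointwise t (t ≟ 0#)) ⟩
    ∑[ t ∈ elements ] (𝟙 (t ≟ 0#) ℕ.+ 𝟙 (t ≟ r)) ≡⟨ ∑-+ elements (λ t → 𝟙 (t ≟ 0#)) (λ t → 𝟙 (t ≟ r)) ⟩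
    ∑[ t ∈ elements ] 𝟙 (t ≟ 0#) ℕ.+ ∑[ t ∈ elements ] 𝟙 (t ≟ r) ≡⟨ cong₂ ℕ._+_ (∑-δ _≟_ elements-unique (∈-elements 0#)) (∑-δ _≟_ elements-unique (∈-elements r)) ⟩
    2 ∎
    where
    root : ∃ λ r → r ≢ 0# × a * σ r ≡ b * r
    root = semilinear-root a≢0 b≢0
    r = proj₁ root
    r≢0 = proj₁ (proj₂ root)
    aσr≡br = proj₂ (proj₂ root)
    unique : ∀ {t} → t ≢ 0# → a * σ t ≡ b * t → t ≡ r
    unique {t} t≢0 eq = σx*y≡σy*x⇒x≡y t≢0 r≢0 (*-cancelˡ (*-≢0 a≢0 b≢0) (begin
      a * b * (σ t * r)   ≡⟨ solve 4 (λ a b s r → a :* b :* (s :* r) := (a :* s) :* (b :* r)) refl a b (σ t) r ⟩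
      a * σ t * (b * r)   ≡⟨ cong₂ _*_ eq (sym aσr≡br) ⟩
      b * t * (a * σ r)   ≡⟨ solve 4 (λ a b s t → b :* t :* (a :* s) := a :* b :* (s :* t)) refl a b (σ r) t ⟩
      a * b * (σ r * t) ∎))
    pointwise : ∀ t → Dec (t ≡ 0#) → 𝟙 (a * σ t + b * t ≟ 0#) ≡ 𝟙 (t ≟ 0#) ℕ.+ 𝟙 (t ≟ r)
    pointwise t (yes refl) = begin
      𝟙 (a * σ 0# + b * 0# ≟ 0#)     ≡⟨ 𝟙-yes (_ ≟ 0#) (trans (cong₂ _+_ (trans (cong (a *_) σ-0) (zeroʳ a)) (zeroʳ b)) (+-identityˡ 0#)) ⟩
      1                              ≡⟨ cong₂ ℕ._+_ (𝟙-yes (0# ≟ 0#) refl) (𝟙-no (0# ≟ r) (r≢0 ∘ sym)) ⟨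
      𝟙 (0# ≟ 0#) ℕ.+ 𝟙 (0# ≟ r) ∎
    pointwise t (no t≢0) = begin
      𝟙 (a * σ t + b * t ≟ 0#)   ≡⟨ 𝟙-⇔ (_ ≟ 0#) (t ≟ r) (unique t≢0 ∘ x+y≡0⇒x≡y) (λ { refl → x≡y⇒x+y≡0 aσr≡br }) ⟩
      𝟙 (t ≟ r)                  ≡⟨ cong (ℕ._+ 𝟙 (t ≟ r)) (𝟙-no (t ≟ 0#) t≢0) ⟨
      𝟙 (t ≟ 0#) ℕ.+ 𝟙 (t ≟ r) ∎

  ∑-translate : ∀ s (f : Fin q → ℕ) → ∑[ t ∈ elements ] f (s + t) ≡ ∑ elements f
  ∑-translate s = ∑-reindex _≟_ elements-unique ∈-elements (+-injective s)

  -- The part without c is additive, so a nonempty solution set is a translate of its kernel, which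
  -- has two elements.
  affine-semilinear-roots : ∀ {a b} c → a ≢ 0# → b ≢ 0# →
    ∑[ t ∈ elements ] 𝟙 (a * σ t + b * t + c ≟ 0#) ≡ 0 ⊎
    ∑[ t ∈ elements ] 𝟙 (a * σ t + b * t + c ≟ 0#) ≡ 2
  affine-semilinear-roots {a} {b} c a≢0 b≢0
    with ∑-0-or-∃ elements (λ t → 𝟙 (a * σ t + b * t + c ≟ 0#))
  ... | inj₁ ≡0 = inj₁ ≡0
  ... | inj₂ (s , _ , ≢0) = inj₂ (begin
      ∑[ t ∈ elements ] 𝟙 (a * σ t + b * t + c ≟ 0#) ≡⟨ ∑-translate s _ ⟨
      ∑[ t ∈ elements ] 𝟙 (a * σ (s + t) + b * (s + t) + c ≟ 0#)
        ≡⟨ ∑-cong elements (λ t → cong (λ v → 𝟙 (v ≟ 0#)) (shifted t)) ⟩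
      ∑[ t ∈ elements ] 𝟙 (a * σ t + b * t ≟ 0#) ≡⟨ semilinear-roots a≢0 b≢0 ⟩
      2 ∎)
    where
    root : a * σ s + b * s + c ≡ 0#
    root = 𝟙≢0 (_ ≟ 0#) ≢0
    shifted : ∀ t → a * σ (s + t) + b * (s + t) + c ≡ a * σ t + b * t
    shifted t = begin
      a * σ (s + t) + b * (s + t) + c ≡⟨ cong (λ v → a * v + b * (s + t) + c) (σ-+ s t) ⟩
      a * (σ s + σ t) + b * (s + t) + c
        ≡⟨ solve 7 (λ a b c s t S T → a :* (S :+ T) :+ b :* (s :+ t) :+ c
             := (a :* S :+ b :* s :+ c) :+ (a :* T :+ b :* t)) refl a b c s t (σ s) (σ t) ⟩
      (a * σ s + b * s + c) + (a * σ t + b * t) ≡⟨ cong (_+ (a * σ t + b * t)) root ⟩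
      0# + (a * σ t + b * t) ≡⟨ +-identityˡ _ ⟩
      a * σ t + b * t ∎

-- Vectors, points and normal forms

module Projective {q : ℕ} (K : FiniteField q) where

  open FieldProperties K
  open ≡-Reasoning

  infix 4 _≟ᵥ_
  _≟ᵥ_ : ∀ {m} → DecidableEquality (Vec (Fin q) m)
  _≟ᵥ_ = Vecₚ.≡-dec _≟_

  vectors : ∀ m → List (Vec (Fin q) m)
  vectors zero = [] ∷ []
  vectors (suc m) = cartesianProductWith _∷_ elements (vectors m)

  vectors-unique : ∀ m → Unique (vectors m)
  vectors-unique zero = All.[] ∷ []
  vectors-unique (suc m) =
    Uniqueₚ.cartesianProductWith⁺ _∷_ Vecₚ.∷-injective elements-unique (vectors-unique m)

  ∈-vectors : ∀ {m} (v : Vec (Fin q) m) → v ∈ vectors m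
  ∈-vectors [] = here refl
  ∈-vectors (a ∷ v) = ∈-cartesianProductWith⁺ _∷_ (∈-elements a) (∈-vectors v)

  ∑-vectors : ∀ m (g : Vec (Fin q) (suc m) → ℕ) →
              ∑ (vectors (suc m)) g ≡ ∑[ a ∈ elements ] ∑[ v ∈ vectors m ] g (a ∷ v)
  ∑-vectors m = ∑-cartesianProductWith _∷_ elements (vectors m)

  -- Representatives of the points of projective space.
  data NormalForm : ∀ {m} → Vec (Fin q) m → Set where
    lead : ∀ {m} (v : Vec (Fin q) m) → NormalForm (1# ∷ v)
    skip : ∀ {m} {v : Vec (Fin q) m} → NormalForm v → NormalForm (0# ∷ v)

  normalForms : ∀ m → List (Vec (Fin q) m)
  normalForms zero = []
  normalForms (suc m) = List.map (1# ∷_) (vectors m) ++ List.map (0# ∷_) (normalForms m)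

  normalForms-unique : ∀ m → Unique (normalForms m)
  normalForms-unique zero = []
  normalForms-unique (suc m) = Uniqueₚ.++⁺
    (Uniqueₚ.map⁺ Vecₚ.∷-injectiveʳ (vectors-unique m))
    (Uniqueₚ.map⁺ Vecₚ.∷-injectiveʳ (normalForms-unique m))
    (λ (∈1 , ∈0) → disjoint (∈-map⁻ (1# ∷_) ∈1) (∈-map⁻ (0# ∷_) ∈0))
    where
    disjoint : ∀ {x : Vec (Fin q) (suc m)} {xs ys} →
      (∃ λ v → v ∈ xs × x ≡ 1# ∷ v) → ¬ (∃ λ v → v ∈ ys × x ≡ 0# ∷ v)
    disjoint (_ , _ , refl) (_ , _ , eq) = 1≢0 (Vecₚ.∷-injectiveˡ eq)

  ∈-normalForms⁺ : ∀ {m} {v : Vec (Fin q) m} → NormalForm v → v ∈ normalForms m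
  ∈-normalForms⁺ (lead v) = ∈-++⁺ˡ (∈-map⁺ (1# ∷_) (∈-vectors v))
  ∈-normalForms⁺ {suc m} (skip nf) = ∈-++⁺ʳ (List.map (1# ∷_) (vectors m)) (∈-map⁺ (0# ∷_) (∈-normalForms⁺ nf))

  ∈-normalForms⁻ : ∀ {m} {v : Vec (Fin q) m} → v ∈ normalForms m → NormalForm v
  ∈-normalForms⁻ {suc m} v∈ with ∈-++⁻ (List.map (1# ∷_) (vectors m)) v∈
  ... | inj₁ ∈1 with w , _ , refl ← ∈-map⁻ (1# ∷_) ∈1 = lead w
  ... | inj₂ ∈0 with w , w∈ , refl ← ∈-map⁻ (0# ∷_) ∈0 = skip (∈-normalForms⁻ w∈)

  ∑-normalForms : ∀ m (g : Vec (Fin q) (suc m) → ℕ) → ∑ (normalForms (suc m)) g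
    ≡ ∑[ v ∈ vectors m ] g (1# ∷ v) ℕ.+ ∑[ v ∈ normalForms m ] g (0# ∷ v)
  ∑-normalForms m g = trans (∑-++ (List.map (1# ∷_) (vectors m)) _ g)
    (cong₂ ℕ._+_ (∑-map (1# ∷_) (vectors m) g) (∑-map (0# ∷_) (normalForms m) g))

  ∑-normalForms-cong : ∀ {m} {f g : Vec (Fin q) m → ℕ} → (∀ {v} → NormalForm v → f v ≡ g v) →
                       ∑ (normalForms m) f ≡ ∑ (normalForms m) g
  ∑-normalForms-cong {m} eq = ∑-cong-∈ (normalForms m) (λ v v∈ → eq (∈-normalForms⁻ v∈))

  scale : ∀ {m} → Fin q → Vec (Fin q) m → Vec (Fin q) m
  scale a = Vec.map (a *_)

  scale-injective : ∀ {m a} → a ≢ 0# → Injective _≡_ _≡_ (scale {m} a)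
  scale-injective a≢0 {[]} {[]} eq = refl
  scale-injective a≢0 {x ∷ v} {y ∷ w} eq = cong₂ _∷_ (*-cancelˡ a≢0 (Vecₚ.∷-injectiveˡ eq))
    (scale-injective a≢0 (Vecₚ.∷-injectiveʳ eq))

  normalForm-exists : ∀ {m} (v : Vec (Fin q) m) i → Vec.lookup v i ≢ 0# →
    ∃ λ a → ∃ λ w → a ≢ 0# × NormalForm w × v ≡ scale a w
  normalForm-exists (x ∷ v) i vᵢ≢0 = by-cases i vᵢ≢0 (x ≟ 0#)
    where
    by-cases : ∀ i → Vec.lookup (x ∷ v) i ≢ 0# → Dec (x ≡ 0#) →
      ∃ λ a → ∃ λ w → a ≢ 0# × NormalForm w × x ∷ v ≡ scale a w
    by-cases i _ (no x≢0) = x , 1# ∷ scale (inv x) v , x≢0 , lead _ ,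
      cong₂ _∷_ (sym (*-identityʳ x)) (begin
        v                       ≡⟨ Vecₚ.map-id v ⟨
        Vec.map id v            ≡⟨ Vecₚ.map-cong (λ y → trans (sym (*-identityˡ y))
                                     (trans (cong (_* y) (sym (inv-inverseʳ x≢0))) (*-assoc x (inv x) y))) v ⟩
        Vec.map (λ y → x * (inv x * y)) v ≡⟨ Vecₚ.map-∘ (x *_) (inv x *_) v ⟩
        scale x (scale (inv x) v) ∎)
    by-cases zero x≢0 (yes x≡0) = contradiction x≡0 x≢0
    by-cases (suc i) vᵢ≢0 (yes refl) with a , w , a≢0 , nf , refl ← normalForm-exists v i vᵢ≢0 =
      a , 0# ∷ w , a≢0 , skip nf , cong (_∷ scale a w) (sym (zeroʳ a))

  normalForm-unique : ∀ {m} {v w : Vec (Fin q) m} {a b} → NormalForm v → NormalForm w →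
    a ≢ 0# → b ≢ 0# → scale a v ≡ scale b w → v ≡ w
  normalForm-unique {a = a} {b} (lead v) (lead w) a≢0 b≢0 eq
    with refl ← trans (sym (*-identityʳ a)) (trans (Vecₚ.∷-injectiveˡ eq) (*-identityʳ b)) =
    cong (1# ∷_) (scale-injective a≢0 (Vecₚ.∷-injectiveʳ eq))
  normalForm-unique {a = a} {b} (lead v) (skip nf) a≢0 b≢0 eq =
    contradiction (trans (sym (*-identityʳ a)) (trans (Vecₚ.∷-injectiveˡ eq) (zeroʳ b))) a≢0
  normalForm-unique {a = a} {b} (skip nf) (lead w) a≢0 b≢0 eq =
    contradiction (trans (sym (*-identityʳ b)) (trans (sym (Vecₚ.∷-injectiveˡ eq)) (zeroʳ a))) b≢0
  normalForm-unique (skip nf) (skip nf′) a≢0 b≢0 eq =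
    cong (0# ∷_) (normalForm-unique nf nf′ a≢0 b≢0 (Vecₚ.∷-injectiveʳ eq))

  normalForm-≢0 : ∀ {m} {v : Vec (Fin q) m} → NormalForm v → ∃ λ i → Vec.lookup v i ≢ 0#
  normalForm-≢0 (lead v) = zero , 1≢0
  normalForm-≢0 (skip nf) with i , ≢0 ← normalForm-≢0 nf = suc i , ≢0

  -- This is q - 1, used through `1+units≡q` so that no truncated subtraction appears.
  units : ℕ
  units = ∑[ a ∈ elements ] 𝟙 (¬? (a ≟ 0#))

  1+units≡q : 1 ℕ.+ units ≡ q
  1+units≡q = begin
    1 ℕ.+ units ≡⟨ cong (ℕ._+ units) (∑-δ _≟_ elements-unique (∈-elements 0#)) ⟨
    ∑[ a ∈ elements ] 𝟙 (a ≟ 0#) ℕ.+ units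
      ≡⟨ ∑-+ elements (λ a → 𝟙 (a ≟ 0#)) (λ a → 𝟙 (¬? (a ≟ 0#))) ⟨
    ∑[ a ∈ elements ] (𝟙 (a ≟ 0#) ℕ.+ 𝟙 (¬? (a ≟ 0#))) ≡⟨ ∑-cong elements (λ a → 𝟙+𝟙¬ (a ≟ 0#)) ⟩
    ∑[ a ∈ elements ] 1 ≡⟨ ∑-const elements 1 ⟩
    length elements ℕ.* 1 ≡⟨ trans (ℕₚ.*-identityʳ _) length-elements ⟩
    q ∎

  ScaleInvariant : ∀ {m} → (Vec (Fin q) m → ℕ) → Set
  ScaleInvariant g = ∀ a v → a ≢ 0# → g (scale a v) ≡ g v

  -- Every point has q - 1 nonzero representatives. In the induction, scaling the tail by a nonzero
  -- leading entry a permutes the tails and reduces the leading entry to 1.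
  ∑-vectors-projective : ∀ m (g : Vec (Fin q) m → ℕ) → ScaleInvariant g →
    ∑ (vectors m) g ≡ g (replicate m 0#) ℕ.+ units ℕ.* ∑ (normalForms m) g
  ∑-vectors-projective zero g invariant = cong (g [] ℕ.+_) (sym (ℕₚ.*-zeroʳ units))
  ∑-vectors-projective (suc m) g invariant = begin
    ∑ (vectors (suc m)) g ≡⟨ ∑-vectors m g ⟩
    ∑[ a ∈ elements ] G a ≡⟨ ∑-cong elements (λ a → pointwise a (a ≟ 0#)) ⟩
    ∑[ a ∈ elements ] (𝟙 (a ≟ 0#) ℕ.* G a ℕ.+ 𝟙 (¬? (a ≟ 0#)) ℕ.* G 1#)
      ≡⟨ ∑-+ elements (λ a → 𝟙 (a ≟ 0#) ℕ.* G a) (λ a → 𝟙 (¬? (a ≟ 0#)) ℕ.* G 1#) ⟩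
    ∑[ a ∈ elements ] (𝟙 (a ≟ 0#) ℕ.* G a) ℕ.+ ∑[ a ∈ elements ] (𝟙 (¬? (a ≟ 0#)) ℕ.* G 1#)
      ≡⟨ cong₂ ℕ._+_ (∑-pick _≟_ elements-unique (∈-elements 0#) G)
                     (∑-*ʳ elements (G 1#) (λ a → 𝟙 (¬? (a ≟ 0#)))) ⟩
    G 0# ℕ.+ units ℕ.* G 1#
      ≡⟨ cong (ℕ._+ units ℕ.* G 1#) (∑-vectors-projective m (g ∘ (0# ∷_)) invariant-0) ⟩
    g (replicate (suc m) 0#) ℕ.+ units ℕ.* ∑[ v ∈ normalForms m ] g (0# ∷ v) ℕ.+ units ℕ.* G 1#
      ≡⟨ +-*-Solver.solve 4 (λ z u x y → z :+ u :* x :+ u :* y := z :+ u :* (y :+ x)) refl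
           (g (replicate (suc m) 0#)) units (∑[ v ∈ normalForms m ] g (0# ∷ v)) (G 1#) ⟩
    g (replicate (suc m) 0#) ℕ.+ units ℕ.* (G 1# ℕ.+ ∑[ v ∈ normalForms m ] g (0# ∷ v))
      ≡⟨ cong (λ s → g (replicate (suc m) 0#) ℕ.+ units ℕ.* s) (∑-normalForms m g) ⟨
    g (replicate (suc m) 0#) ℕ.+ units ℕ.* ∑ (normalForms (suc m)) g ∎
    where
    open +-*-Solver using (_:+_; _:*_; _:=_)
    G : Fin q → ℕ
    G a = ∑[ v ∈ vectors m ] g (a ∷ v)
    invariant-0 : ScaleInvariant (g ∘ (0# ∷_))
    invariant-0 a v a≢0 = trans (cong (λ z → g (z ∷ scale a v)) (sym (zeroʳ a))) (invariant a (0# ∷ v) a≢0)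
    pointwise : ∀ a (d : Dec (a ≡ 0#)) → G a ≡ 𝟙 d ℕ.* G a ℕ.+ 𝟙 (¬? d) ℕ.* G 1#
    pointwise a (yes _) = sym (trans (ℕₚ.+-identityʳ _) (ℕₚ.+-identityʳ _))
    pointwise a (no a≢0) = begin
      G a ≡⟨ ∑-reindex _≟ᵥ_ (vectors-unique m) ∈-vectors (scale-injective a≢0) (g ∘ (a ∷_)) ⟨
      ∑[ v ∈ vectors m ] g (a ∷ scale a v)
        ≡⟨ ∑-cong (vectors m) (λ v → cong (λ b → g (b ∷ scale a v)) (sym (*-identityʳ a))) ⟩
      ∑[ v ∈ vectors m ] g (scale a (1# ∷ v)) ≡⟨ ∑-cong (vectors m) (λ v → invariant a (1# ∷ v) a≢0) ⟩
      G 1# ≡⟨ ℕₚ.+-identityʳ (G 1#) ⟨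
      G 1# ℕ.+ 0 ∎

  ∑-vectors-reindex : ∀ {m} {f : Vec (Fin q) m → Vec (Fin q) m} → Injective _≡_ _≡_ f →
    (g : Vec (Fin q) m → ℕ) → ∑[ v ∈ vectors m ] g (f v) ≡ ∑ (vectors m) g
  ∑-vectors-reindex {m} f-injective =
    ∑-reindex _≟ᵥ_ (vectors-unique m) ∈-vectors f-injective

  linear-roots : ∀ {a} b → a ≢ 0# → ∑[ t ∈ elements ] 𝟙 (a * t + b ≟ 0#) ≡ 1
  linear-roots {a} b a≢0 = begin
    ∑[ t ∈ elements ] 𝟙 (a * t + b ≟ 0#)
      ≡⟨ ∑-reindex _≟_ elements-unique ∈-elements injective (λ t → 𝟙 (t ≟ 0#)) ⟩
    ∑[ t ∈ elements ] 𝟙 (t ≟ 0#) ≡⟨ ∑-δ _≟_ elements-unique (∈-elements 0#) ⟩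
    1 ∎
    where
    injective : Injective _≡_ _≡_ (λ t → a * t + b)
    injective eq = *-cancelˡ a≢0 (+-cancelʳ b _ _ eq)

-- The symplectic form, the quadric and changes of basis

module Geometry (n : ℕ) (K : FiniteField (2 ℕ.^ n)) (h : ℕ) (coprime : gcd n h ≡ 1) where

  private
    q = 2 ℕ.^ n

  open FieldProperties K
  open Characteristic2 n K
  open Frobenius n K h coprime
  open Projective K
  open ≡-Reasoning

  Line Space : Set
  Line = Vec (Fin q) 2
  Space = Vec (Fin q) 4

  Z : Fin q → ℕ
  Z a = 𝟙 (a ≟ 0#)

  Z-yes : ∀ {a} → a ≡ 0# → Z a ≡ 1
  Z-yes {a} = 𝟙-yes (a ≟ 0#)

  Z-no : ∀ {a} → a ≢ 0# → Z a ≡ 0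
  Z-no {a} = 𝟙-no (a ≟ 0#)

  Z-scale : ∀ {a} b → a ≢ 0# → Z (a * b) ≡ Z b
  Z-scale {a} b a≢0 = 𝟙-⇔ (a * b ≟ 0#) (b ≟ 0#) (x*y≡0⇒y≡0 a≢0)
    (λ b≡0 → trans (cong (a *_) b≡0) (zeroʳ a))

  form : Space → Space → Fin q
  form (x₁ ∷ x₂ ∷ x₃ ∷ x₄ ∷ []) (y₁ ∷ y₂ ∷ y₃ ∷ y₄ ∷ []) =
    x₁ * y₄ + x₂ * y₃ + x₃ * y₂ + x₄ * y₁

  -- The determinant of the matrix with rows (x₁, x₂) and (x₃, x₄); its polarization is `form`.
  det : Space → Fin q
  det (x₁ ∷ x₂ ∷ x₃ ∷ x₄ ∷ []) = x₁ * x₄ + x₂ * x₃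

  area : Line → Line → Fin q
  area (v₁ ∷ v₂ ∷ []) (w₁ ∷ w₂ ∷ []) = v₁ * w₂ + v₂ * w₁

  tensor : Line → Line → Space
  tensor (v₁ ∷ v₂ ∷ []) (w₁ ∷ w₂ ∷ []) = σ v₁ * w₁ ∷ σ v₁ * w₂ ∷ σ v₂ * w₁ ∷ σ v₂ * w₂ ∷ []

  -- The point x seen as a form on 𝔽_q², σ-linear in v and linear in w; the points
  -- of the arc are the tensor v v, and the zeros v of B x v v correspond to the
  -- osculating planes through x.
  B : Space → Line → Line → Fin q
  B x v w = form x (tensor v w)

  -- The Gram matrix of `B x` with respect to s and t, row by row. Under it the osculating planes at
  -- s and t become the planes where the first and the fourth coordinate vanish.
  frame : Line → Line → Space → Space
  frame s t x = B x s s ∷ B x s t ∷ B x t s ∷ B x t t ∷ []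

  form-comm : ∀ x y → form x y ≡ form y x
  form-comm (x₁ ∷ x₂ ∷ x₃ ∷ x₄ ∷ []) (y₁ ∷ y₂ ∷ y₃ ∷ y₄ ∷ []) =
    solve 8 (λ x₁ x₂ x₃ x₄ y₁ y₂ y₃ y₄ →
      x₁ :* y₄ :+ x₂ :* y₃ :+ x₃ :* y₂ :+ x₄ :* y₁ :=
      y₁ :* x₄ :+ y₂ :* x₃ :+ y₃ :* x₂ :+ y₄ :* x₁) refl x₁ x₂ x₃ x₄ y₁ y₂ y₃ y₄

  form-scale : ∀ a x y → form (scale a x) y ≡ a * form x y
  form-scale a (x₁ ∷ x₂ ∷ x₃ ∷ x₄ ∷ []) (y₁ ∷ y₂ ∷ y₃ ∷ y₄ ∷ []) =
    solve 9 (λ a x₁ x₂ x₃ x₄ y₁ y₂ y₃ y₄ →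
      (a :* x₁) :* y₄ :+ (a :* x₂) :* y₃ :+ (a :* x₃) :* y₂ :+ (a :* x₄) :* y₁ :=
      a :* (x₁ :* y₄ :+ x₂ :* y₃ :+ x₃ :* y₂ :+ x₄ :* y₁)) refl a x₁ x₂ x₃ x₄ y₁ y₂ y₃ y₄

  -- The expanded form of `σ (area s t)`, in which the solver can treat the values of σ as
  -- independent variables.
  σ-area : Line → Line → Fin q
  σ-area (s₁ ∷ s₂ ∷ []) (t₁ ∷ t₂ ∷ []) = σ s₁ * σ t₂ + σ s₂ * σ t₁

  σ-area≡ : ∀ s t → σ-area s t ≡ σ (area s t)
  σ-area≡ (s₁ ∷ s₂ ∷ []) (t₁ ∷ t₂ ∷ []) = sym (trans (σ-+ (s₁ * t₂) (s₂ * t₁)) (cong₂ _+_ (σ-* s₁ t₂) (σ-* s₂ t₁)))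

  -- With a point seen as a 2 by 2 matrix, `frame` multiplies it on one side by the matrix of σ s
  -- and σ t and on the other by that of s and t. The determinant is multiplied by both
  -- determinants, and so is its polarization `form`.
  form-frame : ∀ s t x y → form (frame s t x) (frame s t y) ≡ σ (area s t) * area s t * form x y
  form-frame s@(s₁ ∷ s₂ ∷ []) t@(t₁ ∷ t₂ ∷ []) x@(x₁ ∷ x₂ ∷ x₃ ∷ x₄ ∷ []) y@(y₁ ∷ y₂ ∷ y₃ ∷ y₄ ∷ []) =
    trans {j = σ-area s t * area s t * form x y}
    (solve 16 (λ s₁ s₂ t₁ t₂ S₁ S₂ T₁ T₂ x₁ x₂ x₃ x₄ y₁ y₂ y₃ y₄ →
      let B = λ x₁ x₂ x₃ x₄ V₁ V₂ w₁ w₂ →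
                x₁ :* (V₂ :* w₂) :+ x₂ :* (V₂ :* w₁) :+ x₃ :* (V₁ :* w₂) :+ x₄ :* (V₁ :* w₁)
          X = B x₁ x₂ x₃ x₄
          Y = B y₁ y₂ y₃ y₄ in
      X S₁ S₂ s₁ s₂ :* Y T₁ T₂ t₁ t₂ :+ X S₁ S₂ t₁ t₂ :* Y T₁ T₂ s₁ s₂ :+
      X T₁ T₂ s₁ s₂ :* Y S₁ S₂ t₁ t₂ :+ X T₁ T₂ t₁ t₂ :* Y S₁ S₂ s₁ s₂ :=
      (S₁ :* T₂ :+ S₂ :* T₁) :* (s₁ :* t₂ :+ s₂ :* t₁) :*
        (x₁ :* y₄ :+ x₂ :* y₃ :+ x₃ :* y₂ :+ x₄ :* y₁))
      refl s₁ s₂ t₁ t₂ (σ s₁) (σ s₂) (σ t₁) (σ t₂) x₁ x₂ x₃ x₄ y₁ y₂ y₃ y₄)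
    (cong (λ k → k * area s t * form x y) (σ-area≡ s t))

  det-frame : ∀ s t x → det (frame s t x) ≡ σ (area s t) * area s t * det x
  det-frame s@(s₁ ∷ s₂ ∷ []) t@(t₁ ∷ t₂ ∷ []) x@(x₁ ∷ x₂ ∷ x₃ ∷ x₄ ∷ []) =
    trans {j = σ-area s t * area s t * det x}
    (solve 12 (λ s₁ s₂ t₁ t₂ S₁ S₂ T₁ T₂ x₁ x₂ x₃ x₄ →
      let X = λ V₁ V₂ w₁ w₂ →
                x₁ :* (V₂ :* w₂) :+ x₂ :* (V₂ :* w₁) :+ x₃ :* (V₁ :* w₂) :+ x₄ :* (V₁ :* w₁) in
      X S₁ S₂ s₁ s₂ :* X T₁ T₂ t₁ t₂ :+ X S₁ S₂ t₁ t₂ :* X T₁ T₂ s₁ s₂ :=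
      (S₁ :* T₂ :+ S₂ :* T₁) :* (s₁ :* t₂ :+ s₂ :* t₁) :* (x₁ :* x₄ :+ x₂ :* x₃))
      refl s₁ s₂ t₁ t₂ (σ s₁) (σ s₂) (σ t₁) (σ t₂) x₁ x₂ x₃ x₄)
    (cong (λ k → k * area s t * det x) (σ-area≡ s t))

  form-nondegenerate : ∀ {x y} → (∀ z → form x z ≡ form y z) → x ≡ y
  form-nondegenerate {x₁ ∷ x₂ ∷ x₃ ∷ x₄ ∷ []} {y₁ ∷ y₂ ∷ y₃ ∷ y₄ ∷ []} eq =
    cong₂ _∷_ (compare (0# ∷ 0# ∷ 0# ∷ 1# ∷ []) (
      solve 4 (λ a b c d → a :* I :+ b :* O :+ c :* O :+ d :* O := a) refl))
    (cong₂ _∷_ (compare (0# ∷ 0# ∷ 1# ∷ 0# ∷ []) (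
      solve 4 (λ a b c d → a :* O :+ b :* I :+ c :* O :+ d :* O := b) refl))
    (cong₂ _∷_ (compare (0# ∷ 1# ∷ 0# ∷ 0# ∷ []) (
      solve 4 (λ a b c d → a :* O :+ b :* O :+ c :* I :+ d :* O := c) refl))
    (cong (_∷ []) (compare (1# ∷ 0# ∷ 0# ∷ 0# ∷ []) (
      solve 4 (λ a b c d → a :* O :+ b :* O :+ c :* O :+ d :* I := d) refl)))))
    where
    O = con false
    I = con true
    compare : {f : Fin q → Fin q → Fin q → Fin q → Fin q} (z : Space) →
      (∀ a b c d → form (a ∷ b ∷ c ∷ d ∷ []) z ≡ f a b c d) → f x₁ x₂ x₃ x₄ ≡ f y₁ y₂ y₃ y₄
    compare z simplify = trans (sym (simplify x₁ x₂ x₃ x₄)) (trans (eq z) (simplify y₁ y₂ y₃ y₄))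

  private
    variable
      s t v w : Line
      x y p : Space

  frame-scalar-≢0 : area s t ≢ 0# → σ (area s t) * area s t ≢ 0#
  frame-scalar-≢0 a≢0 = *-≢0 (σ-≢0 a≢0) a≢0

  frame-injective : area s t ≢ 0# → Injective _≡_ _≡_ (frame s t)
  frame-injective {s} {t} a≢0 {x} {y} eq = form-nondegenerate λ z →
    *-cancelˡ (frame-scalar-≢0 {s} {t} a≢0) (begin
      σ (area s t) * area s t * form x z ≡⟨ form-frame s t x z ⟨
      form (frame s t x) (frame s t z)   ≡⟨ cong (λ x′ → form x′ (frame s t z)) eq ⟩
      form (frame s t y) (frame s t z)   ≡⟨ form-frame s t y z ⟩
      σ (area s t) * area s t * form y z ∎)

  det-frame-≢0 : area s t ≢ 0# → det x ≢ 0# → det (frame s t x) ≢ 0#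
  det-frame-≢0 {s} {t} {x} a≢0 d≢0 eq =
    *-≢0 (frame-scalar-≢0 {s} {t} a≢0) d≢0 (trans (sym (det-frame s t x)) eq)

  area≡0⇒≡ : NormalForm v → NormalForm w → area v w ≡ 0# → v ≡ w
  area≡0⇒≡ (lead (a ∷ [])) (lead (b ∷ [])) eq =
    cong (λ c → 1# ∷ c ∷ []) (sym (x+y≡0⇒x≡y (trans
      (solve 2 (λ a b → b :+ a := con true :* b :+ a :* con true) refl a b) eq)))
  area≡0⇒≡ (lead (a ∷ [])) (skip (lead [])) eq = contradiction
    (trans (solve 1 (λ a → con true := con true :* con true :+ a :* con false) refl a) eq) 1≢0
  area≡0⇒≡ (skip (lead [])) (lead (b ∷ [])) eq = contradiction
    (trans (solve 1 (λ b → con true := con false :* b :+ con true :* con true) refl b) eq) 1≢0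
  area≡0⇒≡ (skip (lead [])) (skip (lead [])) eq = refl

  area-≢0 : NormalForm s → NormalForm t → s ≢ t → area s t ≢ 0#
  area-≢0 nf-s nf-t s≢t eq = s≢t (area≡0⇒≡ nf-s nf-t eq)

  complement : NormalForm t → ∃ λ s → area s t ≢ 0#
  complement (lead (a ∷ [])) = (0# ∷ 1# ∷ []) , λ eq → 1≢0 (trans
    (solve 1 (λ a → con true := con false :* a :+ con true :* con true) refl a) eq)
  complement (skip (lead [])) = (1# ∷ 0# ∷ []) , λ eq → 1≢0 (trans
    (solve 0 (con true := con true :* con true :+ con false :* con false) refl) eq)

  ∑-frame : area s t ≢ 0# → (g : Space → ℕ) → ∑[ v ∈ vectors 4 ] g (frame s t v) ≡ ∑ (vectors 4) g
  ∑-frame {s} {t} a≢0 = ∑-vectors-reindex (frame-injective {s} {t} a≢0)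

  Z-form-frame : area s t ≢ 0# → ∀ x y → Z (form (frame s t x) (frame s t y)) ≡ Z (form x y)
  Z-form-frame {s} {t} a≢0 x y =
    trans (cong Z (form-frame s t x y)) (Z-scale (form x y) (frame-scalar-≢0 {s} {t} a≢0))

  ∑-coordinates : (g : Space → ℕ) → ∑ (vectors 4) g ≡
    ∑[ a ∈ elements ] ∑[ b ∈ elements ] ∑[ c ∈ elements ] ∑[ d ∈ elements ] g (a ∷ b ∷ c ∷ d ∷ [])
  ∑-coordinates g = begin
    ∑ (vectors 4) g ≡⟨ ∑-vectors 3 g ⟩
    ∑[ a ∈ elements ] ∑[ v ∈ vectors 3 ] g (a ∷ v)
      ≡⟨ ∑-cong elements (λ a → ∑-vectors 2 _) ⟩
    ∑[ a ∈ elements ] ∑[ b ∈ elements ] ∑[ v ∈ vectors 2 ] g (a ∷ b ∷ v)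
      ≡⟨ ∑-cong elements (λ a → ∑-cong elements λ b → ∑-vectors 1 _) ⟩
    ∑[ a ∈ elements ] ∑[ b ∈ elements ] ∑[ c ∈ elements ] ∑[ v ∈ vectors 1 ] g (a ∷ b ∷ c ∷ v)
      ≡⟨ ∑-cong elements (λ a → ∑-cong elements λ b → ∑-cong elements λ c →
           trans (∑-vectors 0 _) (∑-cong elements λ d → ℕₚ.+-identityʳ _)) ⟩
    ∑[ a ∈ elements ] ∑[ b ∈ elements ] ∑[ c ∈ elements ] ∑[ d ∈ elements ] g (a ∷ b ∷ c ∷ d ∷ []) ∎

  ∑-constant : ∀ k → ∑[ a ∈ elements ] k ≡ q ℕ.* k
  ∑-constant k = trans (∑-const elements k) (cong (ℕ._* k) length-elements)

  ∑-Z* : (f : Fin q → ℕ) → ∑[ a ∈ elements ] (Z a ℕ.* f a) ≡ f 0#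
  ∑-Z* f = ∑-pick _≟_ elements-unique (∈-elements 0#) f

  ∑-linear : ∀ {a} → a ≢ 0# → (e : Fin q → Fin q) → ∀ b → (∀ t → e t ≡ a * t + b) →
             ∑[ t ∈ elements ] Z (e t) ≡ 1
  ∑-linear a≢0 e b eq = trans (∑-cong elements λ t → cong Z (eq t)) (linear-roots b a≢0)

-- Point counts in a polar plane

module _ where
  open +-*-Solver

  *-reverse : ∀ i j k → i ℕ.* (j ℕ.* k) ≡ k ℕ.* (j ℕ.* i)
  *-reverse = solve 3 (λ i j k → i :* (j :* k) := k :* (j :* i)) refl

  q*q≡q+u*q : ∀ u {q} → 1 ℕ.+ u ≡ q → q ℕ.* (q ℕ.* 1) ≡ q ℕ.+ u ℕ.* q ℕ.* 1
  q*q≡q+u*q u refl = solve 1 (λ u → let q = con 1 :+ u in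
    q :* (q :* con 1) := q :+ u :* q :* con 1) refl u

  -- A cone over k points has 1 + (q - 1) k vectors; u stands for q - 1, and the value of k in a
  -- plane is q² + q + 1.
  plane-size : ∀ u {q} → 1 ℕ.+ u ≡ q → q ℕ.* (q ℕ.* q) ≡ 1 ℕ.+ u ℕ.* (q ℕ.* q ℕ.+ q ℕ.+ 1)
  plane-size u refl = solve 1 (λ u → let q = con 1 :+ u in
    q :* (q :* q) := con 1 :+ u :* (q :* q :+ q :+ con 1)) refl u

  line-size : ∀ u {q} → 1 ℕ.+ u ≡ q → q ℕ.* q ≡ 1 ℕ.+ u ℕ.* (q ℕ.+ 1)
  line-size u refl = solve 1 (λ u → let q = con 1 :+ u in
    q :* q := con 1 :+ u :* (q :+ con 1)) refl u

  point-or-line-size : ∀ u z {q} → 1 ℕ.+ u ≡ q → q ℕ.+ u ℕ.* q ℕ.* z ≡ 1 ℕ.+ u ℕ.* (1 ℕ.+ q ℕ.* z)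
  point-or-line-size u z refl = solve 2 (λ u z → let q = con 1 :+ u in
    q :+ u :* q :* z := con 1 :+ u :* (con 1 :+ q :* z)) refl u z

module Counting (n : ℕ) (K : FiniteField (2 ℕ.^ n)) (h : ℕ) (coprime : gcd n h ≡ 1) where

  private
    q = 2 ℕ.^ n

  open FieldProperties K
  open Characteristic2 n K
  open Frobenius n K h coprime
  open Projective K
  open Geometry n K h coprime
  open ≡-Reasoning

  private
    variable
      s t v w : Line
      x y p : Space

  det-≢0⇒ : ∀ {x₁ x₂ x₃ x₄} → x₁ * x₄ + x₂ * x₃ ≢ 0# → x₁ ≡ 0# → x₂ ≢ 0# × x₃ ≢ 0#
  det-≢0⇒ {x₂ = x₂} {x₃} {x₄} d≢0 refl =
      (λ { refl → d≢0 (solve 2 (λ c d → con false :* d :+ con false :* c := con false) refl x₃ x₄) })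
    , (λ { refl → d≢0 (solve 2 (λ b d → con false :* d :+ b :* con false := con false) refl x₂ x₄) })

  ∑₂-linear : ∀ {a b} → a ≢ 0# ⊎ b ≢ 0# → ∀ e →
    ∑[ s ∈ elements ] ∑[ t ∈ elements ] Z (a * t + b * s + e) ≡ q
  ∑₂-linear {a} {b} (inj₁ a≢0) e = begin
    ∑[ s ∈ elements ] ∑[ t ∈ elements ] Z (a * t + b * s + e)
      ≡⟨ ∑-cong elements (λ s → ∑-linear a≢0 (λ t → a * t + b * s + e) (b * s + e) λ t → +-assoc _ _ _) ⟩
    ∑[ s ∈ elements ] 1 ≡⟨ trans (∑-constant 1) (ℕₚ.*-identityʳ q) ⟩
    q ∎
  ∑₂-linear {a} {b} (inj₂ b≢0) e = begin
    ∑[ s ∈ elements ] ∑[ t ∈ elements ] Z (a * t + b * s + e) ≡⟨ ∑-swap elements elements _ ⟩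
    ∑[ t ∈ elements ] ∑[ s ∈ elements ] Z (a * t + b * s + e)
      ≡⟨ ∑-cong elements (λ t → ∑-linear b≢0 (λ s → a * t + b * s + e) (a * t + e) λ s →
           solve 5 (λ a b s t e → a :* t :+ b :* s :+ e := b :* s :+ (a :* t :+ e)) refl a b s t e) ⟩
    ∑[ t ∈ elements ] 1 ≡⟨ trans (∑-constant 1) (ℕₚ.*-identityʳ q) ⟩
    q ∎

  plane-vectors : ∀ x → det x ≢ 0# → ∑[ p ∈ vectors 4 ] Z (form x p) ≡ q ℕ.* (q ℕ.* q)
  plane-vectors x@(x₁ ∷ x₂ ∷ x₃ ∷ x₄ ∷ []) d≢0 = begin
    ∑[ p ∈ vectors 4 ] Z (form x p) ≡⟨ ∑-coordinates (Z ∘ form x) ⟩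
    ∑[ a ∈ elements ] ∑[ b ∈ elements ] ∑[ c ∈ elements ] ∑[ d ∈ elements ] Z (x₁ * d + x₂ * c + x₃ * b + x₄ * a)
      ≡⟨ ∑-cong elements (λ a → ∑-cong elements λ b → ∑-cong elements λ c → ∑-cong elements λ d →
           cong Z (+-assoc _ (x₃ * b) (x₄ * a))) ⟩
    ∑[ a ∈ elements ] ∑[ b ∈ elements ] ∑[ c ∈ elements ] ∑[ d ∈ elements ] Z (x₁ * d + x₂ * c + (x₃ * b + x₄ * a))
      ≡⟨ ∑-cong elements (λ a → ∑-cong elements λ b → ∑₂-linear nonzero (x₃ * b + x₄ * a)) ⟩
    ∑[ a ∈ elements ] ∑[ b ∈ elements ] q ≡⟨ ∑-cong elements (λ a → ∑-constant q) ⟩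
    ∑[ a ∈ elements ] (q ℕ.* q) ≡⟨ ∑-constant (q ℕ.* q) ⟩
    q ℕ.* (q ℕ.* q) ∎
    where
    nonzero : x₁ ≢ 0# ⊎ x₂ ≢ 0#
    nonzero with x₁ ≟ 0#
    ... | no x₁≢0 = inj₁ x₁≢0
    ... | yes x₁≡0 = inj₂ (proj₁ (det-≢0⇒ d≢0 x₁≡0))

  first fourth : Space → Fin q
  first (a ∷ b ∷ c ∷ d ∷ []) = a
  fourth (a ∷ b ∷ c ∷ d ∷ []) = d

  -- Once d = 0, a nonzero determinant excludes x₂ = x₄ = 0, which is why c and a, the variables
  -- with these coefficients, are summed innermost.
  tangent-vectors : ∀ x → det x ≢ 0# →
    ∑[ p ∈ vectors 4 ] (Z (form x p) ℕ.* Z (fourth p)) ≡ q ℕ.* q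
  tangent-vectors x@(x₁ ∷ x₂ ∷ x₃ ∷ x₄ ∷ []) d≢0 = begin
    ∑[ p ∈ vectors 4 ] (Z (form x p) ℕ.* Z (fourth p)) ≡⟨ ∑-coordinates _ ⟩
    ∑[ a ∈ elements ] ∑[ b ∈ elements ] ∑[ c ∈ elements ] ∑[ d ∈ elements ]
      (Z (x₁ * d + x₂ * c + x₃ * b + x₄ * a) ℕ.* Z d)
      ≡⟨ ∑-cong elements (λ a → ∑-cong elements λ b → ∑-cong elements λ c →
           trans (∑-cong elements λ d → ℕₚ.*-comm (Z (x₁ * d + x₂ * c + x₃ * b + x₄ * a)) (Z d)) (∑-Z* _)) ⟩
    ∑[ a ∈ elements ] ∑[ b ∈ elements ] ∑[ c ∈ elements ] Z (x₁ * 0# + x₂ * c + x₃ * b + x₄ * a)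
      ≡⟨ ∑-swap elements elements _ ⟩
    ∑[ b ∈ elements ] ∑[ a ∈ elements ] ∑[ c ∈ elements ] Z (x₁ * 0# + x₂ * c + x₃ * b + x₄ * a)
      ≡⟨ ∑-cong elements (λ b → ∑-cong elements λ a → ∑-cong elements λ c → cong Z
           (solve 7 (λ x₁ x₂ x₃ x₄ a b c → x₁ :* con false :+ x₂ :* c :+ x₃ :* b :+ x₄ :* a :=
             x₂ :* c :+ x₄ :* a :+ x₃ :* b) refl x₁ x₂ x₃ x₄ a b c)) ⟩
    ∑[ b ∈ elements ] ∑[ a ∈ elements ] ∑[ c ∈ elements ] Z (x₂ * c + x₄ * a + x₃ * b)
      ≡⟨ ∑-cong elements (λ b → ∑₂-linear nonzero (x₃ * b)) ⟩
    ∑[ b ∈ elements ] q ≡⟨ ∑-constant q ⟩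
    q ℕ.* q ∎
    where
    nonzero : x₂ ≢ 0# ⊎ x₄ ≢ 0#
    nonzero with x₂ ≟ 0#
    ... | no x₂≢0 = inj₁ x₂≢0
    ... | yes refl = inj₂ λ { refl → d≢0
      (solve 2 (λ a c → a :* con false :+ con false :* c := con false) refl x₁ x₃) }

  -- With a = d = 0 there remains x₂ c + x₃ b = 0, which has q solutions, or q² if both coefficients
  -- vanish; the excess q² - q is `units * q`. In the frame of s and t these coefficients are
  -- `B x s t` and `B x t s`.
  chord-vectors : ∀ x → ∑[ p ∈ vectors 4 ] (Z (form x p) ℕ.* (Z (first p) ℕ.* Z (fourth p)))
    ≡ q ℕ.+ units ℕ.* q ℕ.* (Z (Vec.lookup x (suc zero)) ℕ.* Z (Vec.lookup x (suc (suc zero))))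
  chord-vectors x@(x₁ ∷ x₂ ∷ x₃ ∷ x₄ ∷ []) = begin
    ∑[ p ∈ vectors 4 ] (Z (form x p) ℕ.* (Z (first p) ℕ.* Z (fourth p))) ≡⟨ ∑-coordinates _ ⟩
    ∑[ a ∈ elements ] ∑[ b ∈ elements ] ∑[ c ∈ elements ] ∑[ d ∈ elements ]
      (Z (f a b c d) ℕ.* (Z a ℕ.* Z d))
      ≡⟨ ∑-cong elements (λ a → ∑-cong elements λ b → ∑-cong elements λ c →
           trans (∑-cong elements λ d → *-reverse (Z (f a b c d)) (Z a) (Z d)) (∑-Z* _)) ⟩
    ∑[ a ∈ elements ] ∑[ b ∈ elements ] ∑[ c ∈ elements ] (Z a ℕ.* Z (f a b c 0#))
      ≡⟨ ∑-cong elements (λ a → trans (∑-cong elements λ b → ∑-*ˡ elements (Z a) _) (∑-*ˡ elements (Z a) _)) ⟩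
    ∑[ a ∈ elements ] (Z a ℕ.* (∑[ b ∈ elements ] ∑[ c ∈ elements ] Z (f a b c 0#))) ≡⟨ ∑-Z* _ ⟩
    ∑[ b ∈ elements ] ∑[ c ∈ elements ] Z (f 0# b c 0#)
      ≡⟨ ∑-cong elements (λ b → ∑-cong elements λ c → cong Z
           (solve 6 (λ x₁ x₂ x₃ x₄ b c → x₁ :* con false :+ x₂ :* c :+ x₃ :* b :+ x₄ :* con false :=
             x₂ :* c :+ x₃ :* b :+ con false) refl x₁ x₂ x₃ x₄ b c)) ⟩
    ∑[ b ∈ elements ] ∑[ c ∈ elements ] Z (x₂ * c + x₃ * b + 0#) ≡⟨ by-cases (x₂ ≟ 0#) (x₃ ≟ 0#) ⟩
    q ℕ.+ units ℕ.* q ℕ.* (Z x₂ ℕ.* Z x₃) ∎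
    where
    f : Fin q → Fin q → Fin q → Fin q → Fin q
    f a b c d = x₁ * d + x₂ * c + x₃ * b + x₄ * a
    by-cases : (d₂ : Dec (x₂ ≡ 0#)) (d₃ : Dec (x₃ ≡ 0#)) →
      ∑[ b ∈ elements ] ∑[ c ∈ elements ] Z (x₂ * c + x₃ * b + 0#)
        ≡ q ℕ.+ units ℕ.* q ℕ.* (𝟙 d₂ ℕ.* 𝟙 d₃)
    by-cases (no x₂≢0) _ = trans (∑₂-linear (inj₁ x₂≢0) 0#)
      (sym (trans (cong (q ℕ.+_) (ℕₚ.*-zeroʳ (units ℕ.* q))) (ℕₚ.+-identityʳ q)))
    by-cases (yes _) (no x₃≢0) = trans (∑₂-linear (inj₂ x₃≢0) 0#)
      (sym (trans (cong (q ℕ.+_) (ℕₚ.*-zeroʳ (units ℕ.* q))) (ℕₚ.+-identityʳ q)))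
    by-cases (yes refl) (yes refl) = begin
      ∑[ b ∈ elements ] ∑[ c ∈ elements ] Z (0# * c + 0# * b + 0#)
        ≡⟨ ∑-cong elements (λ b → trans (∑-cong elements λ c → Z-yes
             (solve 2 (λ b c → con false :* c :+ con false :* b :+ con false := con false) refl b c)) (∑-constant 1)) ⟩
      ∑[ b ∈ elements ] (q ℕ.* 1) ≡⟨ ∑-constant (q ℕ.* 1) ⟩
      q ℕ.* (q ℕ.* 1) ≡⟨ q*q≡q+u*q units 1+units≡q ⟩
      q ℕ.+ units ℕ.* q ℕ.* 1 ∎

  units-nonZero : ℕ.NonZero units
  units-nonZero with units | 1+units≡q | 2≤q K
  ... | zero  | eq | 2≤q = contradiction (subst (2 ℕ.≤_) (sym eq) 2≤q) λ { (ℕ.s≤s ()) }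
  ... | suc _ | _  | _   = _

  -- What is needed to divide a count of vectors by q - 1: the weight depends on the point only, and
  -- the zero vector is counted once.
  Cone : (Space → ℕ) → Set
  Cone g = ScaleInvariant g × g (replicate 4 0#) ≡ 1

  cone-form : ∀ y → Cone (λ p → Z (form p y))
  cone-form y@(y₁ ∷ y₂ ∷ y₃ ∷ y₄ ∷ []) =
      (λ a v a≢0 → trans (cong Z (form-scale a v y)) (Z-scale _ a≢0))
    , Z-yes (solve 4 (λ y₁ y₂ y₃ y₄ → con false :* y₄ :+ con false :* y₃ :+ con false :* y₂ :+ con false :* y₁
        := con false) refl y₁ y₂ y₃ y₄)

  cone-form′ : ∀ x → Cone (λ p → Z (form x p))
  cone-form′ x =
      (λ a v a≢0 → trans (cong Z (form-comm x (scale a v))) (trans (proj₁ (cone-form x) a v a≢0)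
        (cong Z (form-comm v x))))
    , trans (cong Z (form-comm x (replicate 4 0#))) (proj₂ (cone-form x))

  cone-* : ∀ {f g} → Cone f → Cone g → Cone (λ p → f p ℕ.* g p)
  cone-* (inv-f , f≡1) (inv-g , g≡1) =
    (λ a v a≢0 → cong₂ ℕ._*_ (inv-f a v a≢0) (inv-g a v a≢0)) , cong₂ ℕ._*_ f≡1 g≡1

  ∑-points : ∀ {g} → Cone g → ∀ k → ∑ (vectors 4) g ≡ 1 ℕ.+ units ℕ.* k →
             ∑ (normalForms 4) g ≡ k
  ∑-points {g} (invariant , g0≡1) k eq = ℕₚ.*-cancelˡ-≡ _ _ units ⦃ units-nonZero ⦄ (ℕₚ.+-cancelˡ-≡ 1 _ _ (begin
    1 ℕ.+ units ℕ.* ∑ (normalForms 4) g ≡⟨ cong (ℕ._+ units ℕ.* ∑ (normalForms 4) g) g0≡1 ⟨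
    g (replicate 4 0#) ℕ.+ units ℕ.* ∑ (normalForms 4) g ≡⟨ ∑-vectors-projective 4 g invariant ⟨
    ∑ (vectors 4) g ≡⟨ eq ⟩
    1 ℕ.+ units ℕ.* k ∎))

  plane-points : ∀ x → det x ≢ 0# → ∑[ p ∈ normalForms 4 ] Z (form x p) ≡ q ℕ.* q ℕ.+ q ℕ.+ 1
  plane-points x d≢0 = ∑-points (cone-form′ x) _
    (trans (plane-vectors x d≢0) (plane-size units 1+units≡q))

  -- A point x off the quadric is not on the arc, so its polar plane differs from the osculating
  -- plane at t and meets it in a line.
  tangent-points : ∀ x → det x ≢ 0# → NormalForm t →
    ∑[ p ∈ normalForms 4 ] (Z (form x p) ℕ.* Z (B p t t)) ≡ q ℕ.+ 1
  tangent-points {t} x d≢0 nf with s , a≢0 ← complement nf =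
    ∑-points (cone-* (cone-form′ x) (cone-form (tensor t t))) _ (begin
      ∑[ p ∈ vectors 4 ] (Z (form x p) ℕ.* Z (B p t t))
        ≡⟨ ∑-cong (vectors 4) (λ p → cong (ℕ._* Z (B p t t)) (sym (Z-form-frame {s} {t} a≢0 x p))) ⟩
      ∑[ p ∈ vectors 4 ] (Z (form (frame s t x) (frame s t p)) ℕ.* Z (fourth (frame s t p)))
        ≡⟨ ∑-frame {s} {t} a≢0 (λ p → Z (form (frame s t x) p) ℕ.* Z (fourth p)) ⟩
      ∑[ p ∈ vectors 4 ] (Z (form (frame s t x) p) ℕ.* Z (fourth p))
        ≡⟨ tangent-vectors (frame s t x) (det-frame-≢0 {s} {t} {x} a≢0 d≢0) ⟩
      q ℕ.* q ≡⟨ line-size units 1+units≡q ⟩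
      1 ℕ.+ units ℕ.* (q ℕ.+ 1) ∎)

  -- Two osculating planes meet in the line polar to the chord through s and t. The polar plane of x
  -- contains this line if x lies on the chord, and otherwise meets it in one point.
  chord-points : ∀ x → area s t ≢ 0# →
    ∑[ p ∈ normalForms 4 ] (Z (form x p) ℕ.* (Z (B p s s) ℕ.* Z (B p t t)))
      ≡ 1 ℕ.+ q ℕ.* (Z (B x s t) ℕ.* Z (B x t s))
  chord-points {s} {t} x a≢0 =
    ∑-points (cone-* (cone-form′ x)
      (cone-* (cone-form (tensor s s)) (cone-form (tensor t t)))) _ (begin
      ∑[ p ∈ vectors 4 ] (Z (form x p) ℕ.* (Z (B p s s) ℕ.* Z (B p t t)))
        ≡⟨ ∑-cong (vectors 4) (λ p → cong (ℕ._* (Z (B p s s) ℕ.* Z (B p t t))) (sym (Z-form-frame {s} {t} a≢0 x p))) ⟩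
      ∑[ p ∈ vectors 4 ] (Z (form (frame s t x) (frame s t p)) ℕ.*
                          (Z (first (frame s t p)) ℕ.* Z (fourth (frame s t p))))
        ≡⟨ ∑-frame {s} {t} a≢0 (λ p → Z (form (frame s t x) p) ℕ.* (Z (first p) ℕ.* Z (fourth p))) ⟩
      ∑[ p ∈ vectors 4 ] (Z (form (frame s t x) p) ℕ.* (Z (first p) ℕ.* Z (fourth p)))
        ≡⟨ chord-vectors (frame s t x) ⟩
      q ℕ.+ units ℕ.* q ℕ.* (Z (B x s t) ℕ.* Z (B x t s)) ≡⟨ point-or-line-size units _ 1+units≡q ⟩
      1 ℕ.+ units ℕ.* (1 ℕ.+ q ℕ.* (Z (B x s t) ℕ.* Z (B x t s))) ∎)

-- The possible values of: the number of osculating planes through a point,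
-- the number of parameters representing it as a point of the arc, and the
-- indicator of the quadric x₁x₄ = x₂x₃.
data Kind : ℕ → ℕ → ℕ → Set where
  on-arc     : Kind 1 1 1
  on-quadric : Kind 2 0 1
  generic₀   : Kind 0 0 0
  generic₁   : Kind 1 0 0
  generic₃   : Kind 3 0 0

-- The number of osculating planes through a point

module Classification (n : ℕ) (K : FiniteField (2 ℕ.^ n)) (h : ℕ) (coprime : gcd n h ≡ 1) where

  private
    q = 2 ℕ.^ n

  open FieldProperties K
  open Characteristic2 n K
  open Frobenius n K h coprime
  open Projective K
  open Geometry n K h coprime
  open Counting n K h coprime
  open ≡-Reasoning

  private
    variable
      s t v w : Line
      X : Space

  osculating : Space → ℕ
  osculating p = ∑[ t ∈ normalForms 2 ] Z (B p t t)

  arc : Space → ℕ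
  arc p = ∑[ t ∈ normalForms 2 ] 𝟙 (p ≟ᵥ tensor t t)

  ∑-line : (f : Line → ℕ) → ∑ (normalForms 2) f ≡ ∑[ t ∈ elements ] f (1# ∷ t ∷ []) ℕ.+ f (0# ∷ 1# ∷ [])
  ∑-line f = trans (∑-normalForms 1 f) (cong₂ ℕ._+_
    (trans (∑-vectors 0 _) (∑-cong elements λ t → ℕₚ.+-identityʳ _)) (ℕₚ.+-identityʳ _))

  ∑-space : (g : Space → ℕ) → ∑ (normalForms 4) g ≡
    ∑[ b ∈ elements ] ∑[ c ∈ elements ] ∑[ d ∈ elements ] g (1# ∷ b ∷ c ∷ d ∷ []) ℕ.+
    (∑[ c ∈ elements ] ∑[ d ∈ elements ] g (0# ∷ 1# ∷ c ∷ d ∷ []) ℕ.+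
    (∑[ d ∈ elements ] g (0# ∷ 0# ∷ 1# ∷ d ∷ []) ℕ.+ g (0# ∷ 0# ∷ 0# ∷ 1# ∷ [])))
  ∑-space g = trans (∑-normalForms 3 g) (cong₂ ℕ._+_
    (trans (∑-vectors 2 _) (∑-cong elements λ b → trans (∑-vectors 1 _) (∑-cong elements λ c →
      trans (∑-vectors 0 _) (∑-cong elements λ d → ℕₚ.+-identityʳ _))))
    (trans (∑-normalForms 2 _) (cong₂ ℕ._+_
      (trans (∑-vectors 1 _) (∑-cong elements λ c →
        trans (∑-vectors 0 _) (∑-cong elements λ d → ℕₚ.+-identityʳ _)))
      (∑-line _))))

  B-affine : ∀ a b c d t → B (a ∷ b ∷ c ∷ d ∷ []) (1# ∷ t ∷ []) (1# ∷ t ∷ []) ≡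
             a * (σ t * t) + b * σ t + c * t + d
  B-affine a b c d t = trans
    (cong (λ i → a * (σ t * t) + b * (σ t * 1#) + c * (i * t) + d * (i * 1#)) σ-1)
    (solve 6 (λ a b c d t T →
      a :* (T :* t) :+ b :* (T :* con true) :+ c :* (con true :* t) :+ d :* (con true :* con true) :=
      a :* (T :* t) :+ b :* T :+ c :* t :+ d) refl a b c d t (σ t))

  B-infinity : ∀ a b c d → B (a ∷ b ∷ c ∷ d ∷ []) (0# ∷ 1# ∷ []) (0# ∷ 1# ∷ []) ≡ a
  B-infinity a b c d = trans
    (cong₂ (λ i o → a * (i * 1#) + b * (i * 0#) + c * (o * 1#) + d * (o * 0#)) σ-1 σ-0)
    (solve 4 (λ a b c d →
      a :* (con true :* con true) :+ b :* (con true :* con false) :+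
      c :* (con false :* con true) :+ d :* (con false :* con false) := a) refl a b c d)

  osculating-coordinates : ∀ a b c d → osculating (a ∷ b ∷ c ∷ d ∷ []) ≡
    ∑[ t ∈ elements ] Z (a * (σ t * t) + b * σ t + c * t + d) ℕ.+ Z a
  osculating-coordinates a b c d = trans (∑-line _) (cong₂ ℕ._+_
    (∑-cong elements λ t → cong Z (B-affine a b c d t)) (cong Z (B-infinity a b c d)))

  tensor-affine : ∀ t → tensor (1# ∷ t ∷ []) (1# ∷ t ∷ []) ≡ 1# ∷ t ∷ σ t ∷ σ t * t ∷ []
  tensor-affine t = begin
    σ 1# * 1# ∷ σ 1# * t ∷ σ t * 1# ∷ σ t * t ∷ []
      ≡⟨ cong (λ i → i * 1# ∷ i * t ∷ σ t * 1# ∷ σ t * t ∷ []) σ-1 ⟩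
    1# * 1# ∷ 1# * t ∷ σ t * 1# ∷ σ t * t ∷ []
      ≡⟨ cong₂ _∷_ (*-identityˡ 1#) (cong₂ _∷_ (*-identityˡ t) (cong (_∷ σ t * t ∷ []) (*-identityʳ (σ t)))) ⟩
    1# ∷ t ∷ σ t ∷ σ t * t ∷ [] ∎

  tensor-infinity : tensor (0# ∷ 1# ∷ []) (0# ∷ 1# ∷ []) ≡ 0# ∷ 0# ∷ 0# ∷ 1# ∷ []
  tensor-infinity = begin
    σ 0# * 0# ∷ σ 0# * 1# ∷ σ 1# * 0# ∷ σ 1# * 1# ∷ []
      ≡⟨ cong₂ (λ o i → o * 0# ∷ o * 1# ∷ i * 0# ∷ i * 1# ∷ []) σ-0 σ-1 ⟩
    0# * 0# ∷ 0# * 1# ∷ 1# * 0# ∷ 1# * 1# ∷ []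
      ≡⟨ cong₂ _∷_ (zeroˡ 0#) (cong₂ _∷_ (zeroˡ 1#) (cong₂ _∷_ (zeroʳ 1#) (cong (_∷ []) (*-identityˡ 1#)))) ⟩
    0# ∷ 0# ∷ 0# ∷ 1# ∷ [] ∎

  tensor-normalForm : NormalForm v → NormalForm (tensor v v)
  tensor-normalForm (lead (t ∷ [])) = subst NormalForm (sym (tensor-affine t)) (lead _)
  tensor-normalForm (skip (lead [])) = subst NormalForm (sym tensor-infinity) (skip (skip (skip (lead []))))

  tensor-injective : NormalForm v → NormalForm w → tensor v v ≡ tensor w w → v ≡ w
  tensor-injective (lead (a ∷ [])) (lead (b ∷ [])) eq =
    cong (λ t → 1# ∷ t ∷ []) (Vecₚ.∷-injectiveˡ (Vecₚ.∷-injectiveʳ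
      (trans (sym (tensor-affine a)) (trans eq (tensor-affine b)))))
  tensor-injective (lead (a ∷ [])) (skip (lead [])) eq = contradiction
    (Vecₚ.∷-injectiveˡ (trans (sym (tensor-affine a)) (trans eq tensor-infinity))) 1≢0
  tensor-injective (skip (lead [])) (lead (b ∷ [])) eq = contradiction
    (Vecₚ.∷-injectiveˡ (trans (sym (tensor-affine b)) (trans (sym eq) tensor-infinity))) 1≢0
  tensor-injective (skip (lead [])) (skip (lead [])) eq = refl

  det-tensor : ∀ v → det (tensor v v) ≡ 0#
  det-tensor (v₁ ∷ v₂ ∷ []) = solve 4 (λ v₁ v₂ V₁ V₂ →
    V₁ :* v₁ :* (V₂ :* v₂) :+ V₁ :* v₂ :* (V₂ :* v₁) := con false) refl v₁ v₂ (σ v₁) (σ v₂)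

  arc-0-or-∃ : ∀ p → arc p ≡ 0 ⊎ ∃ λ v → NormalForm v × p ≡ tensor v v
  arc-0-or-∃ p with ∑-0-or-∃ (normalForms 2) (λ v → 𝟙 (p ≟ᵥ tensor v v))
  ... | inj₁ ≡0 = inj₁ ≡0
  ... | inj₂ (v , v∈ , ≢0) = inj₂ (v , ∈-normalForms⁻ v∈ , 𝟙≢0 (p ≟ᵥ tensor v v) ≢0)

  arc-tensor : NormalForm v → arc (tensor v v) ≡ 1
  arc-tensor {v} nf = trans
    (∑-normalForms-cong λ {w} nf-w → 𝟙-⇔ (tensor v v ≟ᵥ tensor w w) (w ≟ᵥ v)
      (tensor-injective nf-w nf ∘ sym) (λ { refl → refl }))
    (∑-δ _≟ᵥ_ (normalForms-unique 2) (∈-normalForms⁺ nf))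

  arc≡0 : (∀ {v} → NormalForm v → X ≢ tensor v v) → arc X ≡ 0
  arc≡0 {X} off with arc-0-or-∃ X
  ... | inj₁ ≡0 = ≡0
  ... | inj₂ (v , nf , eq) = contradiction eq (off nf)

  det≢0⇒arc≡0 : det X ≢ 0# → arc X ≡ 0
  det≢0⇒arc≡0 {X} d≢0 = arc≡0 {X} λ {v} _ eq → d≢0 (trans (cong det eq) (det-tensor v))

  -- After the exchange of sums each parameter v picks out its single arc point, and
  -- `form x (tensor v v)` is `B x v v` by definition.
  arc-points : ∀ x → ∑[ p ∈ normalForms 4 ] (Z (form x p) ℕ.* arc p) ≡ osculating x
  arc-points x = begin
    ∑[ p ∈ normalForms 4 ] (Z (form x p) ℕ.* arc p)
      ≡⟨ ∑-cong (normalForms 4) (λ p → trans (ℕₚ.*-comm (Z (form x p)) (arc p))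
           (sym (∑-*ʳ (normalForms 2) (Z (form x p)) _))) ⟩
    ∑[ p ∈ normalForms 4 ] ∑[ v ∈ normalForms 2 ] (𝟙 (p ≟ᵥ tensor v v) ℕ.* Z (form x p))
      ≡⟨ ∑-swap (normalForms 4) (normalForms 2) _ ⟩
    ∑[ v ∈ normalForms 2 ] ∑[ p ∈ normalForms 4 ] (𝟙 (p ≟ᵥ tensor v v) ℕ.* Z (form x p))
      ≡⟨ ∑-normalForms-cong (λ nf → ∑-pick _≟ᵥ_ (normalForms-unique 4)
           (∈-normalForms⁺ (tensor-normalForm nf)) (Z ∘ form x)) ⟩
    osculating x ∎

  kind≡ : ∀ {k j z} → osculating X ≡ k → arc X ≡ j → Z (det X) ≡ z → Kind k j z →
          Kind (osculating X) (arc X) (Z (det X))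
  kind≡ refl refl refl kind = kind

  ∑-δ′ : ∀ r → ∑[ t ∈ elements ] 𝟙 (t ≟ r) ≡ 1
  ∑-δ′ r = ∑-δ _≟_ elements-unique (∈-elements r)

  -- A point of the quadric with x₁ = 1 is (1, b, c, b c), and c = σ r for some r. The equation
  -- factors as σ (t + r) (t + b), and its roots r and b coincide exactly on the arc.
  kind-on-quadric : ∀ b r → let p = 1# ∷ b ∷ σ r ∷ b * σ r ∷ [] in
                    Kind (osculating p) (arc p) (Z (det p))
  kind-on-quadric b r = by-cases (r ≟ b)
    where
    p = 1# ∷ b ∷ σ r ∷ b * σ r ∷ []
    det≡0 : Z (det p) ≡ 1
    det≡0 = Z-yes (solve 2 (λ b c → con true :* (b :* c) :+ b :* c := con false) refl b (σ r))
    factor : ∀ t → 1# * (σ t * t) + b * σ t + σ r * t + b * σ r ≡ σ (t + r) * (t + b)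
    factor t = trans
      (solve 4 (λ T t b c → con true :* (T :* t) :+ b :* T :+ c :* t :+ b :* c := (T :+ c) :* (t :+ b))
        refl (σ t) t b (σ r))
      (cong (_* (t + b)) (sym (σ-+ t r)))
    roots : ∀ t → σ (t + r) * (t + b) ≡ 0# → t ≡ r ⊎ t ≡ b
    roots t eq with x*y≡0 eq
    ... | inj₁ σ≡0 = inj₁ (x+y≡0⇒x≡y (σ≡0⇒≡0 σ≡0))
    ... | inj₂ ≡0 = inj₂ (x+y≡0⇒x≡y ≡0)
    root-r : ∀ {t} → t ≡ r → σ (t + r) * (t + b) ≡ 0#
    root-r {t} refl = trans (cong (_* (t + b)) (trans (cong σ (x+x≡0 r)) σ-0)) (zeroˡ _)
    root-b : ∀ {t} → t ≡ b → σ (t + r) * (t + b) ≡ 0#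
    root-b {t} refl = trans (cong (σ (t + r) *_) (x+x≡0 b)) (zeroʳ _)
    osculating≡ : ∀ k → ∑[ t ∈ elements ] Z (σ (t + r) * (t + b)) ≡ k → osculating p ≡ k
    osculating≡ k eq = begin
      osculating p ≡⟨ osculating-coordinates 1# b (σ r) (b * σ r) ⟩
      ∑[ t ∈ elements ] Z (1# * (σ t * t) + b * σ t + σ r * t + b * σ r) ℕ.+ Z 1#
        ≡⟨ cong₂ ℕ._+_ (trans (∑-cong elements λ t → cong Z (factor t)) eq) (Z-no 1≢0) ⟩
      k ℕ.+ 0 ≡⟨ ℕₚ.+-identityʳ k ⟩
      k ∎
    by-cases : Dec (r ≡ b) → Kind (osculating p) (arc p) (Z (det p))
    by-cases (yes refl) = kind≡ {p} (osculating≡ 1 (trans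
        (∑-cong elements λ t → 𝟙-⇔ (_ ≟ 0#) (t ≟ r) ([ id , id ] ∘ roots t) root-r) (∑-δ′ r)))
      (trans (cong arc (trans (cong (λ d → 1# ∷ r ∷ σ r ∷ d ∷ []) (*-comm r (σ r))) (sym (tensor-affine r))))
        (arc-tensor (lead (r ∷ [])))) det≡0 on-arc
    by-cases (no r≢b) = kind≡ {p} (osculating≡ 2 (trans (∑-cong elements pointwise)
        (trans (∑-+ elements (λ t → 𝟙 (t ≟ r)) (λ t → 𝟙 (t ≟ b))) (cong₂ ℕ._+_ (∑-δ′ r) (∑-δ′ b)))))
      (arc≡0 off) det≡0 on-quadric
      where
      pointwise : ∀ t → Z (σ (t + r) * (t + b)) ≡ 𝟙 (t ≟ r) ℕ.+ 𝟙 (t ≟ b)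
      pointwise t = helper (t ≟ r) (t ≟ b)
        where
        helper : (d : Dec (t ≡ r)) (e : Dec (t ≡ b)) → Z (σ (t + r) * (t + b)) ≡ 𝟙 d ℕ.+ 𝟙 e
        helper (yes t≡r) (yes t≡b) = contradiction (trans (sym t≡r) t≡b) r≢b
        helper (yes t≡r) (no _) = Z-yes (root-r t≡r)
        helper (no _) (yes t≡b) = Z-yes (root-b t≡b)
        helper (no t≢r) (no t≢b) = Z-no ([ t≢r , t≢b ] ∘ roots t)
      off : NormalForm v → p ≢ tensor v v
      off (lead (t ∷ [])) eq with refl ← Vecₚ.∷-injectiveˡ (Vecₚ.∷-injectiveʳ (trans eq (tensor-affine t))) =
        r≢b (σ-injective (Vecₚ.∷-injectiveˡ (Vecₚ.∷-injectiveʳ (Vecₚ.∷-injectiveʳ (trans eq (tensor-affine t))))))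
      off (skip (lead [])) eq = 1≢0 (Vecₚ.∷-injectiveˡ (trans eq tensor-infinity))

  kind-generic : ∀ b c d → det (1# ∷ b ∷ c ∷ d ∷ []) ≢ 0# → let p = 1# ∷ b ∷ c ∷ d ∷ [] in
                 Kind (osculating p) (arc p) (Z (det p))
  kind-generic b c d d≢0 with ∑-0-or-∃ elements (λ t → Z (1# * (σ t * t) + b * σ t + c * t + d))
  ... | inj₁ ≡0 = kind≡ {1# ∷ b ∷ c ∷ d ∷ []}
    (trans (osculating-coordinates 1# b c d) (cong₂ ℕ._+_ ≡0 (Z-no 1≢0)))
    (det≢0⇒arc≡0 d≢0) (Z-no d≢0) generic₀
  ... | inj₂ (s , _ , ≢0) = conclude (affine-semilinear-roots 1# c′≢0 b′≢0)
    where
    p = 1# ∷ b ∷ c ∷ d ∷ []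
    f : Fin q → Fin q
    f t = 1# * (σ t * t) + b * σ t + c * t + d
    root : f s ≡ 0#
    root = 𝟙≢0 (_ ≟ 0#) ≢0
    b′ = b + s
    c′ = c + σ s
    -- The product of the two coefficients of g is the determinant, up to the vanishing term f s, so
    -- neither coefficient is 0 off the quadric.
    b′c′ : c′ * b′ ≡ det p + f s
    b′c′ = solve 5 (λ b c d s S → (c :+ S) :* (b :+ s) :=
      (con true :* d :+ b :* c) :+ (con true :* (S :* s) :+ b :* S :+ c :* s :+ d)) refl b c d s (σ s)
    c′b′≢0 : c′ * b′ ≢ 0#
    c′b′≢0 eq = d≢0 (trans (sym (trans (cong (det p +_) root) (+-identityʳ _))) (trans (sym b′c′) eq))
    c′≢0 : c′ ≢ 0#
    c′≢0 eq = c′b′≢0 (trans (cong (_* b′) eq) (zeroˡ _))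
    b′≢0 : b′ ≢ 0#
    b′≢0 eq = c′b′≢0 (trans (cong (c′ *_) eq) (zeroʳ _))
    g : Fin q → Fin q
    g u = c′ * σ u + b′ * u + 1#
    -- The roots s + 1/u of f other than s correspond to the roots u of g.
    reciprocal : ∀ u → u ≢ 0# → σ u * u * f (s + inv u) ≡ g u
    reciprocal u u≢0 = begin
      σ u * u * f (s + y) ≡⟨ cong (λ v → σ u * u * (1# * (v * (s + y)) + b * v + c * (s + y) + d)) (σ-+ s y) ⟩
      σ u * u * (1# * ((σ s + σ y) * (s + y)) + b * (σ s + σ y) + c * (s + y) + d)
        ≡⟨ solve 9 (λ b c d s S y Y u U →
             U :* u :* (con true :* ((S :+ Y) :* (s :+ y)) :+ b :* (S :+ Y) :+ c :* (s :+ y) :+ d) :=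
             U :* u :* (con true :* (S :* s) :+ b :* S :+ c :* s :+ d) :+
             ((c :+ S) :* (U :* (y :* u)) :+ (b :+ s) :* (u :* (Y :* U)) :+ (Y :* U) :* (y :* u)))
             refl b c d s (σ s) y (σ y) u (σ u) ⟩
      σ u * u * f s + (c′ * (σ u * (y * u)) + b′ * (u * (σ y * σ u)) + (σ y * σ u) * (y * u))
        ≡⟨ cong₂ _+_ (cong (σ u * u *_) root) (cong₂ (λ i I → c′ * (σ u * i) + b′ * (u * I) + I * i) yu≡1 YU≡1) ⟩
      σ u * u * 0# + (c′ * (σ u * 1#) + b′ * (u * 1#) + 1# * 1#)
        ≡⟨ solve 4 (λ c b U u → U :* u :* con false :+ (c :* (U :* con true) :+ b :* (u :* con true) :+ con true :* con true)
             := c :* U :+ b :* u :+ con true) refl c′ b′ (σ u) u ⟩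
      g u ∎
      where
      y = inv u
      yu≡1 : y * u ≡ 1#
      yu≡1 = inv-inverseˡ u≢0
      YU≡1 : σ y * σ u ≡ 1#
      YU≡1 = trans (sym (σ-* y u)) (trans (cong σ yu≡1) σ-1)
    -- Since `inv` sends 0 to 0, the index u = 0 stands for the root t = s itself. It is counted by
    -- `𝟙 e`, because g takes the value 1 at 0.
    pointwise : ∀ u (e : Dec (u ≡ 0#)) → Z (f (s + inv u)) ≡ 𝟙 e ℕ.+ Z (g u)
    pointwise u (yes refl) = begin
      Z (f (s + inv 0#)) ≡⟨ Z-yes (trans (cong f (trans (cong (s +_) inv-0) (+-identityʳ s))) root) ⟩
      1                  ≡⟨ cong suc (Z-no λ eq → 1≢0 (trans (sym g0≡1) eq)) ⟨
      1 ℕ.+ Z (g 0#) ∎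
      where
      g0≡1 : g 0# ≡ 1#
      g0≡1 = trans (cong (λ o → c′ * o + b′ * 0# + 1#) σ-0)
        (solve 2 (λ c b → c :* con false :+ b :* con false :+ con true := con true) refl c′ b′)
    pointwise u (no u≢0) = trans (sym (Z-scale (f (s + inv u)) (*-≢0 (σ-≢0 u≢0) u≢0))) (cong Z (reciprocal u u≢0))
    osculating≡ : osculating p ≡ 1 ℕ.+ ∑[ u ∈ elements ] Z (g u)
    osculating≡ = begin
      osculating p ≡⟨ osculating-coordinates 1# b c d ⟩
      ∑[ t ∈ elements ] Z (f t) ℕ.+ Z 1# ≡⟨ trans (cong (∑ elements (Z ∘ f) ℕ.+_) (Z-no 1≢0)) (ℕₚ.+-identityʳ _) ⟩
      ∑[ t ∈ elements ] Z (f t) ≡⟨ ∑-translate s (Z ∘ f) ⟨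
      ∑[ t ∈ elements ] Z (f (s + t))
        ≡⟨ ∑-reindex _≟_ elements-unique ∈-elements inv-injective (λ t → Z (f (s + t))) ⟨
      ∑[ u ∈ elements ] Z (f (s + inv u)) ≡⟨ ∑-cong elements (λ u → pointwise u (u ≟ 0#)) ⟩
      ∑[ u ∈ elements ] (Z u ℕ.+ Z (g u)) ≡⟨ ∑-+ elements Z (Z ∘ g) ⟩
      ∑ elements Z ℕ.+ ∑[ u ∈ elements ] Z (g u) ≡⟨ cong (ℕ._+ ∑ elements (Z ∘ g)) (∑-δ′ 0#) ⟩
      1 ℕ.+ ∑[ u ∈ elements ] Z (g u) ∎
    conclude : ∑[ u ∈ elements ] Z (g u) ≡ 0 ⊎ ∑[ u ∈ elements ] Z (g u) ≡ 2 →
               Kind (osculating p) (arc p) (Z (det p))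
    conclude (inj₁ ≡0) = kind≡ {p} (trans osculating≡ (cong suc ≡0)) (det≢0⇒arc≡0 d≢0) (Z-no d≢0) generic₁
    conclude (inj₂ ≡2) = kind≡ {p} (trans osculating≡ (cong suc ≡2)) (det≢0⇒arc≡0 d≢0) (Z-no d≢0) generic₃

  -- A leading 0 means that the parameter at infinity is a root. The remaining equation in t is then
  -- already affine in σ t and t, so no root has to be moved.
  kind : NormalForm X → Kind (osculating X) (arc X) (Z (det X))
  kind (lead (b ∷ c ∷ d ∷ [])) = by-cases (det (1# ∷ b ∷ c ∷ d ∷ []) ≟ 0#)
    where
    -- Abstracting over c and d lets matching on `refl` replace them by σ r and b c.
    KindOf : Fin q → Fin q → Set
    KindOf c d = let p = 1# ∷ b ∷ c ∷ d ∷ [] in Kind (osculating p) (arc p) (Z (det p))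
    on : ∀ {c d} r → σ r ≡ c → b * c ≡ d → KindOf c d
    on r refl refl = kind-on-quadric b r
    by-cases : Dec (det (1# ∷ b ∷ c ∷ d ∷ []) ≡ 0#) → KindOf c d
    by-cases (yes d≡0) = on (proj₁ (σ-surjective c)) (proj₂ (σ-surjective c))
      (trans (sym (x+y≡0⇒x≡y d≡0)) (*-identityˡ d))
    by-cases (no d≢0) = kind-generic b c d d≢0
  kind (skip (lead (c ∷ d ∷ []))) = by-cases (c ≟ 0#)
    where
    p = 0# ∷ 1# ∷ c ∷ d ∷ []
    det≡c : det p ≡ c
    det≡c = solve 2 (λ c d → con false :* d :+ con true :* c := c) refl c d
    osculating≡ : osculating p ≡ ∑[ t ∈ elements ] Z (1# * σ t + c * t + d) ℕ.+ 1
    osculating≡ = trans (osculating-coordinates 0# 1# c d) (cong₂ ℕ._+_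
      (∑-cong elements λ t → cong Z (solve 4 (λ c d t T →
        con false :* (T :* t) :+ con true :* T :+ c :* t :+ d := con true :* T :+ c :* t :+ d) refl c d t (σ t)))
      (Z-yes refl))
    by-cases : Dec (c ≡ 0#) → Kind (osculating p) (arc p) (Z (det p))
    by-cases (yes refl) = kind≡ {p}
      (trans osculating≡ (cong (ℕ._+ 1) (trans (∑-cong elements λ t →
        𝟙-⇔ (_ ≟ 0#) (t ≟ r) (λ eq → σ-injective (x+y≡0⇒x≡y (trans (sym (simplify t)) eq)))
          (λ { refl → trans (simplify r) (x+x≡0 (σ r)) })) (∑-δ′ r))))
      (arc≡0 off) (Z-yes det≡c) on-quadric
      where
      r = proj₁ (σ-surjective d)
      simplify : ∀ t → 1# * σ t + 0# * t + d ≡ σ t + σ r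
      simplify t = trans (solve 3 (λ T t d → con true :* T :+ con false :* t :+ d := T :+ d) refl (σ t) t d)
        (cong (σ t +_) (sym (proj₂ (σ-surjective d))))
      off : NormalForm v → p ≢ tensor v v
      off (lead (t ∷ [])) eq = 1≢0 (sym (Vecₚ.∷-injectiveˡ (trans eq (tensor-affine t))))
      off (skip (lead [])) eq = 1≢0 (Vecₚ.∷-injectiveˡ (Vecₚ.∷-injectiveʳ (trans eq tensor-infinity)))
    by-cases (no c≢0) = conclude (affine-semilinear-roots d 1≢0 c≢0)
      where
      d≢0 : det p ≢ 0#
      d≢0 eq = c≢0 (trans (sym det≡c) eq)
      conclude : ∑[ t ∈ elements ] Z (1# * σ t + c * t + d) ≡ 0 ⊎ ∑[ t ∈ elements ] Z (1# * σ t + c * t + d) ≡ 2 →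
                 Kind (osculating p) (arc p) (Z (det p))
      conclude (inj₁ ≡0) = kind≡ {p} (trans osculating≡ (cong (ℕ._+ 1) ≡0)) (det≢0⇒arc≡0 d≢0) (Z-no d≢0) generic₁
      conclude (inj₂ ≡2) = kind≡ {p} (trans osculating≡ (cong (ℕ._+ 1) ≡2)) (det≢0⇒arc≡0 d≢0) (Z-no d≢0) generic₃
  kind (skip (skip (lead (d ∷ [])))) = kind≡ {0# ∷ 0# ∷ 1# ∷ d ∷ []}
    (trans (osculating-coordinates 0# 0# 1# d) (cong₂ ℕ._+_
      (∑-linear 1≢0 _ d λ t → solve 3 (λ d t T →
        con false :* (T :* t) :+ con false :* T :+ con true :* t :+ d := con true :* t :+ d) refl d t (σ t))
      (Z-yes refl)))
    (arc≡0 off)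
    (Z-yes (solve 1 (λ d → con false :* d :+ con false :* con true := con false) refl d)) on-quadric
    where
    off : NormalForm v → 0# ∷ 0# ∷ 1# ∷ d ∷ [] ≢ tensor v v
    off (lead (t ∷ [])) eq = 1≢0 (sym (Vecₚ.∷-injectiveˡ (trans eq (tensor-affine t))))
    off (skip (lead [])) eq =
      1≢0 (Vecₚ.∷-injectiveˡ (Vecₚ.∷-injectiveʳ (Vecₚ.∷-injectiveʳ (trans eq tensor-infinity))))
  kind (skip (skip (skip (lead [])))) = kind≡ {0# ∷ 0# ∷ 0# ∷ 1# ∷ []}
    (trans (osculating-coordinates 0# 0# 0# 1#) (cong₂ ℕ._+_
      (trans (∑-cong elements λ t → Z-no λ eq → 1≢0 (trans (sym (solve 2 (λ t T →
        con false :* (T :* t) :+ con false :* T :+ con false :* t :+ con true := con true) refl t (σ t))) eq))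
        (∑-zero elements))
      (Z-yes refl)))
    (trans (cong arc (sym tensor-infinity)) (arc-tensor (skip (lead []))))
    (Z-yes (solve 0 (con false :* con true :+ con false :* con false := con false) refl)) on-arc

-- The quadric section and the chords through a point

module Incidence (n : ℕ) (K : FiniteField (2 ℕ.^ n)) (h : ℕ) (coprime : gcd n h ≡ 1) where

  private
    q = 2 ℕ.^ n

  open FieldProperties K
  open Characteristic2 n K
  open Frobenius n K h coprime
  open Projective K
  open Geometry n K h coprime
  open Counting n K h coprime
  open Classification n K h coprime
  open ≡-Reasoning

  private
    variable
      s t u v w : Line
      X : Space

  -- The section is parametrized by b, since each b outside x₁ b + x₂ = 0 determines c and then d =
  -- b c. If x₁ ≠ 0, the exceptional b gives nothing, but its loss is made up by a point (0, 0, 1,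
  -- d) with the same equation for d; the remaining point has the form (0, 1, 0, d).
  quadric-points : ∀ x → det x ≢ 0# → ∑[ p ∈ normalForms 4 ] (Z (form x p) ℕ.* Z (det p)) ≡ q ℕ.+ 1
  quadric-points x@(x₁ ∷ x₂ ∷ x₃ ∷ x₄ ∷ []) d≢0 = begin
    ∑[ p ∈ normalForms 4 ] (Z (form x p) ℕ.* Z (det p)) ≡⟨ ∑-space _ ⟩
    _ ≡⟨ cong₂ ℕ._+_ (∑-cong elements λ b → ∑-cong elements λ c → part₁ b c) (cong₂ ℕ._+_ part₂
           (cong₂ ℕ._+_ (∑-cong elements part₃) part₄)) ⟩
    ∑[ b ∈ elements ] ∑[ c ∈ elements ] Z ((x₁ * b + x₂) * c + (x₃ * b + x₄)) ℕ.+
    (∑[ d ∈ elements ] Z (x₁ * d + x₃) ℕ.+ (∑[ d ∈ elements ] Z (x₁ * d + x₂) ℕ.+ Z x₁)) ≡⟨ by-cases (x₁ ≟ 0#) ⟩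
    q ℕ.+ 1 ∎
    where
    part₁ : ∀ b c → ∑[ d ∈ elements ] (Z (x₁ * d + x₂ * c + x₃ * b + x₄ * 1#) ℕ.* Z (1# * d + b * c))
                    ≡ Z ((x₁ * b + x₂) * c + (x₃ * b + x₄))
    part₁ b c = begin
      ∑[ d ∈ elements ] (Z (x₁ * d + x₂ * c + x₃ * b + x₄ * 1#) ℕ.* Z (1# * d + b * c))
        ≡⟨ ∑-cong elements (λ d → trans (ℕₚ.*-comm (Z (x₁ * d + x₂ * c + x₃ * b + x₄ * 1#)) _)
             (cong (ℕ._* Z (x₁ * d + x₂ * c + x₃ * b + x₄ * 1#)) (𝟙-⇔ (1# * d + b * c ≟ 0#) (d ≟ b * c)
               (λ eq → trans (sym (*-identityˡ d)) (x+y≡0⇒x≡y eq))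
               (λ eq → trans (cong (_+ b * c) (*-identityˡ d)) (x≡y⇒x+y≡0 eq))))) ⟩
      ∑[ d ∈ elements ] (𝟙 (d ≟ b * c) ℕ.* Z (x₁ * d + x₂ * c + x₃ * b + x₄ * 1#))
        ≡⟨ ∑-pick _≟_ elements-unique (∈-elements (b * c)) (λ d → Z (x₁ * d + x₂ * c + x₃ * b + x₄ * 1#)) ⟩
      Z (x₁ * (b * c) + x₂ * c + x₃ * b + x₄ * 1#)
        ≡⟨ cong Z (solve 6 (λ x₁ x₂ x₃ x₄ b c → x₁ :* (b :* c) :+ x₂ :* c :+ x₃ :* b :+ x₄ :* con true :=
             (x₁ :* b :+ x₂) :* c :+ (x₃ :* b :+ x₄)) refl x₁ x₂ x₃ x₄ b c) ⟩
      Z ((x₁ * b + x₂) * c + (x₃ * b + x₄)) ∎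
    part₂ : ∑[ c ∈ elements ] ∑[ d ∈ elements ] (Z (x₁ * d + x₂ * c + x₃ * 1# + x₄ * 0#) ℕ.* Z (0# * d + 1# * c))
            ≡ ∑[ d ∈ elements ] Z (x₁ * d + x₃)
    part₂ = begin
      ∑[ c ∈ elements ] ∑[ d ∈ elements ] (Z (x₁ * d + x₂ * c + x₃ * 1# + x₄ * 0#) ℕ.* Z (0# * d + 1# * c))
        ≡⟨ ∑-cong elements (λ c → trans (∑-cong elements λ d → cong (Z (x₁ * d + x₂ * c + x₃ * 1# + x₄ * 0#) ℕ.*_)
             (cong Z (solve 2 (λ c d → con false :* d :+ con true :* c := c) refl c d)))
             (trans (∑-*ʳ elements (Z c) _) (ℕₚ.*-comm _ (Z c)))) ⟩
      ∑[ c ∈ elements ] (Z c ℕ.* (∑[ d ∈ elements ] Z (x₁ * d + x₂ * c + x₃ * 1# + x₄ * 0#))) ≡⟨ ∑-Z* _ ⟩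
      ∑[ d ∈ elements ] Z (x₁ * d + x₂ * 0# + x₃ * 1# + x₄ * 0#)
        ≡⟨ ∑-cong elements (λ d → cong Z (solve 5 (λ x₁ x₂ x₃ x₄ d →
             x₁ :* d :+ x₂ :* con false :+ x₃ :* con true :+ x₄ :* con false := x₁ :* d :+ x₃) refl x₁ x₂ x₃ x₄ d)) ⟩
      ∑[ d ∈ elements ] Z (x₁ * d + x₃) ∎
    part₃ : ∀ d → Z (x₁ * d + x₂ * 1# + x₃ * 0# + x₄ * 0#) ℕ.* Z (0# * d + 0# * 1#) ≡ Z (x₁ * d + x₂)
    part₃ d = trans (cong₂ ℕ._*_
      (cong Z (solve 5 (λ x₁ x₂ x₃ x₄ d →
        x₁ :* d :+ x₂ :* con true :+ x₃ :* con false :+ x₄ :* con false := x₁ :* d :+ x₂) refl x₁ x₂ x₃ x₄ d))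
      (Z-yes (solve 1 (λ d → con false :* d :+ con false :* con true := con false) refl d))) (ℕₚ.*-identityʳ _)
    part₄ : Z (x₁ * 1# + x₂ * 0# + x₃ * 0# + x₄ * 0#) ℕ.* Z (0# * 1# + 0# * 0#) ≡ Z x₁
    part₄ = trans (cong₂ ℕ._*_
      (cong Z (solve 4 (λ x₁ x₂ x₃ x₄ →
        x₁ :* con true :+ x₂ :* con false :+ x₃ :* con false :+ x₄ :* con false := x₁) refl x₁ x₂ x₃ x₄))
      (Z-yes (solve 0 (con false :* con true :+ con false :* con false := con false) refl))) (ℕₚ.*-identityʳ _)
    by-cases : (e : Dec (x₁ ≡ 0#)) →
      ∑[ b ∈ elements ] ∑[ c ∈ elements ] Z ((x₁ * b + x₂) * c + (x₃ * b + x₄)) ℕ.+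
      (∑[ d ∈ elements ] Z (x₁ * d + x₃) ℕ.+ (∑[ d ∈ elements ] Z (x₁ * d + x₂) ℕ.+ 𝟙 e)) ≡ q ℕ.+ 1
    by-cases (no x₁≢0) = begin
      ∑[ b ∈ elements ] ∑[ c ∈ elements ] Z ((x₁ * b + x₂) * c + (x₃ * b + x₄)) ℕ.+
      (∑[ d ∈ elements ] Z (x₁ * d + x₃) ℕ.+ (∑[ d ∈ elements ] Z (x₁ * d + x₂) ℕ.+ 0))
        ≡⟨ cong₂ ℕ._+_ (∑-cong elements λ b → inner b (x₁ * b + x₂ ≟ 0#)) (cong₂ ℕ._+_ (linear-roots x₃ x₁≢0)
             (trans (ℕₚ.+-identityʳ _) refl)) ⟩
      m ℕ.+ (1 ℕ.+ ∑[ d ∈ elements ] Z (x₁ * d + x₂)) ≡⟨ cong (m ℕ.+_) (ℕₚ.+-comm 1 _) ⟩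
      m ℕ.+ (∑[ d ∈ elements ] Z (x₁ * d + x₂) ℕ.+ 1) ≡⟨ ℕₚ.+-assoc m _ 1 ⟨
      m ℕ.+ ∑[ d ∈ elements ] Z (x₁ * d + x₂) ℕ.+ 1 ≡⟨ cong (ℕ._+ 1) complementary ⟩
      q ℕ.+ 1 ∎
      where
      m = ∑[ b ∈ elements ] 𝟙 (¬? (x₁ * b + x₂ ≟ 0#))
      complementary : m ℕ.+ ∑[ d ∈ elements ] Z (x₁ * d + x₂) ≡ q
      complementary = begin
        m ℕ.+ ∑[ d ∈ elements ] Z (x₁ * d + x₂)
          ≡⟨ trans (ℕₚ.+-comm m _) (sym (∑-+ elements (λ d → Z (x₁ * d + x₂)) _)) ⟩
        ∑[ d ∈ elements ] (Z (x₁ * d + x₂) ℕ.+ 𝟙 (¬? (x₁ * d + x₂ ≟ 0#)))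
          ≡⟨ ∑-cong elements (λ d → 𝟙+𝟙¬ (x₁ * d + x₂ ≟ 0#)) ⟩
        ∑[ d ∈ elements ] 1 ≡⟨ trans (∑-constant 1) (ℕₚ.*-identityʳ q) ⟩
        q ∎
      inner : ∀ b (e : Dec (x₁ * b + x₂ ≡ 0#)) →
              ∑[ c ∈ elements ] Z ((x₁ * b + x₂) * c + (x₃ * b + x₄)) ≡ 𝟙 (¬? e)
      inner b (no ≢0) = linear-roots (x₃ * b + x₄) ≢0
      -- The determinant is a combination of x₁ b + x₂ and of the equation for c, so a solution c
      -- would force it to vanish.
      inner b (yes ≡0) = trans (∑-cong elements λ c → Z-no λ eq → d≢0 (begin
        x₁ * x₄ + x₂ * x₃
          ≡⟨ solve 6 (λ x₁ x₂ x₃ x₄ b c → x₁ :* x₄ :+ x₂ :* x₃ :=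
               x₁ :* ((x₁ :* b :+ x₂) :* c :+ (x₃ :* b :+ x₄)) :+ (x₁ :* b :+ x₂) :* (x₁ :* c :+ x₃))
               refl x₁ x₂ x₃ x₄ b c ⟩
        x₁ * ((x₁ * b + x₂) * c + (x₃ * b + x₄)) + (x₁ * b + x₂) * (x₁ * c + x₃)
          ≡⟨ cong₂ (λ i j → x₁ * i + j * (x₁ * c + x₃)) eq ≡0 ⟩
        x₁ * 0# + 0# * (x₁ * c + x₃) ≡⟨ trans (cong₂ _+_ (zeroʳ _) (zeroˡ _)) (+-identityˡ 0#) ⟩
        0# ∎)) (∑-zero elements)
    by-cases (yes refl) = begin
      ∑[ b ∈ elements ] ∑[ c ∈ elements ] Z ((0# * b + x₂) * c + (x₃ * b + x₄)) ℕ.+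
      (∑[ d ∈ elements ] Z (0# * d + x₃) ℕ.+ (∑[ d ∈ elements ] Z (0# * d + x₂) ℕ.+ 1))
        ≡⟨ cong₂ ℕ._+_ (trans (∑-cong elements λ b → ∑-linear x₂≢0 _ (x₃ * b + x₄) λ c →
             cong (λ a → a * c + (x₃ * b + x₄)) (drop b x₂)) (trans (∑-constant 1) (ℕₚ.*-identityʳ q)))
           (cong₂ ℕ._+_ (vanish x₃ x₃≢0) (cong (ℕ._+ 1) (vanish x₂ x₂≢0))) ⟩
      q ℕ.+ (0 ℕ.+ (0 ℕ.+ 1)) ∎
      where
      x₂≢0 : x₂ ≢ 0#
      x₂≢0 = proj₁ (det-≢0⇒ d≢0 refl)
      x₃≢0 : x₃ ≢ 0#
      x₃≢0 = proj₂ (det-≢0⇒ d≢0 refl)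
      drop : ∀ d a → 0# * d + a ≡ a
      drop d a = trans (cong (_+ a) (zeroˡ d)) (+-identityˡ a)
      vanish : ∀ a → a ≢ 0# → ∑[ d ∈ elements ] Z (0# * d + a) ≡ 0
      vanish a a≢0 = trans (∑-cong elements λ d → Z-no λ eq → a≢0 (trans (sym (drop d a)) eq)) (∑-zero elements)

  B-tensor : ∀ v w s t → B (tensor v w) s t ≡ σ (area v s) * area w t
  B-tensor (v₁ ∷ v₂ ∷ []) (w₁ ∷ w₂ ∷ []) (s₁ ∷ s₂ ∷ []) (t₁ ∷ t₂ ∷ []) = trans
    (solve 8 (λ V₁ V₂ w₁ w₂ S₁ S₂ t₁ t₂ →
      V₁ :* w₁ :* (S₂ :* t₂) :+ V₁ :* w₂ :* (S₂ :* t₁) :+ V₂ :* w₁ :* (S₁ :* t₂) :+ V₂ :* w₂ :* (S₁ :* t₁) :=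
      (V₁ :* S₂ :+ V₂ :* S₁) :* (w₁ :* t₂ :+ w₂ :* t₁)) refl (σ v₁) (σ v₂) w₁ w₂ (σ s₁) (σ s₂) t₁ t₂)
    (cong (_* (w₁ * t₂ + w₂ * t₁)) (σ-area≡ (v₁ ∷ v₂ ∷ []) (s₁ ∷ s₂ ∷ [])))

  area-plücker : ∀ u w s t → area u t * area w s + area u s * area w t ≡ area u w * area s t
  area-plücker (u₁ ∷ u₂ ∷ []) (w₁ ∷ w₂ ∷ []) (s₁ ∷ s₂ ∷ []) (t₁ ∷ t₂ ∷ []) =
    solve 8 (λ u₁ u₂ w₁ w₂ s₁ s₂ t₁ t₂ →
      (u₁ :* t₂ :+ u₂ :* t₁) :* (w₁ :* s₂ :+ w₂ :* s₁) :+ (u₁ :* s₂ :+ u₂ :* s₁) :* (w₁ :* t₂ :+ w₂ :* t₁) :=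
      (u₁ :* w₂ :+ u₂ :* w₁) :* (s₁ :* t₂ :+ s₂ :* t₁)) refl u₁ u₂ w₁ w₂ s₁ s₂ t₁ t₂

  -- A point x off the quadric lies on the chord of the arc through the points
  -- with parameters s ≠ t exactly when s and t are conjugate.
  Conjugate : Space → Line → Line → Set
  Conjugate x s t = B x s t ≡ 0# × B x t s ≡ 0#

  -- In the frame of s and t the point x is (`B x s s`, 0, 0, `B x t t`), so only two terms of its
  -- form with `tensor u w` survive. By `form-frame` their sum is a multiple of `B x u w`.
  conjugate-equation : ∀ x → Conjugate x s t → ∀ u w → B x u w ≡ 0# →
    B x s s * (σ (area u t) * area w t) ≡ B x t t * (σ (area u s) * area w s)
  conjugate-equation {s} {t} x (st≡0 , ts≡0) u w uw≡0 = x+y≡0⇒x≡y (begin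
    B x s s * (σ (area u t) * area w t) + B x t t * (σ (area u s) * area w s)
      ≡⟨ solve 6 (λ A D i j k l → A :* i :+ D :* l := A :* i :+ con false :* j :+ con false :* k :+ D :* l) refl
           (B x s s) (B x t t) (σ (area u t) * area w t) (σ (area u t) * area w s)
           (σ (area u s) * area w t) (σ (area u s) * area w s) ⟩
    B x s s * (σ (area u t) * area w t) + 0# * (σ (area u t) * area w s) +
      0# * (σ (area u s) * area w t) + B x t t * (σ (area u s) * area w s)
      ≡⟨ cong₂ (λ i j → B x s s * (σ (area u t) * area w t) + i * (σ (area u t) * area w s) +
           j * (σ (area u s) * area w t) + B x t t * (σ (area u s) * area w s)) st≡0 ts≡0 ⟨
    B x s s * (σ (area u t) * area w t) + B x s t * (σ (area u t) * area w s) +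
      B x t s * (σ (area u s) * area w t) + B x t t * (σ (area u s) * area w s)
      ≡⟨ cong₂ _+_ (cong₂ _+_ (cong₂ _+_
           (cong (B x s s *_) (B-tensor u w t t)) (cong (B x s t *_) (B-tensor u w t s)))
           (cong (B x t s *_) (B-tensor u w s t))) (cong (B x t t *_) (B-tensor u w s s)) ⟨
    form (frame s t x) (frame s t (tensor u w)) ≡⟨ form-frame s t x (tensor u w) ⟩
    σ (area s t) * area s t * B x u w ≡⟨ trans (cong (σ (area s t) * area s t *_) uw≡0) (zeroʳ _) ⟩
    0# ∎)

  -- Multiplying `eq₁` crosswise by `eq₂` eliminates A and D and leaves σ y z = σ z y with y = a₁ b₂
  -- and z = a₂ b₁. If these are nonzero they are equal, and the Plücker relation makes `area u w`
  -- vanish, against u ≠ w. If one of the areas is 0, the two pairs coincide up to order.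
  conjugate-unique : ∀ x → det x ≢ 0# → NormalForm s → NormalForm t → NormalForm u → NormalForm w →
    s ≢ t → u ≢ w → Conjugate x s t → Conjugate x u w → (u ≡ s × w ≡ t) ⊎ (u ≡ t × w ≡ s)
  conjugate-unique {s} {t} {u} {w} x d≢0 nf-s nf-t nf-u nf-w s≢t u≢w st uw =
    by-cases (area u t ≟ 0#) (area u s ≟ 0#)
    where
    A = B x s s
    D = B x t t
    a₁ = area u t
    a₂ = area u s
    b₁ = area w t
    b₂ = area w s
    eq₁ : A * (σ a₁ * b₁) ≡ D * (σ a₂ * b₂)
    eq₁ = conjugate-equation {s} {t} x st u w (proj₁ uw)
    eq₂ : A * (σ b₁ * a₁) ≡ D * (σ b₂ * a₂)
    eq₂ = conjugate-equation {s} {t} x st w u (proj₂ uw)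
    AD≢0 : A * D ≢ 0#
    AD≢0 eq = det-frame-≢0 {s} {t} {x} (area-≢0 nf-s nf-t s≢t) d≢0
      (trans (cong₂ _+_ eq (trans (cong (_* B x t s) (proj₁ st)) (zeroˡ _))) (+-identityˡ 0#))
    A≢0 : A ≢ 0#
    A≢0 eq = AD≢0 (trans (cong (_* D) eq) (zeroˡ D))
    D≢0 : D ≢ 0#
    D≢0 eq = AD≢0 (trans (cong (A *_) eq) (zeroʳ A))
    0-left : ∀ {c a b} → a ≡ 0# → c * (σ a * b) ≡ 0#
    0-left {c} {a} {b} refl = trans (cong (λ z → c * (z * b)) σ-0) (trans (cong (c *_) (zeroˡ b)) (zeroʳ c))
    0-right : ∀ {c a b} → b ≡ 0# → c * (σ a * b) ≡ 0#
    0-right {c} {a} refl = trans (cong (c *_) (zeroʳ (σ a))) (zeroʳ c)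
    cancel : ∀ {c a b} → c ≢ 0# → a ≢ 0# → c * (σ a * b) ≡ 0# → b ≡ 0#
    cancel c≢0 a≢0 eq = x*y≡0⇒y≡0 (σ-≢0 a≢0) (x*y≡0⇒y≡0 c≢0 eq)
    w≡t : b₁ ≡ 0# → w ≡ t
    w≡t = area≡0⇒≡ nf-w nf-t
    w≡s : b₂ ≡ 0# → w ≡ s
    w≡s = area≡0⇒≡ nf-w nf-s
    by-cases : Dec (a₁ ≡ 0#) → Dec (a₂ ≡ 0#) → (u ≡ s × w ≡ t) ⊎ (u ≡ t × w ≡ s)
    by-cases (yes a₁≡0) (yes a₂≡0) =
      contradiction (trans (sym (area≡0⇒≡ nf-u nf-s a₂≡0)) (area≡0⇒≡ nf-u nf-t a₁≡0)) s≢t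
    by-cases (yes a₁≡0) (no a₂≢0) =
      inj₂ (area≡0⇒≡ nf-u nf-t a₁≡0 , w≡s (cancel D≢0 a₂≢0 (trans (sym eq₁) (0-left a₁≡0))))
    by-cases (no a₁≢0) (yes a₂≡0) =
      inj₁ (area≡0⇒≡ nf-u nf-s a₂≡0 , w≡t (cancel A≢0 a₁≢0 (trans eq₁ (0-left a₂≡0))))
    by-cases (no a₁≢0) (no a₂≢0) = contradiction (area≡0⇒≡ nf-u nf-w
      (x*y≡0⇒x≡0 (area-≢0 nf-s nf-t s≢t) (trans (sym (area-plücker u w s t)) (x≡y⇒x+y≡0 a₁b₂≡a₂b₁)))) u≢w
      where
      b₁≢0 : b₁ ≢ 0#
      b₁≢0 b₁≡0 = s≢t (trans (sym (w≡s (cancel D≢0 a₂≢0 (trans (sym eq₁) (0-right b₁≡0))))) (w≡t b₁≡0))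
      b₂≢0 : b₂ ≢ 0#
      b₂≢0 b₂≡0 = s≢t (trans (sym (w≡s b₂≡0)) (w≡t (cancel A≢0 a₁≢0 (trans eq₁ (0-right b₂≡0)))))
      a₁b₂≡a₂b₁ : a₁ * b₂ ≡ a₂ * b₁
      a₁b₂≡a₂b₁ = σx*y≡σy*x⇒x≡y (*-≢0 a₁≢0 b₂≢0) (*-≢0 a₂≢0 b₁≢0) (*-cancelˡ AD≢0 (begin
        A * D * (σ (a₁ * b₂) * (a₂ * b₁)) ≡⟨ cong (λ z → A * D * (z * (a₂ * b₁))) (σ-* a₁ b₂) ⟩
        A * D * (σ a₁ * σ b₂ * (a₂ * b₁))
          ≡⟨ solve 6 (λ A D i j a b → A :* D :* (i :* j :* (a :* b)) := (A :* (i :* b)) :* (D :* (j :* a))) refl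
               A D (σ a₁) (σ b₂) a₂ b₁ ⟩
        A * (σ a₁ * b₁) * (D * (σ b₂ * a₂)) ≡⟨ cong₂ _*_ eq₁ (sym eq₂) ⟩
        D * (σ a₂ * b₂) * (A * (σ b₁ * a₁))
          ≡⟨ solve 6 (λ A D i j a b → (D :* (i :* b)) :* (A :* (j :* a)) := A :* D :* (i :* j :* (a :* b))) refl
               A D (σ a₂) (σ b₁) a₁ b₂ ⟩
        A * D * (σ a₂ * σ b₁ * (a₁ * b₂)) ≡⟨ cong (λ z → A * D * (z * (a₁ * b₂))) (σ-* a₂ b₁) ⟨
        A * D * (σ (a₂ * b₁) * (a₁ * b₂)) ∎))

  conjugate? : ∀ x s t → Dec (s ≢ t × Conjugate x s t)
  conjugate? x s t = ¬? (s ≟ᵥ t) ×-dec ((B x s t ≟ 0#) ×-dec (B x t s ≟ 0#))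

  -- Each chord through x is counted twice.
  chords : Space → ℕ
  chords x = ∑[ s ∈ normalForms 2 ] ∑[ t ∈ normalForms 2 ] 𝟙 (conjugate? x s t)

  chords≤2 : ∀ x → det x ≢ 0# → chords x ℕ.≤ 2
  chords≤2 x d≢0 with ∑-0-or-∃ (normalForms 2) (λ s → ∑[ t ∈ normalForms 2 ] 𝟙 (conjugate? x s t))
  ... | inj₁ ≡0 = subst (ℕ._≤ 2) (sym ≡0) ℕ.z≤n
  ... | inj₂ (s , s∈ , ∑≢0) with ∑-0-or-∃ (normalForms 2) (λ t → 𝟙 (conjugate? x s t))
  ...   | inj₁ ≡0 = contradiction ≡0 ∑≢0
  ...   | inj₂ (t , t∈ , ≢0) = bound
    where
    st : s ≢ t × Conjugate x s t
    st = 𝟙≢0 (conjugate? x s t) ≢0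
    L = normalForms 2
    single : ∀ {s t} → s ∈ L → t ∈ L → ∑[ u ∈ L ] ∑[ w ∈ L ] (𝟙 (u ≟ᵥ s) ℕ.* 𝟙 (w ≟ᵥ t)) ≡ 1
    single {s} {t} s∈ t∈ = begin
      ∑[ u ∈ L ] ∑[ w ∈ L ] (𝟙 (u ≟ᵥ s) ℕ.* 𝟙 (w ≟ᵥ t))
        ≡⟨ ∑-cong L (λ u → trans (∑-*ˡ L (𝟙 (u ≟ᵥ s)) _)
             (trans (cong (𝟙 (u ≟ᵥ s) ℕ.*_) (∑-δ _≟ᵥ_ (normalForms-unique 2) t∈)) (ℕₚ.*-identityʳ _))) ⟩
      ∑[ u ∈ L ] 𝟙 (u ≟ᵥ s) ≡⟨ ∑-δ _≟ᵥ_ (normalForms-unique 2) s∈ ⟩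
      1 ∎
    pointwise : ∀ u → u ∈ L → ∀ w → w ∈ L →
      𝟙 (conjugate? x u w) ℕ.≤ 𝟙 (u ≟ᵥ s) ℕ.* 𝟙 (w ≟ᵥ t) ℕ.+ 𝟙 (u ≟ᵥ t) ℕ.* 𝟙 (w ≟ᵥ s)
    pointwise u u∈ w w∈ = helper (conjugate? x u w)
      where
      helper : (e : Dec (u ≢ w × Conjugate x u w)) →
        𝟙 e ℕ.≤ 𝟙 (u ≟ᵥ s) ℕ.* 𝟙 (w ≟ᵥ t) ℕ.+ 𝟙 (u ≟ᵥ t) ℕ.* 𝟙 (w ≟ᵥ s)
      helper (no _) = ℕ.z≤n
      helper (yes (u≢w , uw)) with conjugate-unique x d≢0 (∈-normalForms⁻ s∈) (∈-normalForms⁻ t∈)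
        (∈-normalForms⁻ u∈) (∈-normalForms⁻ w∈) (proj₁ st) u≢w (proj₂ st) uw
      ... | inj₁ (u≡s , w≡t) = subst (1 ℕ.≤_)
        (cong (ℕ._+ 𝟙 (u ≟ᵥ t) ℕ.* 𝟙 (w ≟ᵥ s)) (sym (cong₂ ℕ._*_ (𝟙-yes (u ≟ᵥ s) u≡s) (𝟙-yes (w ≟ᵥ t) w≡t))))
        (ℕₚ.m≤m+n 1 _)
      ... | inj₂ (u≡t , w≡s) = subst (1 ℕ.≤_)
        (cong (𝟙 (u ≟ᵥ s) ℕ.* 𝟙 (w ≟ᵥ t) ℕ.+_) (sym (cong₂ ℕ._*_ (𝟙-yes (u ≟ᵥ t) u≡t) (𝟙-yes (w ≟ᵥ s) w≡s))))
        (ℕₚ.m≤n+m 1 _)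
    bound : chords x ℕ.≤ 2
    bound = subst (chords x ℕ.≤_) (trans (∑-cong L λ u → ∑-+ L _ _) (trans (∑-+ L _ _)
      (cong₂ ℕ._+_ (single s∈ t∈) (single t∈ s∈))))
      (∑-mono-∈ L λ u u∈ → ∑-mono-∈ L λ w w∈ → pointwise u u∈ w w∈)

-- Class indicators evaluated on the possible kinds

open +-*-Solver using () renaming (solve to ℕ-solve; con to ℕcon; _:+_ to _ℕ:+_; _:*_ to _ℕ:*_; _:=_ to _ℕ:=_)

-- Membership of a point in a class, in terms of the number k of osculating
-- planes through it and its multiplicity j on the arc.
Member : Class → ℕ → ℕ → Set
Member c0   k j = j ≡ 0 × k ≡ 0
Member c1   k j = j ≡ 0 × k ≡ 1
Member c2   k j = j ≡ 0 × k ≡ 2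
Member c3   k j = j ≡ 0 × k ≡ 3
Member cq+1 k j = j ≡ 1

member? : ∀ d k j → Dec (Member d k j)
member? c0   k j = (j ℕ.≟ 0) ×-dec (k ℕ.≟ 0)
member? c1   k j = (j ℕ.≟ 0) ×-dec (k ℕ.≟ 1)
member? c2   k j = (j ℕ.≟ 0) ×-dec (k ℕ.≟ 2)
member? c3   k j = (j ℕ.≟ 0) ×-dec (k ℕ.≟ 3)
member? cq+1 k j = j ℕ.≟ 1

private
  wt : Class → ℕ → ℕ → ℕ
  wt d k j = 𝟙 (member? d k j)

classes-partition : ∀ {k j z} → Kind k j z →
  wt c0 k j ℕ.+ wt c1 k j ℕ.+ wt c2 k j ℕ.+ wt c3 k j ℕ.+ wt cq+1 k j ≡ 1
classes-partition on-arc     = refl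
classes-partition on-quadric = refl
classes-partition generic₀   = refl
classes-partition generic₁   = refl
classes-partition generic₃   = refl

-- Each coefficient is the number of osculating planes through a point of the class, which is 1 on
-- the arc; the second moment has their squares.
classes-first-moment : ∀ {k j z} → Kind k j z →
  wt cq+1 k j ℕ.+ wt c1 k j ℕ.+ 2 ℕ.* wt c2 k j ℕ.+ 3 ℕ.* wt c3 k j ≡ k
classes-first-moment on-arc     = refl
classes-first-moment on-quadric = refl
classes-first-moment generic₀   = refl
classes-first-moment generic₁   = refl
classes-first-moment generic₃   = refl

classes-second-moment : ∀ {k j z} → Kind k j z →
  wt cq+1 k j ℕ.+ wt c1 k j ℕ.+ 4 ℕ.* wt c2 k j ℕ.+ 9 ℕ.* wt c3 k j ≡ k ℕ.* k
classes-second-moment on-arc     = refl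
classes-second-moment on-quadric = refl
classes-second-moment generic₀   = refl
classes-second-moment generic₁   = refl
classes-second-moment generic₃   = refl

classes-quadric : ∀ {k j z} → Kind k j z → wt c2 k j ℕ.+ wt cq+1 k j ≡ z
classes-quadric on-arc     = refl
classes-quadric on-quadric = refl
classes-quadric generic₀   = refl
classes-quadric generic₁   = refl
classes-quadric generic₃   = refl

classes-arc : ∀ {k j z} → Kind k j z → wt cq+1 k j ≡ j
classes-arc on-arc     = refl
classes-arc on-quadric = refl
classes-arc generic₀   = refl
classes-arc generic₁   = refl
classes-arc generic₃   = refl

member⇒off-quadric : ∀ {k j z} → Kind k j z → Member c0 k j ⊎ Member c3 k j → z ≡ 0
member⇒off-quadric generic₀ _ = refl
member⇒off-quadric generic₁ _ = refl
member⇒off-quadric generic₃ _ = refl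
member⇒off-quadric on-arc     (inj₁ (() , _))
member⇒off-quadric on-arc     (inj₂ (() , _))
member⇒off-quadric on-quadric (inj₁ (_ , ()))
member⇒off-quadric on-quadric (inj₂ (_ , ()))

-- Equations for the class sizes in a polar plane

module Moments (n : ℕ) (K : FiniteField (2 ℕ.^ n)) (h : ℕ) (coprime : gcd n h ≡ 1) where

  private
    q = 2 ℕ.^ n

  open FieldProperties K
  open Characteristic2 n K
  open Frobenius n K h coprime
  open Projective K
  open Geometry n K h coprime
  open Counting n K h coprime
  open Classification n K h coprime
  open Incidence n K h coprime
  open ≡-Reasoning

  private
    weight : Class → Space → ℕ
    weight d p = wt d (osculating p) (arc p)

  classCount : Space → Class → ℕ
  classCount x d = ∑[ p ∈ normalForms 4 ] (Z (form x p) ℕ.* 𝟙 (member? d (osculating p) (arc p)))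

  line-length : ∑[ t ∈ normalForms 2 ] 1 ≡ q ℕ.+ 1
  line-length = trans (∑-line _) (cong (ℕ._+ 1) (trans (∑-constant 1) (ℕₚ.*-identityʳ q)))

  ∑-line-constant : ∀ k → ∑[ t ∈ normalForms 2 ] k ≡ (q ℕ.+ 1) ℕ.* k
  ∑-line-constant k = trans (∑-cong (normalForms 2) λ _ → sym (ℕₚ.*-identityˡ k))
    (trans (∑-*ʳ (normalForms 2) k (λ _ → 1)) (cong (ℕ._* k) line-length))

  -- Points of the quadric are included, since this count later evaluates `OnExactlyOsculating` at
  -- an arbitrary point.
  count-arc : ∀ x → classCount x cq+1 ≡ osculating x
  count-arc x = trans (∑-normalForms-cong λ {p} nf → cong (Z (form x p) ℕ.*_) (classes-arc (kind nf))) (arc-points x)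

  module _ (x : Space) (d≢0 : det x ≢ 0#) where

    private
      P = normalForms 4
      L = normalForms 2

      ∑ₓ : (Space → ℕ) → ℕ
      ∑ₓ f = ∑[ p ∈ P ] (Z (form x p) ℕ.* f p)

      infixl 6 _⊕_
      infixl 7 _⊗_
      _⊕_ : (f g : Space → ℕ) → Space → ℕ
      (f ⊕ g) p = f p ℕ.+ g p
      _⊗_ : ℕ → (Space → ℕ) → Space → ℕ
      (k ⊗ f) p = k ℕ.* f p

      ∑ₓ-cong : ∀ {f g} → (∀ {p} → NormalForm p → f p ≡ g p) → ∑ₓ f ≡ ∑ₓ g
      ∑ₓ-cong eq = ∑-normalForms-cong λ {p} nf → cong (Z (form x p) ℕ.*_) (eq nf)

      ∑ₓ-+ : ∀ f g → ∑ₓ (f ⊕ g) ≡ ∑ₓ f ℕ.+ ∑ₓ g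
      ∑ₓ-+ f g = trans (∑-cong P λ p → ℕₚ.*-distribˡ-+ (Z (form x p)) (f p) (g p)) (∑-+ P _ _)

      ∑ₓ-* : ∀ k f → ∑ₓ (k ⊗ f) ≡ k ℕ.* ∑ₓ f
      ∑ₓ-* k f = trans (∑-cong P λ p → swap (Z (form x p)) k (f p)) (∑-*ˡ P k _)
        where
        swap : ∀ a b c → a ℕ.* (b ℕ.* c) ≡ b ℕ.* (a ℕ.* c)
        swap a b c = trans (sym (ℕₚ.*-assoc a b c)) (trans (cong (ℕ._* c) (ℕₚ.*-comm a b)) (ℕₚ.*-assoc b a c))

      ∑ₓ-∑ : ∀ (f : Space → Line → ℕ) → ∑ₓ (λ p → ∑[ t ∈ L ] f p t) ≡ ∑[ t ∈ L ] ∑ₓ (λ p → f p t)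
      ∑ₓ-∑ f = trans (∑-cong P λ p → sym (∑-*ˡ L (Z (form x p)) (f p))) (∑-swap P L _)

      W = classCount x

      osculating-sum : ∑ₓ osculating ≡ (q ℕ.+ 1) ℕ.* (q ℕ.+ 1)
      osculating-sum = begin
        ∑ₓ osculating ≡⟨ ∑ₓ-∑ (λ p t → Z (B p t t)) ⟩
        ∑[ t ∈ L ] ∑[ p ∈ P ] (Z (form x p) ℕ.* Z (B p t t))
          ≡⟨ ∑-normalForms-cong (λ nf → tangent-points x d≢0 nf) ⟩
        ∑[ t ∈ L ] (q ℕ.+ 1) ≡⟨ ∑-line-constant (q ℕ.+ 1) ⟩
        (q ℕ.+ 1) ℕ.* (q ℕ.+ 1) ∎

      -- The polar plane of x meets the intersection of the two osculating planes in one point in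
      -- general. It meets it in a line, hence in q further points, if the planes coincide or if the
      -- pair is conjugate, and these cases exclude each other.
      pair : ∀ {s t} → NormalForm s → NormalForm t →
        ∑ₓ (λ p → Z (B p s s) ℕ.* Z (B p t t)) ≡ 1 ℕ.+ q ℕ.* 𝟙 (t ≟ᵥ s) ℕ.+ q ℕ.* 𝟙 (conjugate? x s t)
      pair {s} {t} nf-s nf-t = by-cases (s ≟ᵥ t)
        where
        by-cases : Dec (s ≡ t) →
          ∑ₓ (λ p → Z (B p s s) ℕ.* Z (B p t t)) ≡ 1 ℕ.+ q ℕ.* 𝟙 (t ≟ᵥ s) ℕ.+ q ℕ.* 𝟙 (conjugate? x s t)
        by-cases (yes refl) = begin
          ∑ₓ (λ p → Z (B p s s) ℕ.* Z (B p s s)) ≡⟨ ∑ₓ-cong (λ {p} _ → idempotent (B p s s ≟ 0#)) ⟩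
          ∑ₓ (λ p → Z (B p s s)) ≡⟨ tangent-points x d≢0 nf-s ⟩
          q ℕ.+ 1 ≡⟨ arithmetic q ⟩
          1 ℕ.+ q ℕ.* 1 ℕ.+ q ℕ.* 0
            ≡⟨ cong₂ (λ i j → 1 ℕ.+ q ℕ.* i ℕ.+ q ℕ.* j) (𝟙-yes (s ≟ᵥ s) refl)
                 (𝟙-no (conjugate? x s s) λ (s≢s , _) → s≢s refl) ⟨
          1 ℕ.+ q ℕ.* 𝟙 (s ≟ᵥ s) ℕ.+ q ℕ.* 𝟙 (conjugate? x s s) ∎
          where
          idempotent : ∀ {A : Set} (e : Dec A) → 𝟙 e ℕ.* 𝟙 e ≡ 𝟙 e
          idempotent (yes _) = refl
          idempotent (no _) = refl
          arithmetic : ∀ q → q ℕ.+ 1 ≡ 1 ℕ.+ q ℕ.* 1 ℕ.+ q ℕ.* 0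
          arithmetic = ℕ-solve 1 (λ q → q ℕ:+ ℕcon 1 ℕ:= ℕcon 1 ℕ:+ q ℕ:* ℕcon 1 ℕ:+ q ℕ:* ℕcon 0) refl
        by-cases (no s≢t) = begin
          ∑ₓ (λ p → Z (B p s s) ℕ.* Z (B p t t)) ≡⟨ chord-points {s} {t} x (area-≢0 nf-s nf-t s≢t) ⟩
          1 ℕ.+ q ℕ.* (Z (B x s t) ℕ.* Z (B x t s))
            ≡⟨ cong (λ i → 1 ℕ.+ q ℕ.* i) (sym (𝟙-× (B x s t ≟ 0#) (B x t s ≟ 0#))) ⟩
          1 ℕ.+ q ℕ.* 𝟙 ((B x s t ≟ 0#) ×-dec (B x t s ≟ 0#))
            ≡⟨ cong (λ i → 1 ℕ.+ q ℕ.* i) (𝟙-⇔ ((B x s t ≟ 0#) ×-dec (B x t s ≟ 0#)) (conjugate? x s t) (s≢t ,_) proj₂) ⟩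
          1 ℕ.+ q ℕ.* 𝟙 (conjugate? x s t) ≡⟨ arithmetic q _ ⟩
          1 ℕ.+ q ℕ.* 0 ℕ.+ q ℕ.* 𝟙 (conjugate? x s t)
            ≡⟨ cong (λ i → 1 ℕ.+ q ℕ.* i ℕ.+ q ℕ.* 𝟙 (conjugate? x s t)) (𝟙-no (t ≟ᵥ s) (s≢t ∘ sym)) ⟨
          1 ℕ.+ q ℕ.* 𝟙 (t ≟ᵥ s) ℕ.+ q ℕ.* 𝟙 (conjugate? x s t) ∎
          where
          arithmetic : ∀ q z → 1 ℕ.+ q ℕ.* z ≡ 1 ℕ.+ q ℕ.* 0 ℕ.+ q ℕ.* z
          arithmetic = ℕ-solve 2 (λ q z → ℕcon 1 ℕ:+ q ℕ:* z ℕ:= ℕcon 1 ℕ:+ q ℕ:* ℕcon 0 ℕ:+ q ℕ:* z) refl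

      -- The square counts ordered pairs of osculating planes: there are (q + 1)² of them, and q is
      -- added for each of the q + 1 equal pairs and for each conjugate pair.
      osculating-sum² : ∑ₓ (λ p → osculating p ℕ.* osculating p)
        ≡ (q ℕ.+ 1) ℕ.* (q ℕ.+ 1) ℕ.+ q ℕ.* (q ℕ.+ 1) ℕ.+ q ℕ.* chords x
      osculating-sum² = begin
        ∑ₓ (λ p → osculating p ℕ.* osculating p)
          ≡⟨ ∑ₓ-cong (λ {p} _ → trans (sym (∑-*ʳ L (osculating p) _))
               (∑-cong L λ s → sym (∑-*ˡ L (Z (B p s s)) _))) ⟩
        ∑ₓ (λ p → ∑[ s ∈ L ] ∑[ t ∈ L ] (Z (B p s s) ℕ.* Z (B p t t)))
          ≡⟨ trans (∑ₓ-∑ _) (∑-cong L λ s → ∑ₓ-∑ (λ p t → Z (B p s s) ℕ.* Z (B p t t))) ⟩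
        ∑[ s ∈ L ] ∑[ t ∈ L ] ∑ₓ (λ p → Z (B p s s) ℕ.* Z (B p t t))
          ≡⟨ ∑-normalForms-cong (λ nf-s → ∑-normalForms-cong (λ nf-t → pair nf-s nf-t)) ⟩
        ∑[ s ∈ L ] ∑[ t ∈ L ] (1 ℕ.+ q ℕ.* 𝟙 (t ≟ᵥ s) ℕ.+ q ℕ.* 𝟙 (conjugate? x s t))
          ≡⟨ ∑-normalForms-cong inner ⟩
        ∑[ s ∈ L ] (q ℕ.+ 1 ℕ.+ q ℕ.+ q ℕ.* ∑[ t ∈ L ] 𝟙 (conjugate? x s t))
          ≡⟨ trans (∑-+ L _ _) (cong₂ ℕ._+_ (∑-line-constant (q ℕ.+ 1 ℕ.+ q)) (∑-*ˡ L q _)) ⟩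
        (q ℕ.+ 1) ℕ.* (q ℕ.+ 1 ℕ.+ q) ℕ.+ q ℕ.* chords x
          ≡⟨ arithmetic q (chords x) ⟩
        (q ℕ.+ 1) ℕ.* (q ℕ.+ 1) ℕ.+ q ℕ.* (q ℕ.+ 1) ℕ.+ q ℕ.* chords x ∎
        where
        inner : ∀ {s} → NormalForm s → ∑[ t ∈ L ] (1 ℕ.+ q ℕ.* 𝟙 (t ≟ᵥ s) ℕ.+ q ℕ.* 𝟙 (conjugate? x s t))
                ≡ q ℕ.+ 1 ℕ.+ q ℕ.+ q ℕ.* ∑[ t ∈ L ] 𝟙 (conjugate? x s t)
        inner nf-s = trans (∑-+ L _ _) (cong₂ ℕ._+_
          (trans (∑-+ L _ _) (cong₂ ℕ._+_ line-length
            (trans (∑-*ˡ L q _) (trans (cong (q ℕ.*_) (∑-δ _≟ᵥ_ (normalForms-unique 2) (∈-normalForms⁺ nf-s)))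
              (ℕₚ.*-identityʳ q)))))
          (∑-*ˡ L q _))
        arithmetic : ∀ q m → (q ℕ.+ 1) ℕ.* (q ℕ.+ 1 ℕ.+ q) ℕ.+ q ℕ.* m
          ≡ (q ℕ.+ 1) ℕ.* (q ℕ.+ 1) ℕ.+ q ℕ.* (q ℕ.+ 1) ℕ.+ q ℕ.* m
        arithmetic = ℕ-solve 2 (λ q m →
          (q ℕ:+ ℕcon 1) ℕ:* (q ℕ:+ ℕcon 1 ℕ:+ q) ℕ:+ q ℕ:* m ℕ:=
          (q ℕ:+ ℕcon 1) ℕ:* (q ℕ:+ ℕcon 1) ℕ:+ q ℕ:* (q ℕ:+ ℕcon 1) ℕ:+ q ℕ:* m) refl

    count-quadric : W c2 ℕ.+ W cq+1 ≡ q ℕ.+ 1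
    count-quadric = trans (sym (∑ₓ-+ (weight c2) (weight cq+1)))
      (trans (∑ₓ-cong (classes-quadric ∘ kind)) (quadric-points x d≢0))

    count-all : W c0 ℕ.+ W c1 ℕ.+ W c2 ℕ.+ W c3 ℕ.+ W cq+1 ≡ q ℕ.* q ℕ.+ q ℕ.+ 1
    count-all = begin
      W c0 ℕ.+ W c1 ℕ.+ W c2 ℕ.+ W c3 ℕ.+ W cq+1
        ≡⟨ trans (∑ₓ-+ (weight c0 ⊕ weight c1 ⊕ weight c2 ⊕ weight c3) (weight cq+1)) (cong (ℕ._+ W cq+1)
           (trans (∑ₓ-+ (weight c0 ⊕ weight c1 ⊕ weight c2) (weight c3)) (cong (ℕ._+ W c3)
           (trans (∑ₓ-+ (weight c0 ⊕ weight c1) (weight c2)) (cong (ℕ._+ W c2)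
           (∑ₓ-+ (weight c0) (weight c1))))))) ⟨
      ∑ₓ (weight c0 ⊕ weight c1 ⊕ weight c2 ⊕ weight c3 ⊕ weight cq+1) ≡⟨ ∑ₓ-cong (classes-partition ∘ kind) ⟩
      ∑ₓ (λ _ → 1) ≡⟨ ∑-cong P (λ p → ℕₚ.*-identityʳ _) ⟩
      ∑[ p ∈ P ] Z (form x p) ≡⟨ plane-points x d≢0 ⟩
      q ℕ.* q ℕ.+ q ℕ.+ 1 ∎

    private
      count-moment : ∀ a b → ∑ₓ (weight cq+1 ⊕ weight c1 ⊕ a ⊗ weight c2 ⊕ b ⊗ weight c3)
                     ≡ W cq+1 ℕ.+ W c1 ℕ.+ a ℕ.* W c2 ℕ.+ b ℕ.* W c3
      count-moment a b =
        trans (∑ₓ-+ (weight cq+1 ⊕ weight c1 ⊕ a ⊗ weight c2) (b ⊗ weight c3)) (cong₂ ℕ._+_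
        (trans (∑ₓ-+ (weight cq+1 ⊕ weight c1) (a ⊗ weight c2)) (cong₂ ℕ._+_
        (∑ₓ-+ (weight cq+1) (weight c1)) (∑ₓ-* a (weight c2)))) (∑ₓ-* b (weight c3)))

    count-osculating : W cq+1 ℕ.+ W c1 ℕ.+ 2 ℕ.* W c2 ℕ.+ 3 ℕ.* W c3 ≡ (q ℕ.+ 1) ℕ.* (q ℕ.+ 1)
    count-osculating = trans (sym (count-moment 2 3))
      (trans (∑ₓ-cong (classes-first-moment ∘ kind)) osculating-sum)

    count-osculating² : W cq+1 ℕ.+ W c1 ℕ.+ 4 ℕ.* W c2 ℕ.+ 9 ℕ.* W c3
      ≡ (q ℕ.+ 1) ℕ.* (q ℕ.+ 1) ℕ.+ q ℕ.* (q ℕ.+ 1) ℕ.+ q ℕ.* chords x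
    count-osculating² = trans (sym (count-moment 4 9))
      (trans (∑ₓ-cong (classes-second-moment ∘ kind)) osculating-sum²)

-- A copy of the given field on `Fin q`

module FiniteCopy {c ℓ} (F : Field c ℓ) {q : ℕ} (card : HasCardinality (Field.setoid F) q) where

  private
    module F = Field F

  open Inverse card public using (to; from; to-cong; strictlyInverseˡ; strictlyInverseʳ)

  private
    rawRing : RawRing _ _
    rawRing = record
      { Carrier = Fin q
      ; _≈_ = _≡_
      ; _+_ = λ x y → to (from x F.+ from y)
      ; _*_ = λ x y → to (from x F.* from y)
      ; -_  = λ x → to (F.- from x)
      ; 0#  = to F.0#
      ; 1#  = to F.1#
      }

    -- The operations on `Fin q` are conjugated from F, so `from` preserves them; being injective,
    -- it reflects the ring laws back to the copy.
    from-isRingMonomorphism : IsRingMonomorphism rawRing F.rawRing from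
    from-isRingMonomorphism = record
      { isRingHomomorphism = record
        { isSemiringHomomorphism = record
          { isNearSemiringHomomorphism = record
            { +-isMonoidHomomorphism = record
              { isMagmaHomomorphism = record
                { isRelHomomorphism = record { cong = λ { refl → F.refl } }
                ; homo = λ _ _ → strictlyInverseʳ _
                }
              ; ε-homo = strictlyInverseʳ _
              }
            ; *-homo = λ _ _ → strictlyInverseʳ _
            }
          ; 1#-homo = strictlyInverseʳ _
          }
        ; -‿homo = λ _ → strictlyInverseʳ _
        }
      ; injective = λ {x} {y} eq → trans (sym (strictlyInverseˡ x)) (trans (to-cong eq) (strictlyInverseˡ y))
      }

  to-injective : ∀ {x y} → to x ≡ to y → x F.≈ y
  to-injective {x} {y} eq = F.trans (F.sym (strictlyInverseʳ x))
    (F.trans (F.reflexive (cong from eq)) (strictlyInverseʳ y))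

  copy : FiniteField q
  copy = record
    { isCommutativeRing = RingMonomorphism.isCommutativeRing from-isRingMonomorphism F.isCommutativeRing
    ; 1≢0 = λ eq → F.1≉0 (to-injective eq)
    ; inverse = λ x x≢0 →
        let (y , yx≈1 , _) = F.inverse (from x) (λ x≈0 → x≢0 (trans (sym (strictlyInverseˡ x)) (to-cong x≈0)))
        in to y , to-cong (F.trans (F.*-congʳ (strictlyInverseʳ y)) yx≈1)
    }

  open FiniteField copy

  to-+ : ∀ x y → to (x F.+ y) ≡ to x + to y
  to-+ x y = to-cong (F.sym (F.+-cong (strictlyInverseʳ x) (strictlyInverseʳ y)))

  to-* : ∀ x y → to (x F.* y) ≡ to x * to y
  to-* x y = to-cong (F.sym (F.*-cong (strictlyInverseʳ x) (strictlyInverseʳ y)))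

  open FieldProperties copy using (_^_)
  open Power F.semiring using () renaming (_^_ to _^ᶠ_)

  to-^ : ∀ x k → to (x ^ᶠ k) ≡ to x ^ k
  to-^ x zero = refl
  to-^ x (suc k) = trans (to-* x (x ^ᶠ k)) (cong (to x *_) (to-^ x k))

  ≉0⇒≢0 : ∀ {x} → ¬ (x F.≈ F.0#) → to x ≢ 0#
  ≉0⇒≢0 x≉0 eq = x≉0 (to-injective eq)

  from-≉0 : ∀ {x} → x ≢ 0# → ¬ (from x F.≈ F.0#)
  from-≉0 {x} x≢0 eq = x≢0 (trans (sym (strictlyInverseˡ x)) (to-cong eq))

-- From points and planes over the given field to normal forms

module Transfer {c ℓ} (F : Field c ℓ) (n h : ℕ) (coprime : gcd n h ≡ 1)
                (card : HasCardinality (Field.setoid F) (2 ℕ.^ n)) where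

  private
    q = 2 ℕ.^ n
    module F = Field F

  open FiniteCopy F card
  open PG3 F hiding (form)
  open Arc h
  open FieldProperties copy hiding (inverse)
  open Frobenius n copy h coprime
  open Projective copy
  open Geometry n copy h coprime
  open Classification n copy h coprime
  open Moments n copy h coprime
  open ≡-Reasoning

  code : Homogeneous → Space
  code P = to (coord P 0F) ∷ to (coord P 1F) ∷ to (coord P 2F) ∷ to (coord P 3F) ∷ []

  lookup-code : ∀ P i → Vec.lookup (code P) i ≡ to (coord P i)
  lookup-code P 0F = refl
  lookup-code P 1F = refl
  lookup-code P 2F = refl
  lookup-code P 3F = refl

  decode : ∀ {p} → NormalForm p → Homogeneous
  decode {p} nf = homogeneous (λ i → from (Vec.lookup p i))
    (proj₁ (normalForm-≢0 nf) , from-≉0 (proj₂ (normalForm-≢0 nf)))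

  code-decode : ∀ {p} (nf : NormalForm p) → code (decode nf) ≡ p
  code-decode {x₁ ∷ x₂ ∷ x₃ ∷ x₄ ∷ []} nf = cong₂ _∷_ (strictlyInverseˡ x₁) (cong₂ _∷_ (strictlyInverseˡ x₂)
    (cong₂ _∷_ (strictlyInverseˡ x₃) (cong (_∷ []) (strictlyInverseˡ x₄))))

  proportional⇒scale : ∀ {P R} → Proportional P R → ∃ λ a → a ≢ 0# × code P ≡ scale a (code R)
  proportional⇒scale {P} {R} (s , s≉0 , eq) = to s , ≉0⇒≢0 s≉0 ,
    cong₂ _∷_ (e 0F) (cong₂ _∷_ (e 1F) (cong₂ _∷_ (e 2F) (cong (_∷ []) (e 3F))))
    where
    e : ∀ i → to (coord P i) ≡ to s * to (coord R i)
    e i = trans (to-cong (eq i)) (to-* s (coord R i))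

  scale⇒proportional : ∀ {P R a} → a ≢ 0# → code P ≡ scale a (code R) → Proportional P R
  scale⇒proportional {P} {R} {a} a≢0 eq = from a , from-≉0 a≢0 , λ i → to-injective (begin
    to (coord P i)                 ≡⟨ lookup-code P i ⟨
    Vec.lookup (code P) i          ≡⟨ cong (λ v → Vec.lookup v i) eq ⟩
    Vec.lookup (scale a (code R)) i ≡⟨ Vecₚ.lookup-map i (a *_) (code R) ⟩
    a * Vec.lookup (code R) i      ≡⟨ cong₂ _*_ (sym (strictlyInverseˡ a)) (lookup-code R i) ⟩
    to (from a) * to (coord R i)   ≡⟨ to-* (from a) (coord R i) ⟨
    to (from a F.* coord R i)      ∎)

  private
    normal : ∀ P → ∃ λ a → ∃ λ p → a ≢ 0# × NormalForm p × code P ≡ scale a p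
    normal P = normalForm-exists (code P) (proj₁ (nonzero P))
      (λ eq → ≉0⇒≢0 (proj₂ (nonzero P)) (trans (sym (lookup-code P (proj₁ (nonzero P)))) eq))

  -- The normal form turns proportionality, with its existential scalar, into propositional equality
  -- of list entries.
  nf : Homogeneous → Space
  nf P = proj₁ (proj₂ (normal P))

  factor : Homogeneous → Fin q
  factor P = proj₁ (normal P)

  factor-≢0 : ∀ P → factor P ≢ 0#
  factor-≢0 P = proj₁ (proj₂ (proj₂ (normal P)))

  nf-normalForm : ∀ P → NormalForm (nf P)
  nf-normalForm P = proj₁ (proj₂ (proj₂ (proj₂ (normal P))))

  code≡ : ∀ P → code P ≡ scale (factor P) (nf P)
  code≡ P = proj₂ (proj₂ (proj₂ (proj₂ (normal P))))

  scale-∘ : ∀ a b {m} (v : Vec (Fin q) m) → scale a (scale b v) ≡ scale (a * b) v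
  scale-∘ a b v = trans (sym (Vecₚ.map-∘ (a *_) (b *_) v)) (Vecₚ.map-cong (λ x → sym (*-assoc a b x)) v)

  nf-unique : ∀ {P a p} → NormalForm p → a ≢ 0# → code P ≡ scale a p → nf P ≡ p
  nf-unique {P} nf-p a≢0 eq =
    normalForm-unique (nf-normalForm P) nf-p (factor-≢0 P) a≢0 (trans (sym (code≡ P)) eq)

  nf-decode : ∀ {p} (nf-p : NormalForm p) → ∀ P → code P ≡ code (decode nf-p) → nf P ≡ p
  nf-decode {p} nf-p P eq = nf-unique {P} nf-p 1≢0 (trans eq (trans (code-decode nf-p) (sym (scale-1 p))))
    where
    scale-1 : ∀ {m} (v : Vec (Fin q) m) → scale 1# v ≡ v
    scale-1 v = trans (Vecₚ.map-cong *-identityˡ v) (Vecₚ.map-id v)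

  proportional⇒nf≡ : ∀ {P R} → Proportional P R → nf P ≡ nf R
  proportional⇒nf≡ {P} {R} P∼R with a , a≢0 , eq ← proportional⇒scale {P} {R} P∼R =
    nf-unique {P} (nf-normalForm R) (*-≢0 a≢0 (factor-≢0 R))
      (trans eq (trans (cong (scale a) (code≡ R)) (scale-∘ a (factor R) (nf R))))

  nf≡⇒proportional : ∀ {P R} → nf P ≡ nf R → Proportional P R
  nf≡⇒proportional {P} {R} eq = scale⇒proportional {P} {R} (*-≢0 (factor-≢0 P) (inv-≢0 (factor-≢0 R))) (begin
    code P                          ≡⟨ code≡ P ⟩
    scale (factor P) (nf P)         ≡⟨ cong (scale (factor P)) eq ⟩
    scale (factor P) (nf R)         ≡⟨ cong (λ a → scale a (nf R)) (begin
      factor P                             ≡⟨ *-identityʳ _ ⟨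
      factor P * 1#                        ≡⟨ cong (factor P *_) (inv-inverseˡ (factor-≢0 R)) ⟨
      factor P * (inv (factor R) * factor R) ≡⟨ *-assoc (factor P) (inv (factor R)) (factor R) ⟨
      factor P * inv (factor R) * factor R ∎) ⟩
    scale (factor P * inv (factor R) * factor R) (nf R) ≡⟨ scale-∘ _ (factor R) (nf R) ⟨
    scale (factor P * inv (factor R)) (scale (factor R) (nf R)) ≡⟨ cong (scale (factor P * inv (factor R))) (code≡ R) ⟨
    scale (factor P * inv (factor R)) (code R) ∎)

  polar-cong : ∀ {P R} → Proportional P R → Proportional (P ^𝔰) (R ^𝔰)
  polar-cong (s , s≉0 , eq) = s , s≉0 , λ i → eq (opposite i)

  pole≡ : ∀ {π R} → Proportional π (R ^𝔰) → nf (π ^𝔰) ≡ nf R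
  pole≡ {π} {R} π∼R = trans (proportional⇒nf≡ {π ^𝔰} {R ^𝔰 ^𝔰} (polar-cong {π} {R ^𝔰} π∼R))
    -- Reversing four coordinates twice is the identity by computation, so `code≡ R` also serves for
    -- the double polar.
    (nf-unique {R ^𝔰 ^𝔰} (nf-normalForm R) (factor-≢0 R) (code≡ R))

  pole≡⇒proportional : ∀ {π ρ} → nf (π ^𝔰) ≡ nf (ρ ^𝔰) → Proportional π ρ
  pole≡⇒proportional {π} {ρ} eq
    with a , a≢0 , eq′ ← proportional⇒scale {π ^𝔰} {ρ ^𝔰} (nf≡⇒proportional {π ^𝔰} {ρ ^𝔰} eq) =
    scale⇒proportional {π} {ρ} a≢0 (cong reverse eq′)
    where
    reverse : Space → Space
    reverse (x₁ ∷ x₂ ∷ x₃ ∷ x₄ ∷ []) = x₄ ∷ x₃ ∷ x₂ ∷ x₁ ∷ []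

  to-incidence : ∀ Q π → to ((coord Q 0F F.* coord π 0F) F.+ (coord Q 1F F.* coord π 1F) F.+
    (coord Q 2F F.* coord π 2F) F.+ (coord Q 3F F.* coord π 3F)) ≡ form (code Q) (code (π ^𝔰))
  to-incidence Q π = trans (to-+ _ _) (cong₂ _+_ (trans (to-+ _ _) (cong₂ _+_ (trans (to-+ _ _)
    (cong₂ _+_ (to-* _ _) (to-* _ _))) (to-* _ _))) (to-* _ _))

  form-nf : ∀ P R → form (code P) (code R) ≡ factor P * factor R * form (nf P) (nf R)
  form-nf P R = begin
    form (code P) (code R) ≡⟨ cong₂ form (code≡ P) (code≡ R) ⟩
    form (scale (factor P) (nf P)) (scale (factor R) (nf R)) ≡⟨ form-scale (factor P) (nf P) _ ⟩
    factor P * form (nf P) (scale (factor R) (nf R)) ≡⟨ cong (factor P *_) (form-comm (nf P) _) ⟩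
    factor P * form (scale (factor R) (nf R)) (nf P) ≡⟨ cong (factor P *_) (form-scale (factor R) (nf R) (nf P)) ⟩
    factor P * (factor R * form (nf R) (nf P)) ≡⟨ *-assoc (factor P) (factor R) _ ⟨
    factor P * factor R * form (nf R) (nf P) ≡⟨ cong (factor P * factor R *_) (form-comm (nf R) (nf P)) ⟩
    factor P * factor R * form (nf P) (nf R) ∎

  liesOn⇒form≡0 : ∀ {Q π} → Q liesOn π → form (nf Q) (nf (π ^𝔰)) ≡ 0#
  liesOn⇒form≡0 {Q} {π} lies = x*y≡0⇒y≡0 (*-≢0 (factor-≢0 Q) (factor-≢0 (π ^𝔰)))
    (trans (sym (form-nf Q (π ^𝔰))) (trans (sym (to-incidence Q π)) (to-cong lies)))

  form≡0⇒liesOn : ∀ {Q π} → form (nf Q) (nf (π ^𝔰)) ≡ 0# → Q liesOn π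
  form≡0⇒liesOn {Q} {π} eq = to-injective (trans (to-incidence Q π)
    (trans (form-nf Q (π ^𝔰)) (trans (cong (factor Q * factor (π ^𝔰) *_) eq) (zeroʳ _))))

  module _ {r s} {𝒫 : Pred Point r} {M : Pred Space s} (M? : Decidable M)
           (𝒫⇒M : ∀ {R} → 𝒫 R → M (nf R)) (M⇒𝒫 : ∀ {R} → M (nf R) → 𝒫 R) where

    -- A plane is encoded by the normal form of its pole, and incidence with Q becomes the vanishing
    -- of `form`. The set `𝒫` stays abstract because the result is applied twice: to the arc, which
    -- evaluates the numbers defining the classes, and then to the classes themselves.
    polar-planes-cardinality : ∀ Q →
      HasCardinality (Subsetoid Planes (λ π → (∃ λ R → 𝒫 R × (π ≈ᴴ R ^𝔰)) × Q liesOn π))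
        (∑[ p ∈ normalForms 4 ] (Z (form (nf Q) p) ℕ.* 𝟙 (M? p)))
    polar-planes-cardinality Q = subst (HasCardinality _)
      (∑-cong (normalForms 4) λ p → 𝟙-× (form (nf Q) p ≟ 0#) (M? p))
      (hasCardinality-∑ _ (λ p → (form (nf Q) p ≟ 0#) ×-dec M? p) (normalForms-unique 4)
        (λ (π , _) → nf (π ^𝔰))
        (λ (π , _) → ∈-normalForms⁺ (nf-normalForm (π ^𝔰)))
        (λ (π , (R , 𝒫R , π∼R) , lies) → liesOn⇒form≡0 {Q} {π} lies , subst M (sym (pole≡ {π} {R} π∼R)) (𝒫⇒M 𝒫R))
        (λ {(π , _)} {(ρ , _)} π∼ρ → proportional⇒nf≡ {π ^𝔰} {ρ ^𝔰} (polar-cong {π} {ρ} π∼ρ))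
        (λ {(π , _)} {(ρ , _)} → pole≡⇒proportional {π} {ρ})
        (λ p∈ (form≡0 , Mp) →
          let nf-p = ∈-normalForms⁻ p∈
              R = decode nf-p
              nf-R = nf-decode nf-p R refl
              nf-pole = nf-decode nf-p (R ^𝔰 ^𝔰) refl
          in ( R ^𝔰
             , (R , M⇒𝒫 (subst M (sym nf-R) Mp) , Setoid.refl Planes {R ^𝔰})
             , form≡0⇒liesOn {Q} {R ^𝔰} (trans (cong (form (nf Q)) nf-pole) form≡0))
             , nf-pole))

  code-arc-point : ∀ t → code P⟨ t ⟩ ≡ tensor (1# ∷ to t ∷ []) (1# ∷ to t ∷ [])
  code-arc-point t = trans (cong₂ (λ x y → 1# ∷ to t ∷ x ∷ y ∷ []) σ≡ (trans (to-^ t (2 ℕ.^ h ℕ.+ 1))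
      (trans (^-homo-* (to t) (2 ℕ.^ h) 1) (cong₂ _*_ (sym (frobenius≡^ h (to t))) (*-identityʳ (to t))))))
    (sym (tensor-affine (to t)))
    where
    σ≡ = trans (to-^ t (2 ℕ.^ h)) (sym (frobenius≡^ h (to t)))

  code-U₄ : code U₄ ≡ tensor (0# ∷ 1# ∷ []) (0# ∷ 1# ∷ [])
  code-U₄ = sym tensor-infinity

  𝒜⇒tensor : ∀ {R} → 𝒜 R → ∃ λ v → NormalForm v × nf R ≡ tensor v v
  𝒜⇒tensor {R} (inj₁ (t , R∼P)) with a , a≢0 , eq ← proportional⇒scale {R} {P⟨ t ⟩} R∼P =
    (1# ∷ to t ∷ []) , lead _ ,
    nf-unique {R} (tensor-normalForm (lead _)) a≢0 (trans eq (cong (scale a) (code-arc-point t)))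
  𝒜⇒tensor {R} (inj₂ R∼U) with a , a≢0 , eq ← proportional⇒scale {R} {U₄} R∼U =
    (0# ∷ 1# ∷ []) , skip (lead []) ,
    nf-unique {R} (tensor-normalForm (skip (lead []))) a≢0 (trans eq (cong (scale a) code-U₄))

  𝒜⇒arc : ∀ {R} → 𝒜 R → arc (nf R) ≡ 1
  𝒜⇒arc {R} 𝒜R with v , nf-v , eq ← 𝒜⇒tensor {R} 𝒜R = trans (cong arc eq) (arc-tensor nf-v)

  tensor⇒𝒜 : ∀ {R v} → NormalForm v → nf R ≡ tensor v v → 𝒜 R
  tensor⇒𝒜 {R} (lead (t ∷ [])) eq = inj₁ (from t , scale⇒proportional {R} {P⟨ from t ⟩} (factor-≢0 R)
    (trans (code≡ R) (cong (scale (factor R)) (trans eq (sym (trans (code-arc-point (from t))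
      (cong (λ t → tensor (1# ∷ t ∷ []) (1# ∷ t ∷ [])) (strictlyInverseˡ t))))))))
  tensor⇒𝒜 {R} (skip (lead [])) eq = inj₂ (scale⇒proportional {R} {U₄} (factor-≢0 R)
    (trans (code≡ R) (cong (scale (factor R)) (trans eq (sym code-U₄)))))

  arc⇒𝒜 : ∀ {R} → arc (nf R) ≡ 1 → 𝒜 R
  arc⇒𝒜 {R} eq with arc-0-or-∃ (nf R)
  ... | inj₁ ≡0 = contradiction (trans (sym ≡0) eq) λ ()
  ... | inj₂ (v , nf-v , nf≡) = tensor⇒𝒜 {R} nf-v nf≡

  ¬𝒜⇒arc≡0 : ∀ {R} → ¬ 𝒜 R → arc (nf R) ≡ 0
  ¬𝒜⇒arc≡0 {R} R∉𝒜 with arc-0-or-∃ (nf R)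
  ... | inj₁ ≡0 = ≡0
  ... | inj₂ (v , nf-v , nf≡) = contradiction (tensor⇒𝒜 {R} nf-v nf≡) R∉𝒜

  osculating-cardinality : ∀ Q → OnExactlyOsculating (osculating (nf Q)) Q
  osculating-cardinality Q = subst (λ k → OnExactlyOsculating k Q) (count-arc (nf Q))
    (polar-planes-cardinality (λ p → member? cq+1 (osculating p) (arc p)) (λ {R} → 𝒜⇒arc {R}) (λ {R} → arc⇒𝒜 {R}) Q)

  -- A setoid has only one cardinality, so the one postulated in the definition of a class agrees
  -- with the computed one.
  exactly⇒≡ : ∀ {i R} → OnExactlyOsculating i R → osculating (nf R) ≡ i
  exactly⇒≡ {R = R} = hasCardinality-unique _ (osculating-cardinality R)

  ≡⇒exactly : ∀ {i R} → osculating (nf R) ≡ i → OnExactlyOsculating i R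
  ≡⇒exactly {R = R} refl = osculating-cardinality R

  private
    off : ∀ {i R} → ¬ 𝒜 R × OnExactlyOsculating i R → arc (nf R) ≡ 0 × osculating (nf R) ≡ i
    off {R = R} (R∉𝒜 , exactly) = ¬𝒜⇒arc≡0 {R} R∉𝒜 , exactly⇒≡ {R = R} exactly
    off⁻ : ∀ {i R} → arc (nf R) ≡ 0 × osculating (nf R) ≡ i → ¬ 𝒜 R × OnExactlyOsculating i R
    off⁻ {R = R} (arc≡0 , ≡i) =
      (λ 𝒜R → contradiction (trans (sym arc≡0) (𝒜⇒arc {R} 𝒜R)) λ ()) , ≡⇒exactly {R = R} ≡i

  𝒪⇒member : ∀ d {R} → 𝒪 d R → Member d (osculating (nf R)) (arc (nf R))
  𝒪⇒member c0   {R} = off {R = R}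
  𝒪⇒member c1   {R} = off {R = R}
  𝒪⇒member c2   {R} = off {R = R}
  𝒪⇒member c3   {R} = off {R = R}
  𝒪⇒member cq+1 {R} = 𝒜⇒arc {R}

  member⇒𝒪 : ∀ d {R} → Member d (osculating (nf R)) (arc (nf R)) → 𝒪 d R
  member⇒𝒪 c0   {R} = off⁻ {R = R}
  member⇒𝒪 c1   {R} = off⁻ {R = R}
  member⇒𝒪 c2   {R} = off⁻ {R = R}
  member⇒𝒪 c3   {R} = off⁻ {R = R}
  member⇒𝒪 cq+1 {R} = arc⇒𝒜 {R}

  planesThrough-cardinality : ∀ d Q → HasCardinality (PlanesThrough d Q) (classCount (nf Q) d)
  planesThrough-cardinality d = polar-planes-cardinality (λ p → member? d (osculating p) (arc p))
    (λ {R} → 𝒪⇒member d {R}) (λ {R} → member⇒𝒪 d {R})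

-- Solving the equations for the class sizes

module ClassArithmetic where

  open import Data.Integer.Base using (ℤ; +_; 1ℤ; -1ℤ; _+_; _*_; _-_)
  open import Data.Integer.Divisibility using (_∣_)
  import Data.Integer.Divisibility.Signed as Signed
  import Data.Integer.Properties as ℤₚ
  import Data.Integer.Solver as ℤ-Solver
  open import Data.Nat.Divisibility using (_∣?_)
  open import Data.Rational.Unnormalised.Base using (_/_; _≃_; *≡*)

  -- In the application m is `chords x` and a is the number of osculating planes through x, which by
  -- polarity is also the number of arc points in the polar plane.
  record ClassEquations (q m a : ℕ) (W : Class → ℕ) : Set where
    field
      arc-count       : W cq+1 ≡ a
      quadric-count   : W c2 ℕ.+ W cq+1 ≡ q ℕ.+ 1
      total        : W c0 ℕ.+ W c1 ℕ.+ W c2 ℕ.+ W c3 ℕ.+ W cq+1 ≡ q ℕ.* q ℕ.+ q ℕ.+ 1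
      first-moment : W cq+1 ℕ.+ W c1 ℕ.+ 2 ℕ.* W c2 ℕ.+ 3 ℕ.* W c3 ≡ (q ℕ.+ 1) ℕ.* (q ℕ.+ 1)
      second-moment : W cq+1 ℕ.+ W c1 ℕ.+ 4 ℕ.* W c2 ℕ.+ 9 ℕ.* W c3
        ≡ (q ℕ.+ 1) ℕ.* (q ℕ.+ 1) ℕ.+ q ℕ.* (q ℕ.+ 1) ℕ.+ q ℕ.* m

  module _ {q m a : ℕ} {W : Class → ℕ} (eqs : ClassEquations q m a W) where

    open ClassEquations eqs
    open ≡-Reasoning
    open ℤ-Solver.+-*-Solver

    private
      Q M A W₀ W₁ W₂ W₃ Wₐ : ℤ
      Q = + q
      M = + m
      A = + a
      W₀ = + W c0
      W₁ = + W c1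
      W₂ = + W c2
      W₃ = + W c3
      Wₐ = + W cq+1

      arc : Wₐ ≡ A
      arc = cong +_ arc-count

      quadric : W₂ + A ≡ Q + + 1
      quadric = trans (cong (λ z → W₂ + z) (sym arc)) (cong +_ quadric-count)

      all : W₀ + W₁ + W₂ + W₃ + A ≡ Q * Q + Q + + 1
      all = trans (cong (λ z → W₀ + W₁ + W₂ + W₃ + z) (sym arc)) (trans (cong +_ total)
        (cong (λ z → z + Q + + 1) (ℤₚ.pos-* q q)))

      square : + ((q ℕ.+ 1) ℕ.* (q ℕ.+ 1)) ≡ (Q + + 1) * (Q + + 1)
      square = ℤₚ.pos-* (q ℕ.+ 1) (q ℕ.+ 1)

      moment : ∀ k l → A + W₁ + + k * W₂ + + l * W₃ ≡ + (W cq+1 ℕ.+ W c1 ℕ.+ k ℕ.* W c2 ℕ.+ l ℕ.* W c3)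
      moment k l = trans (cong (λ z → z + W₁ + + k * W₂ + + l * W₃) (sym arc))
        (cong₂ (λ y z → Wₐ + W₁ + y + z) (sym (ℤₚ.pos-* k (W c2))) (sym (ℤₚ.pos-* l (W c3))))

      first : A + W₁ + + 2 * W₂ + + 3 * W₃ ≡ (Q + + 1) * (Q + + 1)
      first = trans (moment 2 3) (trans (cong +_ first-moment) square)

      second : A + W₁ + + 4 * W₂ + + 9 * W₃ ≡ (Q + + 1) * (Q + + 1) + Q * (Q + + 1) + Q * M
      second = trans (moment 4 9) (trans (cong +_ second-moment)
        (cong₂ _+_ (cong₂ _+_ square (ℤₚ.pos-* q (q ℕ.+ 1))) (ℤₚ.pos-* q m)))

    private
      W₂≡ : W₂ ≡ Q + + 1 - A
      W₂≡ = trans (solve 2 (λ w a → w := w :+ a :- a) refl W₂ A) (cong (_- A) quadric)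

      -- The coefficients come from 3 - 4 k + k² = (k - 1)(k - 3), which is 3 at k = 0, vanishes at
      -- 1 and 3 and is -1 at 2. Adding the quadric count removes the value at 2 and leaves the arc
      -- to be subtracted.
      3W₀≡ : W₀ * + 3 ≡ Q * Q - Q + + 1 + Q * M - A
      3W₀≡ = begin
        W₀ * + 3
          ≡⟨ solve 5 (λ w₀ w₁ w₂ w₃ a → w₀ :* con (+ 3) :=
               con (+ 3) :* (w₀ :+ w₁ :+ w₂ :+ w₃ :+ a) :- con (+ 4) :* (a :+ w₁ :+ con (+ 2) :* w₂ :+ con (+ 3) :* w₃)
               :+ (a :+ w₁ :+ con (+ 4) :* w₂ :+ con (+ 9) :* w₃) :+ (w₂ :+ a) :- a) refl W₀ W₁ W₂ W₃ A ⟩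
        + 3 * (W₀ + W₁ + W₂ + W₃ + A) - + 4 * (A + W₁ + + 2 * W₂ + + 3 * W₃) + (A + W₁ + + 4 * W₂ + + 9 * W₃) + (W₂ + A) - A
          ≡⟨ cong (_- A) (cong₂ _+_ (cong₂ _+_ (cong₂ (λ y z → + 3 * y - + 4 * z) all first) second) quadric) ⟩
        + 3 * (Q * Q + Q + + 1) - + 4 * ((Q + + 1) * (Q + + 1)) + ((Q + + 1) * (Q + + 1) + Q * (Q + + 1) + Q * M) + (Q + + 1) - A
          ≡⟨ solve 3 (λ q m a → con (+ 3) :* (q :* q :+ q :+ con (+ 1)) :- con (+ 4) :* ((q :+ con (+ 1)) :* (q :+ con (+ 1)))
               :+ ((q :+ con (+ 1)) :* (q :+ con (+ 1)) :+ q :* (q :+ con (+ 1)) :+ q :* m) :+ (q :+ con (+ 1)) :- a :=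
               q :* q :- q :+ con (+ 1) :+ q :* m :- a) refl Q M A ⟩
        Q * Q - Q + + 1 + Q * M - A ∎

      -- Here 3 k - k² = k (3 - k) is 2 at k = 1 and at k = 2; twice the quadric count removes both
      -- the class c2 and the arc.
      2W₁≡ : W₁ * + 2 ≡ Q * Q + Q - Q * M
      2W₁≡ = begin
        W₁ * + 2
          ≡⟨ solve 4 (λ w₁ w₂ w₃ a → w₁ :* con (+ 2) :=
               con (+ 3) :* (a :+ w₁ :+ con (+ 2) :* w₂ :+ con (+ 3) :* w₃)
               :- (a :+ w₁ :+ con (+ 4) :* w₂ :+ con (+ 9) :* w₃) :- con (+ 2) :* (w₂ :+ a)) refl W₁ W₂ W₃ A ⟩
        + 3 * (A + W₁ + + 2 * W₂ + + 3 * W₃) - (A + W₁ + + 4 * W₂ + + 9 * W₃) - + 2 * (W₂ + A)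
          ≡⟨ cong₂ _-_ (cong₂ (λ y z → + 3 * y - z) first second) (cong (+ 2 *_) quadric) ⟩
        + 3 * ((Q + + 1) * (Q + + 1)) - ((Q + + 1) * (Q + + 1) + Q * (Q + + 1) + Q * M) - + 2 * (Q + + 1)
          ≡⟨ solve 2 (λ q m → con (+ 3) :* ((q :+ con (+ 1)) :* (q :+ con (+ 1)))
               :- ((q :+ con (+ 1)) :* (q :+ con (+ 1)) :+ q :* (q :+ con (+ 1)) :+ q :* m) :- con (+ 2) :* (q :+ con (+ 1)) :=
               q :* q :+ q :- q :* m) refl Q M ⟩
        Q * Q + Q - Q * M ∎

      -- Here k² - k is 6 at k = 3 and 2 at k = 2; subtracting twice the quadric count takes off the
      -- arc twice, which is then restored.
      6W₃≡ : W₃ * + 6 ≡ Q * Q - Q - + 2 + Q * M + + 2 * A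
      6W₃≡ = begin
        W₃ * + 6
          ≡⟨ solve 4 (λ w₁ w₂ w₃ a → w₃ :* con (+ 6) :=
               (a :+ w₁ :+ con (+ 4) :* w₂ :+ con (+ 9) :* w₃) :- (a :+ w₁ :+ con (+ 2) :* w₂ :+ con (+ 3) :* w₃)
               :- con (+ 2) :* (w₂ :+ a) :+ con (+ 2) :* a) refl W₁ W₂ W₃ A ⟩
        (A + W₁ + + 4 * W₂ + + 9 * W₃) - (A + W₁ + + 2 * W₂ + + 3 * W₃) - + 2 * (W₂ + A) + + 2 * A
          ≡⟨ cong (_+ + 2 * A) (cong₂ _-_ (cong₂ _-_ second first) (cong (+ 2 *_) quadric)) ⟩
        ((Q + + 1) * (Q + + 1) + Q * (Q + + 1) + Q * M) - (Q + + 1) * (Q + + 1) - + 2 * (Q + + 1) + + 2 * A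
          ≡⟨ solve 3 (λ q m a → ((q :+ con (+ 1)) :* (q :+ con (+ 1)) :+ q :* (q :+ con (+ 1)) :+ q :* m)
               :- (q :+ con (+ 1)) :* (q :+ con (+ 1)) :- con (+ 2) :* (q :+ con (+ 1)) :+ con (+ 2) :* a :=
               q :* q :- q :- con (+ 2) :+ q :* m :+ con (+ 2) :* a) refl Q M A ⟩
        Q * Q - Q - + 2 + Q * M + + 2 * A ∎

    -- The equation for W c3 modulo 3 determines m ≤ 2.
    chords≡ : ∀ {ξ} b → A ≡ b * + 3 → m ℕ.≤ 2 → ξ ≡ 1ℤ ⊎ ξ ≡ -1ℤ → + 3 ∣ (Q - ξ) → M ≡ ξ + + 1
    chords≡ {ξ} b A≡ m≤2 ξ≡±1 3∣ with Signed.divides j q-ξ≡3j ← Signed.∣ᵤ⇒∣ 3∣ = conclude ξ≡±1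
      where
      Q≡ : Q ≡ ξ + j * + 3
      Q≡ = trans (solve 2 (λ q x → q := x :+ (q :- x)) refl Q ξ) (cong (λ z → ξ + z) q-ξ≡3j)
      6W₃≡′ : W₃ * + 6 ≡ (ξ + j * + 3) * (ξ + j * + 3) - (ξ + j * + 3) - + 2 + (ξ + j * + 3) * M + + 2 * (b * + 3)
      6W₃≡′ = trans 6W₃≡ (cong₂ (λ q a → q * q - q - + 2 + q * M + + 2 * a) Q≡ A≡)
      conclude : ξ ≡ 1ℤ ⊎ ξ ≡ -1ℤ → M ≡ ξ + + 1
      -- For q ≡ 1 the right side of the equation for 6 W₃ is m - 2 modulo 3.
      conclude (inj₁ refl) = small m m≤2 (Signed.∣⇒∣ᵤ (Signed.divides (W₃ * + 2 - j - + 3 * (j * j) - j * M - + 2 * b) (begin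
        M - + 2
          ≡⟨ solve 3 (λ m j b → m :- con (+ 2) :=
               ((con (+ 1) :+ j :* con (+ 3)) :* (con (+ 1) :+ j :* con (+ 3)) :- (con (+ 1) :+ j :* con (+ 3)) :- con (+ 2)
               :+ (con (+ 1) :+ j :* con (+ 3)) :* m :+ con (+ 2) :* (b :* con (+ 3)))
               :- (j :+ con (+ 3) :* (j :* j) :+ j :* m :+ con (+ 2) :* b) :* con (+ 3)) refl M j b ⟩
        _ ≡⟨ cong (_- (j + + 3 * (j * j) + j * M + + 2 * b) * + 3) (sym 6W₃≡′) ⟩
        W₃ * + 6 - (j + + 3 * (j * j) + j * M + + 2 * b) * + 3
          ≡⟨ solve 4 (λ w j m b → w :* con (+ 6) :- (j :+ con (+ 3) :* (j :* j) :+ j :* m :+ con (+ 2) :* b) :* con (+ 3) :=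
               (w :* con (+ 2) :- j :- con (+ 3) :* (j :* j) :- j :* m :- con (+ 2) :* b) :* con (+ 3)) refl W₃ j M b ⟩
        (W₃ * + 2 - j - + 3 * (j * j) - j * M - + 2 * b) * + 3 ∎)))
        where
        small : ∀ m → m ℕ.≤ 2 → + 3 ∣ (+ m - + 2) → + m ≡ + 2
        small 0 _ 3∣2 = contradiction 3∣2 (from-no (3 ∣? 2))
        small 1 _ 3∣1 = contradiction 3∣1 (from-no (3 ∣? 1))
        small 2 _ _ = refl
        small (suc (suc (suc _))) (ℕ.s≤s (ℕ.s≤s ()))
      -- For q ≡ -1 the right side of the equation for 6 W₃ is -m modulo 3.
      conclude (inj₂ refl) = small m m≤2 (Signed.∣⇒∣ᵤ (Signed.divides (+ 3 * (j * j) - + 3 * j + j * M + + 2 * b - W₃ * + 2) (begin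
        M
          ≡⟨ solve 3 (λ m j b → m :=
               (con (+ 3) :* (j :* j) :- con (+ 3) :* j :+ j :* m :+ con (+ 2) :* b) :* con (+ 3) :-
               ((con -1ℤ :+ j :* con (+ 3)) :* (con -1ℤ :+ j :* con (+ 3)) :- (con -1ℤ :+ j :* con (+ 3)) :- con (+ 2)
               :+ (con -1ℤ :+ j :* con (+ 3)) :* m :+ con (+ 2) :* (b :* con (+ 3)))) refl M j b ⟩
        _ ≡⟨ cong (λ z → (+ 3 * (j * j) - + 3 * j + j * M + + 2 * b) * + 3 - z) (sym 6W₃≡′) ⟩
        (+ 3 * (j * j) - + 3 * j + j * M + + 2 * b) * + 3 - W₃ * + 6
          ≡⟨ solve 4 (λ w j m b → (con (+ 3) :* (j :* j) :- con (+ 3) :* j :+ j :* m :+ con (+ 2) :* b) :* con (+ 3) :- w :* con (+ 6) :=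
               (con (+ 3) :* (j :* j) :- con (+ 3) :* j :+ j :* m :+ con (+ 2) :* b :- w :* con (+ 2)) :* con (+ 3)) refl W₃ j M b ⟩
        (+ 3 * (j * j) - + 3 * j + j * M + + 2 * b - W₃ * + 2) * + 3 ∎)))
        where
        small : ∀ m → m ℕ.≤ 2 → + 3 ∣ + m → + m ≡ + 0
        small 0 _ _ = refl
        small 1 _ 3∣1 = contradiction 3∣1 (from-no (3 ∣? 1))
        small 2 _ 3∣2 = contradiction 3∣2 (from-no (3 ∣? 2))
        small (suc (suc (suc _))) (ℕ.s≤s (ℕ.s≤s ()))

    private
      via : ∀ {k M′} (f : ℤ → ℤ) → k ≡ f M → M ≡ M′ → k ≡ f M′
      via f eq M≡ = trans eq (cong f M≡)

    -- Equality of unnormalised rationals is cross-multiplied, so the equations with cleared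
    -- denominators apply directly, and divisibility of the numerators is a consequence.
    class-counts₀ : ∀ {ξ} → a ≡ 0 → M ≡ ξ + + 1 → ∀ d → (+ W d) / 1 ≃ r₀ Q ξ d
    class-counts₀ refl M≡ cq+1 = *≡* (cong (_* + 1) arc)
    class-counts₀ {ξ} refl M≡ c0 = *≡* (trans (via (λ z → Q * Q - Q + + 1 + Q * z - + 0) 3W₀≡ M≡)
      (solve 2 (λ q x → q :* q :- q :+ con (+ 1) :+ q :* (x :+ con (+ 1)) :- con (+ 0) :=
        (q :* q :+ x :* q :+ con (+ 1)) :* con (+ 1)) refl Q ξ))
    class-counts₀ {ξ} refl M≡ c1 = *≡* (trans (via (λ z → Q * Q + Q - Q * z) 2W₁≡ M≡)
      (solve 2 (λ q x → q :* q :+ q :- q :* (x :+ con (+ 1)) := (q :* (q :- x)) :* con (+ 1)) refl Q ξ))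
    class-counts₀ refl M≡ c2 = *≡* (trans (cong (_* + 1) W₂≡)
      (solve 1 (λ q → (q :+ con (+ 1) :- con (+ 0)) :* con (+ 1) := (q :+ con (+ 1)) :* con (+ 1)) refl Q))
    class-counts₀ {ξ} refl M≡ c3 = *≡* (trans (via (λ z → Q * Q - Q - + 2 + Q * z + + 2 * + 0) 6W₃≡ M≡)
      (solve 2 (λ q x → q :* q :- q :- con (+ 2) :+ q :* (x :+ con (+ 1)) :+ con (+ 2) :* con (+ 0) :=
        (q :* q :+ x :* q :- con (+ 2)) :* con (+ 1)) refl Q ξ))

    class-counts₃ : ∀ {ξ} → a ≡ 3 → M ≡ ξ + + 1 → ∀ d → (+ W d) / 1 ≃ r₃ Q ξ d
    class-counts₃ refl M≡ cq+1 = *≡* (cong (_* + 1) arc)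
    class-counts₃ {ξ} refl M≡ c0 = *≡* (trans (via (λ z → Q * Q - Q + + 1 + Q * z - + 3) 3W₀≡ M≡)
      (solve 2 (λ q x → q :* q :- q :+ con (+ 1) :+ q :* (x :+ con (+ 1)) :- con (+ 3) :=
        (q :* q :+ x :* q :- con (+ 2)) :* con (+ 1)) refl Q ξ))
    class-counts₃ {ξ} refl M≡ c1 = *≡* (trans (via (λ z → Q * Q + Q - Q * z) 2W₁≡ M≡)
      (solve 2 (λ q x → q :* q :+ q :- q :* (x :+ con (+ 1)) := (q :* (q :- x)) :* con (+ 1)) refl Q ξ))
    class-counts₃ refl M≡ c2 = *≡* (trans (cong (_* + 1) W₂≡)
      (solve 1 (λ q → (q :+ con (+ 1) :- con (+ 3)) :* con (+ 1) := (q :- con (+ 2)) :* con (+ 1)) refl Q))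
    class-counts₃ {ξ} refl M≡ c3 = *≡* (trans (via (λ z → Q * Q - Q - + 2 + Q * z + + 2 * + 3) 6W₃≡ M≡)
      (solve 2 (λ q x → q :* q :- q :- con (+ 2) :+ q :* (x :+ con (+ 1)) :+ con (+ 2) :* con (+ 3) :=
        (q :* q :+ x :* q :+ con (+ 4)) :* con (+ 1)) refl Q ξ))

open ClassArithmetic

-- The counts for points with no or three osculating planes

open import Data.Nat.Base using (_≤_; _^_)
open import Data.Integer.Base as ℤ using (ℤ; +_; _-_; 1ℤ; -1ℤ)
open import Data.Integer.Divisibility using (_∣_)

proposition3p9 : ∀ {c ℓ : Level} (n h : ℕ) (ξ : ℤ) (F : Field c ℓ) →
    let q = 2 ^ n
        open PG3 F
        open Arc h
    in
    3 ≤ n →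
    1 ≤ h →
    gcd n h ≡ 1 →
    (ξ ≡ 1ℤ ⊎ ξ ≡ -1ℤ) →
    + 3 ∣ (+ q - ξ) →
    HasCardinality (Field.setoid F) q →
    (∀ (Q : Point) → 𝒪 c0 Q → ∀ (d : Class) →
    HasCardinalityℚ (PlanesThrough d Q) (r₀ (+ q) ξ d)) ×
    (∀ (Q : Point) → 𝒪 c3 Q → ∀ (d : Class) →
    HasCardinalityℚ (PlanesThrough d Q) (r₃ (+ q) ξ d))
proposition3p9 n h ξ F _ _ coprime ξ≡±1 3∣q-ξ card = in-𝒪₀ , in-𝒪₃
  where
  open PG3 F using (Point; module Arc)
  open Arc h
  open FiniteCopy F card using (copy)
  open Transfer F n h coprime card
  open Geometry n copy h coprime
  open Classification n copy h coprime
  open Incidence n copy h coprime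
  open Moments n copy h coprime

  module _ (Q : Point) (generic : Z (det (nf Q)) ≡ 0) where

    det≢0 : det (nf Q) ≢ _
    det≢0 det≡0 with () ← trans (sym (Z-yes det≡0)) generic

    equations : ClassEquations (2 ^ n) (chords (nf Q)) (osculating (nf Q)) (classCount (nf Q))
    equations = record
      { arc-count     = count-arc (nf Q)
      ; quadric-count = count-quadric (nf Q) det≢0
      ; total         = count-all (nf Q) det≢0
      ; first-moment  = count-osculating (nf Q) det≢0
      ; second-moment = count-osculating² (nf Q) det≢0
      }

    chords≡ξ+1 : ∀ b → + osculating (nf Q) ≡ b ℤ.* + 3 → + chords (nf Q) ≡ ξ ℤ.+ + 1
    chords≡ξ+1 b osculating≡ = chords≡ equations b osculating≡ (chords≤2 (nf Q) det≢0) ξ≡±1 3∣q-ξ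

  in-𝒪₀ : ∀ Q → 𝒪 c0 Q → ∀ d → HasCardinalityℚ (PlanesThrough d Q) (r₀ (+ (2 ^ n)) ξ d)
  in-𝒪₀ Q Q∈𝒪₀ d =
    classCount (nf Q) d ,
    class-counts₀ (equations Q generic) N≡0 (chords≡ξ+1 Q generic (+ 0) (cong +_ N≡0)) d ,
    planesThrough-cardinality d Q
    where
    member = 𝒪⇒member c0 {Q} Q∈𝒪₀
    N≡0 : osculating (nf Q) ≡ 0
    N≡0 = proj₂ member
    generic : Z (det (nf Q)) ≡ 0
    generic = member⇒off-quadric (kind (nf-normalForm Q)) (inj₁ member)

  in-𝒪₃ : ∀ Q → 𝒪 c3 Q → ∀ d → HasCardinalityℚ (PlanesThrough d Q) (r₃ (+ (2 ^ n)) ξ d)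
  in-𝒪₃ Q Q∈𝒪₃ d =
    classCount (nf Q) d ,
    class-counts₃ (equations Q generic) N≡3 (chords≡ξ+1 Q generic (+ 1) (cong +_ N≡3)) d ,
    planesThrough-cardinality d Q
    where
    member = 𝒪⇒member c3 {Q} Q∈𝒪₃
    N≡3 : osculating (nf Q) ≡ 3
    N≡3 = proj₂ member
    generic : Z (det (nf Q)) ≡ 0
    generic = member⇒off-quadric (kind (nf-normalForm Q)) (inj₂ member)
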